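{- Let $\Gamma=(G,\sigma)$ be a connected signed graph on $n\geq 2$ vertices $1,\ldots,n$ and $m$ edges $e_1,\ldots,e_m$ with incidence matrix $N$ and Moore–Penrose inverse $N^\dagger$ (rows indexed by edges, columns by vertices). \begin{enumerate} \item[(a)] If $\Gamma$ is balanced, then \[(N^\dagger)_{ij}=\frac{1}{\tau(\Gamma)}\sum_{T\in\mathcal S(\Gamma),\ e_i\in T}(N_T^\dagger)_{ij},\] where for a spanning tree $T$ containing $e_i$, \[(N_T^\dagger)_{ij}=\frac{w(e_i)\,\mathrm{sgn}(P_{e_i-j})}{n}\begin{cases}|T_h(e_i)| & \text{if } j\in T_t(e_i),\\ -\sigma(e_i)|T_t(e_i)| & \text{if } j\in T_h(e_i),\end{cases}\] with the path $P_{e_i-j}$ taken in $T$. \item[(b)] If $\Gamma$ is unbalanced, then \[(N^\dagger)_{ij}=\frac{1}{\sum_{H\in\mathcal{TU}_n(\Gamma)}4^{c(H)}}\sum_{H\in\mathcal{TU}_n(\Gamma),\ e_i\in H}4^{c(H)}\,(N_H^{ -1})_{ij},\] where, if $e_i$ lies in the component $U=U^H_r$ of $H$ with cycle $C=C^H_r$: $(N_H^{ -1})_{ij}=0$ if $j\notin V(U)$, and for $j\in V(U)$, \[(N_H^{ -1})_{ij}=w(e_i)\begin{cases}\tfrac12\mathrm{sgn}(P_{e_i^t-j}) & \text{if } e_i\in C,\\ 0 & \text{if } e_i\notin C \text{ and } j\in U\setminus e_i[C],\\ -\mathrm{sgn}(P_{e_i-j}) & \text{if } e_i \text{ positive}, e_i\notin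 E(C),\ j\notin U\setminus e_i[C],\ j\in U_h(e_i),\\ \mathrm{sgn}(P_{e_i-j}) & \text{otherwise.}\end{cases}\] \end{enumerate}
   Context: Signed graph $\Gamma=(G,\sigma)$: simple graph $G$ with $\sigma:E\to\{ -1,1\}$; $e$ positive if $\sigma(e)=1$, negative if $\sigma(e)=-1$. $\mathrm{sgn}(P)$ is the product of $\sigma$ over the edges of a path $P$ (1 if empty). A cycle is balanced if it has an even number of negative edges; $\Gamma$ is balanced if all cycles are balanced, otherwise unbalanced. An incidence matrix $N=[n_{k\ell}]$ is an $n\times m$ matrix (rows = vertices, columns = edges) such that for $e_\ell=\{i,j\}$ column $\ell$ has exactly two nonzero entries $n_{i\ell},n_{j\ell}\in\{\pm1\}$, with $n_{i\ell}=n_{j\ell}$ if $e_\ell$ negative and $n_{i\ell}=-n_{j\ell}$ if positive. Head/tail: a positive edge $\{l,m\}$ with $n_{l\ell}=1,n_{m\ell}=-1$ has tail $l$, head $m$; a negative edge $\{l,m\}$ with $l<m$ has tail $l$, head $m$. $w(e_\ell)=-1$ if $e_\ell$ is negative with both nonzero entries of column $\ell$ equal to $-1$, else $w(e_\ell)=1$. $\mathcal S(\Gamma)$ is the set of spanning trees, $\tau(\Gamma)=|\mathcal S(\Gamma)|$. For a tree $T\ni e_i$, $T_h(e_i)$, $T_t(e_i)$ are the components of $T\setminus e_i$ containing the head and tail of $e_i$, $|\cdot|$ is the number of vertices, and $P_{e_i-j}$ is the shortest path (in the relevant subgraph) between vertex $j$ and edge $e_i$ not containing $e_i$. $\mathcal{TU}_n(\Gamma)$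 is the set of spanning subgraphs $H$ of $\Gamma$ with exactly $n$ edges each of whose components is a tree or an unbalanced unicyclic graph; $c(H)$ is the number of its unbalanced unicyclic components $U^H_1,\ldots,U^H_{c(H)}$ with cycles $C^H_1,\ldots,C^H_{c(H)}$. For a unicyclic $U$ with cycle $C$ and $e_i\notin C$: $U\setminus e_i[C]$ is the component of $U\setminus e_i$ containing $C$, $U_h(e_i)$ the component of $U\setminus e_i$ containing the head of $e_i$. For $e_i\in C$, $e_i^t$ is its tail and $P_{e_i^t-j}$ is the path between $e_i^t$ and $j$ in the tree $U\setminus e_i$. -}

module Defs where

open import Data.Bool using (Bool; true; false; _∧_; _∨_; not; if_then_else_)
open import Data.Nat as ℕ using (ℕ; zero; suc)
open import Data.Fin as Fin using (Fin; zero; suc; toℕ)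
open import Data.Fin.Properties using () renaming (_≟_ to _≟F_)
open import Data.Product using (_×_; _,_; proj₁; proj₂; swap)
open import Data.Sum using (_⊎_)
open import Data.List as List using (List; []; _∷_; length; filterᵇ; foldr; concatMap; allFin)
open import Data.Maybe using (Maybe; just; nothing)
import Data.Maybe as Maybe
open import Data.Integer as ℤ using (ℤ; +_)
open import Data.Rational as ℚ using (ℚ; 0ℚ)
open import Data.Sign using (Sign)
import Data.Sign as Sign
open import Relation.Nullary using (¬_)
open import Relation.Nullary.Decidable using (⌊_⌋)
open import Relation.Binary.PropositionalEquality using (_≡_; _≢_)

eqF : ∀ {k} → Fin k → Fin k → Bool
eqF a b = ⌊ a ≟F b ⌋

eqℤ : ℤ → ℤ → Bool
eqℤ a b = ⌊ a ℤ.≟ b ⌋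

eqℕ : ℕ → ℕ → Bool
eqℕ a b = ⌊ a ℕ.≟ b ⌋

anyF : ∀ {k} → (Fin k → Bool) → Bool
anyF {zero} p = false
anyF {suc k} p = p zero ∨ anyF (λ i → p (suc i))

allF : ∀ {k} → (Fin k → Bool) → Bool
allF {zero} p = true
allF {suc k} p = p zero ∧ allF (λ i → p (suc i))

countF : ∀ {k} → (Fin k → Bool) → ℕ
countF {zero} p = 0
countF {suc k} p = (if p zero then 1 else 0) ℕ.+ countF (λ i → p (suc i))

sumℚ : ∀ {k} → (Fin k → ℚ) → ℚ
sumℚ {zero} f = 0ℚ
sumℚ {suc k} f = f zero ℚ.+ sumℚ (λ i → f (suc i))

sumListℚ : List ℚ → ℚ
sumListℚ = foldr ℚ._+_ 0ℚ

sumListℤ : List ℤ → ℤ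
sumListℤ = foldr ℤ._+_ (+ 0)

ℕtoℚ : ℕ → ℚ
ℕtoℚ k = (+ k) ℚ./ 1

-- integer divided by a natural number as a rational (only ever used with d ≥ 1)
divℚ : ℤ → ℕ → ℚ
divℚ z zero = 0ℚ
divℚ z (suc d) = z ℚ./ suc d

-- rational divided by a natural number (only ever used with d ≥ 1)
_÷ℕ_ : ℚ → ℕ → ℚ
q ÷ℕ zero = 0ℚ
q ÷ℕ suc d = q ℚ.* ((+ 1) ℚ./ suc d)

even : ℕ → Bool
even zero = true
even (suc k) = not (even k)

extend : ∀ {m} → Bool → (Fin m → Bool) → Fin (suc m) → Bool
extend b f zero = b
extend b f (suc i) = f i

subsets : (m : ℕ) → List (Fin m → Bool)
subsets zero = (λ ()) ∷ []
subsets (suc m) = concatMap (λ f → extend false f ∷ extend true f ∷ []) (subsets m)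

anyList : ∀ {A : Set} → (A → Bool) → List A → Bool
anyList p = foldr (λ x b → p x ∨ b) false

distinct : ∀ {k} → List (Fin k) → Bool
distinct [] = true
distinct (x ∷ xs) = not (anyList (eqF x) xs) ∧ distinct xs

lastIs : ∀ {k} → List (Fin k) → Fin k → Bool
lastIs [] v = false
lastIs (x ∷ []) v = eqF x v
lastIs (x ∷ y ∷ xs) v = lastIs (y ∷ xs) v

signℤ : Sign → ℤ
signℤ Sign.+ = + 1
signℤ Sign.- = ℤ.- (+ 1)

record SignedGraph (n m : ℕ) : Set where
  field
    ends     : Fin m → Fin n × Fin n
    σ        : Fin m → Sign
    loopless : ∀ ℓ → proj₁ (ends ℓ) ≢ proj₂ (ends ℓ)
    simple   : ∀ k ℓ → (ends k ≡ ends ℓ ⊎ ends k ≡ swap (ends ℓ)) → k ≡ ℓ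

EdgeSet : ℕ → Set
EdgeSet m = Fin m → Bool

Matrix : Set → ℕ → ℕ → Set
Matrix A r c = Fin r → Fin c → A

module _ {n m : ℕ} (Γ : SignedGraph n m) where
  open SignedGraph Γ

  incident : Fin m → Fin n → Bool
  incident e v = eqF (proj₁ (ends e)) v ∨ eqF (proj₂ (ends e)) v

  -- the endpoint of e other than v (v assumed to be an endpoint)
  other : Fin m → Fin n → Fin n
  other e v = if eqF (proj₁ (ends e)) v then proj₂ (ends e) else proj₁ (ends e)

  isNeg : Fin m → Bool
  isNeg e with σ e
  ... | Sign.- = true
  ... | Sign.+ = false

  allEdges : EdgeSet m
  allEdges _ = true

  remove : EdgeSet m → Fin m → EdgeSet m
  remove S e f = S f ∧ not (eqF f e)

  reachN : EdgeSet m → ℕ → Fin n → Fin n → Bool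
  reachN S zero u v = eqF u v
  reachN S (suc k) u v = reachN S k u v ∨ anyF (λ e → S e ∧
      ((reachN S k u (proj₁ (ends e)) ∧ eqF (proj₂ (ends e)) v) ∨
       (reachN S k u (proj₂ (ends e)) ∧ eqF (proj₁ (ends e)) v)))

  conn : EdgeSet m → Fin n → Fin n → Bool
  conn S u v = reachN S n u v

  Connected : Set
  Connected = ∀ u v → conn allEdges u v ≡ true

  compSize : EdgeSet m → Fin n → ℕ
  compSize S v = countF (λ u → conn S v u)

  deg : EdgeSet m → Fin n → ℕ
  deg C v = countF (λ e → C e ∧ incident e v)

  isCycle : EdgeSet m → Bool
  isCycle C = anyF C
    ∧ allF (λ v → eqℕ (deg C v) 0 ∨ eqℕ (deg C v) 2)
    ∧ allF (λ u → allF (λ v → not (eqℕ (deg C u) 2 ∧ eqℕ (deg C v) 2) ∨ conn C u v))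

  subsetOf : EdgeSet m → EdgeSet m → Bool
  subsetOf C S = allF (λ e → not (C e) ∨ S e)

  balancedCycle : EdgeSet m → Bool
  balancedCycle C = even (countF (λ e → C e ∧ isNeg e))

  Balanced : Set
  Balanced = ∀ C → isCycle C ≡ true → balancedCycle C ≡ true

  cyclesIn : EdgeSet m → List (EdgeSet m)
  cyclesIn S = filterᵇ (λ C → isCycle C ∧ subsetOf C S) (subsets m)

  isSpanningTree : EdgeSet m → Bool
  isSpanningTree T = allF (λ u → allF (λ v → conn T u v)) ∧ List.null (cyclesIn T)

  spanningTrees : List (EdgeSet m)
  spanningTrees = filterᵇ isSpanningTree (subsets m)

  τ : ℕ
  τ = length spanningTrees

  walkVerts : EdgeSet m → Fin n → List (Fin m) → Maybe (List (Fin n))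
  walkVerts S u [] = just (u ∷ [])
  walkVerts S u (e ∷ es) =
    if S e ∧ incident e u then Maybe.map (u ∷_) (walkVerts S (other e u) es) else nothing

  isPath : EdgeSet m → Fin n → List (Fin m) → Fin n → Bool
  isPath S u es v with walkVerts S u es
  ... | just vs = distinct vs ∧ lastIs vs v
  ... | nothing = false

  listsUpTo : ℕ → List (List (Fin m))
  listsUpTo zero = [] ∷ []
  listsUpTo (suc k) = [] ∷ concatMap (λ e → List.map (e ∷_) (listsUpTo k)) (allFin m)

  sgnList : List (Fin m) → ℤ
  sgnList = foldr (λ e z → signℤ (σ e) ℤ.* z) (+ 1)

  -- sum of sgn(P) over all paths P in S from u to v; when S is a forest and u, v
  -- are in the same component this is sgn of the unique u–v path (1 if u = v)
  pathSgn : EdgeSet m → Fin n → Fin n → ℤ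
  pathSgn S u v = sumListℤ (List.map sgnList (filterᵇ (λ es → isPath S u es v) (listsUpTo n)))

  IsIncidenceMatrix : Matrix ℤ n m → Set
  IsIncidenceMatrix N = ∀ ℓ →
      (∀ k → k ≢ proj₁ (ends ℓ) → k ≢ proj₂ (ends ℓ) → N k ℓ ≡ + 0)
    × (N (proj₁ (ends ℓ)) ℓ ≡ + 1 ⊎ N (proj₁ (ends ℓ)) ℓ ≡ ℤ.- (+ 1))
    × (N (proj₂ (ends ℓ)) ℓ ≡ + 1 ⊎ N (proj₂ (ends ℓ)) ℓ ≡ ℤ.- (+ 1))
    × (σ ℓ ≡ Sign.- → N (proj₁ (ends ℓ)) ℓ ≡ N (proj₂ (ends ℓ)) ℓ)
    × (σ ℓ ≡ Sign.+ → N (proj₁ (ends ℓ)) ℓ ≡ ℤ.- N (proj₂ (ends ℓ)) ℓ)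

  module _ (N : Matrix ℤ n m) where

    tail : Fin m → Fin n
    tail e with σ e
    ... | Sign.+ = if eqℤ (N (proj₁ (ends e)) e) (+ 1) then proj₁ (ends e) else proj₂ (ends e)
    ... | Sign.- = if toℕ (proj₁ (ends e)) ℕ.<ᵇ toℕ (proj₂ (ends e)) then proj₁ (ends e) else proj₂ (ends e)

    head : Fin m → Fin n
    head e with σ e
    ... | Sign.+ = if eqℤ (N (proj₁ (ends e)) e) (+ 1) then proj₂ (ends e) else proj₁ (ends e)
    ... | Sign.- = if toℕ (proj₁ (ends e)) ℕ.<ᵇ toℕ (proj₂ (ends e)) then proj₂ (ends e) else proj₁ (ends e)

    w : Fin m → ℤ
    w e = if isNeg e ∧ eqℤ (N (proj₁ (ends e)) e) (ℤ.- (+ 1)) ∧ eqℤ (N (proj₂ (ends e)) e) (ℤ.- (+ 1))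
          then ℤ.- (+ 1) else + 1

    -- sgn(P_{e-j}) where F = (edge set) \ e: path in F from j to the endpoint of e
    -- lying in the same component of F as j
    sgnPe : EdgeSet m → Fin m → Fin n → ℤ
    sgnPe F e j = if conn F (head e) j then pathSgn F (head e) j else pathSgn F (tail e) j

    NTdag : EdgeSet m → Fin m → Fin n → ℚ
    NTdag T i j =
      let F = remove T i in
      if conn F (tail i) j
      then divℚ (w i ℤ.* sgnPe F i j ℤ.* (+ compSize F (head i))) n
      else divℚ (w i ℤ.* sgnPe F i j ℤ.* (ℤ.- signℤ (σ i)) ℤ.* (+ compSize F (tail i))) n

    formulaA : Fin m → Fin n → ℚ
    formulaA i j = sumListℚ (List.map (λ T → NTdag T i j) (filterᵇ (λ T → T i) spanningTrees)) ÷ℕ τ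

    inComp : EdgeSet m → Fin n → EdgeSet m → Bool
    inComp H v C = allF (λ e → not (C e) ∨ conn H v (proj₁ (ends e)))

    -- H ∈ TU_n(Γ): exactly n edges, every component a tree (no cycle) or
    -- unicyclic (exactly one cycle) with unbalanced cycle
    compOK : List (EdgeSet m) → Bool
    compOK [] = true
    compOK (C ∷ []) = not (balancedCycle C)
    compOK (C ∷ D ∷ cs) = false

    isTU : EdgeSet m → Bool
    isTU H = eqℕ (countF H) n ∧ allF (λ v → compOK (filterᵇ (inComp H v) (cyclesIn H)))

    TU : List (EdgeSet m)
    TU = filterᵇ isTU (subsets m)

    -- c(H) = number of (unbalanced unicyclic) components = number of cycles of H
    c : EdgeSet m → ℕ
    c H = length (cyclesIn H)

    onCycle : EdgeSet m → Fin m → Bool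
    onCycle H e = anyList (λ C → C e) (cyclesIn H)

    touchesCycle : EdgeSet m → Fin n → Bool
    touchesCycle H v = anyF (λ e → onCycle H e ∧ incident e v)

    inCside : EdgeSet m → Fin m → Fin n → Bool
    inCside H i j = anyF (λ v → touchesCycle H v ∧ conn (remove H i) j v)

    NHinv : EdgeSet m → Fin m → Fin n → ℚ
    NHinv H i j =
      let F = remove H i in
      if not (conn H (tail i) j) then 0ℚ
      else if onCycle H i then divℚ (w i ℤ.* pathSgn F (tail i) j) 2
      else if inCside H i j then 0ℚ
      else if not (isNeg i) ∧ conn F (head i) j then divℚ (ℤ.- (w i ℤ.* sgnPe F i j)) 1
      else divℚ (w i ℤ.* sgnPe F i j) 1

    formulaB : Fin m → Fin n → ℚ
    formulaB i j =
      sumListℚ (List.map (λ H → ℕtoℚ (4 ℕ.^ c H) ℚ.* NHinv H i j) (filterᵇ (λ H → H i) TU))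
      ÷ℕ foldr ℕ._+_ 0 (List.map (λ H → 4 ℕ.^ c H) TU)

-- Moore–Penrose inverse (over ℚ; transpose = conjugate transpose)

_·_ : ∀ {r k s} → Matrix ℚ r k → Matrix ℚ k s → Matrix ℚ r s
(A · B) a b = sumℚ (λ t → A a t ℚ.* B t b)

transpose : ∀ {r s} → Matrix ℚ r s → Matrix ℚ s r
transpose A a b = A b a

toℚM : ∀ {r s} → Matrix ℤ r s → Matrix ℚ r s
toℚM A a b = A a b ℚ./ 1

infix 4 _≐_
infixl 7 _·_

_≐_ : ∀ {r s} → Matrix ℚ r s → Matrix ℚ r s → Set
A ≐ B = ∀ a b → A a b ≡ B a b

IsMoorePenroseInverse : ∀ {r s} → Matrix ℚ r s → Matrix ℚ s r → Set
IsMoorePenroseInverse A X =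
    ((A · X) · A ≐ A)
  × ((X · A) · X ≐ X)
  × (transpose (A · X) ≐ (A · X))
  × (transpose (X · A) ≐ (X · A))

{-# OPTIONS --safe #-}
-- Both parts are instances of one principle (BasisFamily).  Let 𝓑 be a family of column bases
-- H of N, with rows R_H(e) dual to the columns in H and orthogonal to the left kernel of N,
-- and with weights such that α = R_H(e) N_f ≠ 0 implies H − e + f ∈ 𝓑 and
-- wt (H − e + f) = α² wt H.  Put W = Σ wt H and Y = Σ wt H · R_H.  Every R_H is an inner inverse
-- of N, so N Y N = W N; the exchange H ↔ H − e + f shows that Y N is symmetric; and Y N N† = Y
-- because the rows of Y are orthogonal to the left kernel.  Hence W N† = Y.
--
-- The rows are found combinatorially: y N_f = 0 says that the entries of y at the ends of f
-- agree up to the sign of f.  Hence a vector annihilating the edges of a component without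
-- cycles is a multiple of the path signs, and around a cycle it is multiplied by the sign of
-- the cycle.  For spanning trees all weights are 1.  For TU-subgraphs wt H = 4^c(H): removing e
-- divides the weight by 4 exactly when e lies on a cycle, and this is also when the dual row
-- has entries ±½ instead of ±1.  That TU-subgraphs are exactly the n-edge sets without left
-- kernel follows by deleting an edge of a balanced cycle, or of one of two cycles in the same
-- component, which creates no kernel, and counting dimensions.
module Submission where

open import Defs
open import Algebra.Bundles using (CommutativeMonoid; CommutativeRing)
import Algebra.Properties.CommutativeMonoid.Sum as MonoidSum
import Algebra.Properties.Semiring.Sum as SemiringSum
open import Data.Bool using (Bool; true; false; _∧_; _∨_; _xor_; not; if_then_else_)
open import Data.Bool.Properties using (T-≡; T?; not-involutive; xor-same; xor-comm; ∧-distribˡ-xor; ∧-zeroʳ; xor-∧-commutativeRing)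
  renaming (_≟_ to _≟B_)
open import Data.Empty using (⊥; ⊥-elim)
open import Data.Fin using (Fin; zero; suc; toℕ; punchIn; punchOut)
open import Data.Fin.Properties using (suc-injective; injective⇒≤; punchIn-punchOut)
  renaming (_≟_ to _≟F_)
open import Data.Integer as ℤ using (ℤ)
import Data.Integer.Properties as ℤP
open import Data.List as List using (List; []; _∷_; length; map; filterᵇ; foldr; concatMap; allFin; lookup)
open import Data.List.Membership.Propositional using (_∈_; _∉_; find; lose)
open import Data.List.Membership.Propositional.Properties
  using (∈-filter⁺; ∈-filter⁻; ∈-concatMap⁺; ∈-concatMap⁻; ∈-map⁺; ∈-map⁻; ∈-allFin; ∈-lookup)
open import Data.List.Membership.DecPropositional using () renaming (_∈?_ to mem?)
open import Data.List.Relation.Unary.All as All using (All; []; _∷_)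
open import Data.List.Relation.Unary.AllPairs as AllPairs using (AllPairs; []; _∷_)
import Data.List.Relation.Unary.All.Properties as AllP
import Data.List.Relation.Unary.AllPairs.Properties as AllPairsP
open import Data.List.Relation.Unary.Any using (here; there)
open import Data.List.Relation.Unary.Unique.Propositional using (Unique)
import Data.List.Relation.Unary.Unique.Propositional.Properties as UniqueP
open import Data.Maybe using (just; nothing)
open import Data.Nat as ℕ using (ℕ; zero; suc; _≤_; _<_; s≤s)
import Data.Nat.Properties as ℕP
import Data.Nat.Tactic.RingSolver as ℕ-Ring
open import Data.Product using (∃; ∃₂; _×_; _,_; proj₁; proj₂)
open import Data.Rational as ℚ using (ℚ; 0ℚ; 1ℚ; ½; _+_; _*_; _-_; -_)
import Data.Rational.Properties as ℚP
import Data.Rational.Unnormalised as ℚᵘ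
import Data.Rational.Unnormalised.Properties as ℚᵘP
open import Data.Sign using (Sign)
open import Data.Sum using (_⊎_; inj₁; inj₂; [_,_]′)
open import Function using (_∘_; id; case_of_)
open import Function.Bundles using (Equivalence)
open import Level using (0ℓ)
open import Relation.Binary.PropositionalEquality
open import Relation.Nullary using (¬_; Dec; yes; no)
open import Relation.Nullary.Decidable using (⌊_⌋; dec⇒maybe)
open import Tactic.RingSolver using (solve-∀)
open import Tactic.RingSolver.Core.AlmostCommutativeRing using (AlmostCommutativeRing; fromCommutativeRing)

-- The rule wt (H - e + f) = α² wt H is Cramer's rule squared: exchanging the column e for f
-- multiplies a maximal minor by α up to sign. Demanding it directly replaces determinants
-- throughout. The weight 4^c(H) is the squared determinant of a TU-subgraph, because an unbalanced
-- cycle contributes ±2 and a bridge ±1. In the balanced case N has rank n - 1 and its left kernel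
-- is spanned by a switching function with values ±1. The row of a tree is a one-sided path-sign row
-- minus its projection onto that function; this is the origin of 1/n and of the component sizes. In
-- the unbalanced case the left kernel is zero. Dividing by W requires a member of the family, which
-- is found by deleting edges from the whole graph. Edge sets are Boolean functions compared
-- pointwise, without extensionality. Hence H - e + f is any function with the right values, and
-- existence statements pass through pointwise equal representatives.

-- Reflection of Boolean tests.

∧⁻ : ∀ {a b} → a ∧ b ≡ true → a ≡ true × b ≡ true
∧⁻ {true} {true} _ = refl , refl

∧⁺ : ∀ {a b} → a ≡ true → b ≡ true → a ∧ b ≡ true
∧⁺ refl refl = refl

∨⁻ : ∀ {a b} → a ∨ b ≡ true → a ≡ true ⊎ b ≡ true
∨⁻ {true}  _ = inj₁ refl
∨⁻ {false} p = inj₂ p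

∨⁺ˡ : ∀ {a b} → a ≡ true → a ∨ b ≡ true
∨⁺ˡ refl = refl

∨⁺ʳ : ∀ {a b} → b ≡ true → a ∨ b ≡ true
∨⁺ʳ {true}  _ = refl
∨⁺ʳ {false} p = p

not⁻ : ∀ {a} → not a ≡ true → a ≡ false
not⁻ {false} _ = refl

not⁺ : ∀ {a} → a ≡ false → not a ≡ true
not⁺ refl = refl

impl⁻ : ∀ {a b} → not a ∨ b ≡ true → a ≡ true → b ≡ true
impl⁻ p refl = p

impl⁺ : ∀ {a b} → (a ≡ true → b ≡ true) → not a ∨ b ≡ true
impl⁺ {true}  f = f refl
impl⁺ {false} _ = refl

true≢false : ∀ {b} → b ≡ true → b ≡ false → ⊥
true≢false refl ()

¬true⇒false : ∀ {b} → ¬ (b ≡ true) → b ≡ false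
¬true⇒false {true}  h = ⊥-elim (h refl)
¬true⇒false {false} _ = refl

iff⇒≡ : ∀ {a b} → (a ≡ true → b ≡ true) → (b ≡ true → a ≡ true) → a ≡ b
iff⇒≡ {true}  f _ = sym (f refl)
iff⇒≡ {false} {true}  _ g = g refl
iff⇒≡ {false} {false} _ _ = refl

⌊⌋⁺ : ∀ {A : Set} (d : Dec A) → A → ⌊ d ⌋ ≡ true
⌊⌋⁺ (yes _) _ = refl
⌊⌋⁺ (no ¬a) a = ⊥-elim (¬a a)

⌊⌋⁻ : ∀ {A : Set} (d : Dec A) → ⌊ d ⌋ ≡ true → A
⌊⌋⁻ (yes a) _ = a

⌊⌋-no : ∀ {A : Set} (d : Dec A) → ¬ A → ⌊ d ⌋ ≡ false
⌊⌋-no (yes a) ¬a = ⊥-elim (¬a a)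
⌊⌋-no (no _)  _  = refl

eqF⁺ : ∀ {k} {a b : Fin k} → a ≡ b → eqF a b ≡ true
eqF⁺ = ⌊⌋⁺ (_ ≟F _)

eqF⁻ : ∀ {k} {a b : Fin k} → eqF a b ≡ true → a ≡ b
eqF⁻ = ⌊⌋⁻ (_ ≟F _)

eqF-no : ∀ {k} {a b : Fin k} → a ≢ b → eqF a b ≡ false
eqF-no = ⌊⌋-no (_ ≟F _)

anyF⁺ : ∀ {k} (p : Fin k → Bool) i → p i ≡ true → anyF p ≡ true
anyF⁺ p zero    h = ∨⁺ˡ h
anyF⁺ p (suc i) h = ∨⁺ʳ {p zero} (anyF⁺ (p ∘ suc) i h)

anyF⁻ : ∀ {k} (p : Fin k → Bool) → anyF p ≡ true → ∃ λ i → p i ≡ true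
anyF⁻ {suc k} p h with ∨⁻ {p zero} h
... | inj₁ h₀ = zero , h₀
... | inj₂ h₁ = let i , hi = anyF⁻ (p ∘ suc) h₁ in suc i , hi

allF⁺ : ∀ {k} {p : Fin k → Bool} → (∀ i → p i ≡ true) → allF p ≡ true
allF⁺ {zero}  h = refl
allF⁺ {suc k} h = ∧⁺ (h zero) (allF⁺ (h ∘ suc))

allF⁻ : ∀ {k} (p : Fin k → Bool) → allF p ≡ true → ∀ i → p i ≡ true
allF⁻ p h zero    = proj₁ (∧⁻ h)
allF⁻ p h (suc i) = allF⁻ (p ∘ suc) (proj₂ (∧⁻ {p zero} h)) i

allF-false : ∀ {k} (p : Fin k → Bool) → allF p ≡ false → ∃ λ i → p i ≡ false
allF-false {suc k} p h with p zero in p₀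
... | false = zero , p₀
... | true  = let i , hi = allF-false (p ∘ suc) h in suc i , hi

anyF-cong : ∀ {k} {p q : Fin k → Bool} → p ≗ q → anyF p ≡ anyF q
anyF-cong {zero}  h = refl
anyF-cong {suc k} h = cong₂ _∨_ (h zero) (anyF-cong (h ∘ suc))

allF-cong : ∀ {k} {p q : Fin k → Bool} → p ≗ q → allF p ≡ allF q
allF-cong {zero}  h = refl
allF-cong {suc k} h = cong₂ _∧_ (h zero) (allF-cong (h ∘ suc))

-- Counting, parity and finite sums.

indicator : Bool → ℕ
indicator b = if b then 1 else 0

countF-cong : ∀ {k} {p q : Fin k → Bool} → p ≗ q → countF p ≡ countF q
countF-cong {zero}  h = refl
countF-cong {suc k} h = cong₂ ℕ._+_ (cong indicator (h zero)) (countF-cong (h ∘ suc))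

countF-remove : ∀ {k} (p q : Fin k → Bool) i → (∀ j → j ≢ i → p j ≡ q j) → q i ≡ false →
  countF p ≡ indicator (p i) ℕ.+ countF q
countF-remove p q zero h qi rewrite qi =
  cong (indicator (p zero) ℕ.+_) (countF-cong (λ j → h (suc j) λ ()))
countF-remove p q (suc i) h qi
  rewrite h zero (λ ())
        | countF-remove (p ∘ suc) (q ∘ suc) i (λ j j≢i → h (suc j) (j≢i ∘ suc-injective)) qi
  = let a = indicator (q zero); b = indicator (p (suc i)); r = countF (q ∘ suc) in
    trans (sym (ℕP.+-assoc a b r)) (trans (cong (ℕ._+ r) (ℕP.+-comm a b)) (ℕP.+-assoc b a r))

countF-false : ∀ {k} → countF {k} (λ _ → false) ≡ 0
countF-false {zero}  = refl
countF-false {suc k} = countF-false {k}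

countF-positive : ∀ {k} (p : Fin k → Bool) i → p i ≡ true → countF p ≢ 0
countF-positive p zero    h c rewrite h = case c of λ ()
countF-positive p (suc i) h c = countF-positive (p ∘ suc) i h (ℕP.m+n≡0⇒n≡0 (indicator (p zero)) c)

countF-not : ∀ {k} (p : Fin k → Bool) → countF p ℕ.+ countF (not ∘ p) ≡ k
countF-not {zero}  p = refl
countF-not {suc k} p with p zero
... | true  = cong suc (countF-not (p ∘ suc))
... | false = trans (ℕP.+-suc _ _) (cong suc (countF-not (p ∘ suc)))

-- Generic because it serves twice: for rational sums, and for Booleans under `_xor_`, where sums
-- are parities.
module FinSum {c ℓ} (M : CommutativeMonoid c ℓ) where
  open CommutativeMonoid M renaming (refl to ≈-refl; trans to ≈-trans)
  open MonoidSum M public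

  sum-zero : ∀ {k} (f : Fin k → Carrier) → (∀ i → f i ≈ ε) → sum f ≈ ε
  sum-zero {zero}  f h = ≈-refl
  sum-zero {suc k} f h = ≈-trans (∙-cong (h zero) (sum-zero (f ∘ suc) (h ∘ suc))) (identityˡ ε)

  sum-single : ∀ {k} (f : Fin k → Carrier) i → (∀ j → j ≢ i → f j ≈ ε) → sum f ≈ f i
  sum-single f zero    h = ≈-trans (∙-congˡ (sum-zero (f ∘ suc) λ j → h (suc j) λ ())) (identityʳ _)
  sum-single f (suc i) h =
    ≈-trans (∙-cong (h zero λ ()) (sum-single (f ∘ suc) i λ j j≢i → h (suc j) (j≢i ∘ suc-injective)))
            (identityˡ _)

module ⊕ where
  open CommutativeRing xor-∧-commutativeRing using (semiring; +-commutativeMonoid)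
  open SemiringSum semiring public using (*-distribˡ-sum)
  open FinSum +-commutativeMonoid public

even-indicator : ∀ b k → even (indicator b ℕ.+ k) ≡ b xor even k
even-indicator true  k = refl
even-indicator false k = refl

even-countF : ∀ {k} (p : Fin k → Bool) → even (countF p) ≡ not (⊕.sum p)
even-countF {zero}  p = refl
even-countF {suc k} p = trans (even-indicator (p zero) (countF (p ∘ suc)))
  (trans (cong (p zero xor_) (even-countF (p ∘ suc))) (xor-not (p zero) _))
  where
  xor-not : ∀ a b → a xor not b ≡ not (a xor b)
  xor-not true  b = refl
  xor-not false b = refl

-- Filtered lists and the enumeration of edge sets.

module _ {A : Set} where

  ∈-filterᵇ⁺ : ∀ (p : A → Bool) {x xs} → x ∈ xs → p x ≡ true → x ∈ filterᵇ p xs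
  ∈-filterᵇ⁺ p x∈xs px = ∈-filter⁺ (T? ∘ p) x∈xs (Equivalence.from T-≡ px)

  ∈-filterᵇ⁻ : ∀ (p : A → Bool) {x xs} → x ∈ filterᵇ p xs → x ∈ xs × p x ≡ true
  ∈-filterᵇ⁻ p {xs = xs} x∈ =
    let x∈xs , Tpx = ∈-filter⁻ (T? ∘ p) {xs = xs} x∈ in x∈xs , Equivalence.to T-≡ Tpx

  filterᵇ-cong : ∀ {p q : A → Bool} → p ≗ q → ∀ xs → filterᵇ p xs ≡ filterᵇ q xs
  filterᵇ-cong h []       = refl
  filterᵇ-cong {p} {q} h (x ∷ xs) with p x | q x | h x
  ... | true  | _ | refl = cong (x ∷_) (filterᵇ-cong h xs)
  ... | false | _ | refl = filterᵇ-cong h xs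

  length-filterᵇ-split : ∀ (p q r : A → Bool) →
    (∀ x → indicator (p x) ≡ indicator (q x) ℕ.+ indicator (r x)) → ∀ xs →
    length (filterᵇ p xs) ≡ length (filterᵇ q xs) ℕ.+ length (filterᵇ r xs)
  length-filterᵇ-split p q r h [] = refl
  length-filterᵇ-split p q r h (x ∷ xs) with p x | q x | r x | h x
  ... | true  | true  | false | _ = cong suc (length-filterᵇ-split p q r h xs)
  ... | true  | false | true  | _ =
    trans (cong suc (length-filterᵇ-split p q r h xs)) (sym (ℕP.+-suc _ _))
  ... | false | false | false | _ = length-filterᵇ-split p q r h xs

  anyList⁻ : ∀ (p : A → Bool) xs → anyList p xs ≡ true → ∃ λ x → x ∈ xs × p x ≡ true
  anyList⁻ p (x ∷ xs) h with ∨⁻ {p x} h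
  ... | inj₁ px = x , here refl , px
  ... | inj₂ h′ = let y , y∈ , py = anyList⁻ p xs h′ in y , there y∈ , py

  anyList⁺ : ∀ (p : A → Bool) {x xs} → x ∈ xs → p x ≡ true → anyList p xs ≡ true
  anyList⁺ p (here refl) px = ∨⁺ˡ px
  anyList⁺ p {xs = y ∷ _} (there x∈) px = ∨⁺ʳ {p y} (anyList⁺ p x∈ px)

  -- Abstract in `R` because lists of walks are duplicate-free for `_≢_`, whereas members of
  -- `subsets m` are separated by pointwise inequality.
  singleton-list : ∀ {R : A → A → Set} {xs} → AllPairs R xs →
    (∀ {x y} → x ∈ xs → y ∈ xs → ¬ R x y) → ∀ {z} → z ∈ xs → xs ≡ z ∷ []
  singleton-list _ _ {z} (here {xs = []} refl) = refl
  singleton-list ((r ∷ _) ∷ _) h (here {xs = _ ∷ _} refl) = ⊥-elim (h (here refl) (there (here refl)) r)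
  singleton-list (rs ∷ _) h (there z∈) = ⊥-elim (h (here refl) (there z∈) (All.lookup rs z∈))

  filterᵇ-single : ∀ (p : A → Bool) {xs z} → Unique xs → (∀ x → p x ≡ true → x ≡ z) →
    z ∈ xs → p z ≡ true → filterᵇ p xs ≡ z ∷ []
  filterᵇ-single p {xs} u h z∈ pz =
    singleton-list (AllPairsP.filter⁺ (T? ∘ p) u)
      (λ x∈ y∈ x≢y → x≢y (trans (h _ (proj₂ (∈-filterᵇ⁻ p {xs = xs} x∈)))
                                 (sym (h _ (proj₂ (∈-filterᵇ⁻ p {xs = xs} y∈))))))
      (∈-filterᵇ⁺ p z∈ pz)

  length-filterᵇ-none : ∀ (p : A → Bool) xs → (∀ x → p x ≡ true → ⊥) → length (filterᵇ p xs) ≡ 0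
  length-filterᵇ-none p []       h = refl
  length-filterᵇ-none p (x ∷ xs) h with p x in px
  ... | true  = ⊥-elim (h x px)
  ... | false = length-filterᵇ-none p xs h

extend-≗ : ∀ {m b b′} {f g : Fin m → Bool} → b ≡ b′ → f ≗ g → extend b f ≗ extend b′ g
extend-≗ b≡ f≗ zero    = b≡
extend-≗ b≡ f≗ (suc i) = f≗ i

extend-η : ∀ {m} (C : Fin (suc m) → Bool) → extend (C zero) (C ∘ suc) ≗ C
extend-η C zero    = refl
extend-η C (suc i) = refl

-- Without extensionality `C` itself need not occur in the list, so a property shown for `C` has to
-- be transported to the representative `D`.
subsets-complete : ∀ m (C : Fin m → Bool) → ∃ λ D → D ∈ subsets m × D ≗ C
subsets-complete zero    C = (λ ()) , here refl , λ ()
subsets-complete (suc m) C =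
  let D , D∈ , D≗ = subsets-complete m (C ∘ suc) in
  extend (C zero) D , doubled D∈ (C zero) , λ i → trans (extend-≗ refl D≗ i) (extend-η C i)
  where
  doubled : ∀ {D} {Ds : List (Fin m → Bool)} → D ∈ Ds → ∀ b →
    extend b D ∈ concatMap (λ f → extend false f ∷ extend true f ∷ []) Ds
  doubled (here refl) false = here refl
  doubled (here refl) true  = there (here refl)
  doubled (there D∈)  b     = there (there (doubled D∈ b))

subsets-distinct : ∀ m → AllPairs (λ C D → ¬ C ≗ D) (subsets m)
subsets-distinct zero    = [] ∷ []
subsets-distinct (suc m) = doubled (subsets-distinct m)
  where
  apart : ∀ {C} {Ds : List (Fin m → Bool)} → All (λ D → ¬ C ≗ D) Ds → ∀ b →
    All (λ D → ¬ extend b C ≗ D) (concatMap (λ f → extend false f ∷ extend true f ∷ []) Ds)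
  apart []       b = []
  apart (h ∷ hs) b = (λ e → h (e ∘ suc)) ∷ (λ e → h (e ∘ suc)) ∷ apart hs b
  doubled : ∀ {Ds : List (Fin m → Bool)} → AllPairs (λ C D → ¬ C ≗ D) Ds →
    AllPairs (λ C D → ¬ C ≗ D) (concatMap (λ f → extend false f ∷ extend true f ∷ []) Ds)
  doubled []       = []
  doubled (h ∷ hs) = ((λ e → case e zero of λ ()) ∷ apart h false) ∷ apart h true ∷ doubled hs

length-filterᵇ-subset : ∀ {m} (p : (Fin m → Bool) → Bool) (C : Fin m → Bool) →
  (∀ D → D ≗ C → p D ≡ true) → (∀ D → p D ≡ true → D ≗ C) → length (filterᵇ p (subsets m)) ≡ 1
length-filterᵇ-subset {m} p C pC only =
  let D , D∈ , D≗ = subsets-complete m C in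
  cong length (singleton-list (AllPairsP.filter⁺ (T? ∘ p) (subsets-distinct m))
    (λ x∈ y∈ x≠y → x≠y λ i → trans (only _ (proj₂ (∈-filterᵇ⁻ p {xs = subsets m} x∈)) i)
                                   (sym (only _ (proj₂ (∈-filterᵇ⁻ p {xs = subsets m} y∈)) i)))
    (∈-filterᵇ⁺ p D∈ (pC D D≗)))

-- Exhaustive search in place of excluded middle: it decides whether a component has a cycle and
-- extracts a cycle from a failure of balance.
searchSubsets : ∀ {m} (p : (Fin m → Bool) → Bool) → (∀ {C D} → C ≗ D → p C ≡ true → p D ≡ true) →
  (∃ λ C → p C ≡ true) ⊎ (∀ C → p C ≡ false)
searchSubsets {m} p ext with anyList p (subsets m) in eq
... | true  = let C , _ , pC = anyList⁻ p (subsets m) eq in inj₁ (C , pC)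
... | false = inj₂ λ C → ¬true⇒false λ pC →
  let D , D∈ , D≗ = subsets-complete m C in
  true≢false (anyList⁺ p D∈ (ext (sym ∘ D≗) pC)) eq

-- Rational sums and linear dependence.

ℚ-ring : AlmostCommutativeRing 0ℓ 0ℓ
ℚ-ring = fromCommutativeRing ℚP.+-*-commutativeRing (λ x → dec⇒maybe (0ℚ ℚP.≟ x))

inverse : ∀ p → p ≢ 0ℚ → ∃ λ r → r * p ≡ 1ℚ
inverse p p≢0 = let instance _ = ℚ.≢-nonZero p≢0 in ℚ.1/ p , ℚP.*-inverseˡ p

no-zero-divisors : ∀ p q → p * q ≡ 0ℚ → p ≢ 0ℚ → q ≡ 0ℚ
no-zero-divisors p q pq p≢0 = let r , rp = inverse p p≢0 in begin
  q            ≡⟨ ℚP.*-identityˡ q ⟨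
  1ℚ * q       ≡⟨ cong (_* q) rp ⟨
  r * p * q    ≡⟨ ℚP.*-assoc r p q ⟩
  r * (p * q)  ≡⟨ cong (r *_) pq ⟩
  r * 0ℚ       ≡⟨ ℚP.*-zeroʳ r ⟩
  0ℚ           ∎
  where open ≡-Reasoning

sumℚ-cong : ∀ {k} {f g : Fin k → ℚ} → f ≗ g → sumℚ f ≡ sumℚ g
sumℚ-cong {zero}  h = refl
sumℚ-cong {suc k} h = cong₂ _+_ (h zero) (sumℚ-cong (h ∘ suc))

sumℚ≡sum : ∀ {k} (f : Fin k → ℚ) → sumℚ f ≡ FinSum.sum ℚP.+-0-commutativeMonoid f
sumℚ≡sum {zero}  f = refl
sumℚ≡sum {suc k} f = cong (f zero +_) (sumℚ≡sum (f ∘ suc))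

sumℚ-zero : ∀ {k} (f : Fin k → ℚ) → (∀ i → f i ≡ 0ℚ) → sumℚ f ≡ 0ℚ
sumℚ-zero f h = trans (sumℚ≡sum f) (FinSum.sum-zero ℚP.+-0-commutativeMonoid f h)

sumℚ-single : ∀ {k} (f : Fin k → ℚ) i → (∀ j → j ≢ i → f j ≡ 0ℚ) → sumℚ f ≡ f i
sumℚ-single f i h = trans (sumℚ≡sum f) (FinSum.sum-single ℚP.+-0-commutativeMonoid f i h)

sumℚ-+ : ∀ {k} (f g : Fin k → ℚ) → sumℚ (λ i → f i + g i) ≡ sumℚ f + sumℚ g
sumℚ-+ f g = trans (sumℚ≡sum λ i → f i + g i) (trans (FinSum.∑-distrib-+ ℚP.+-0-commutativeMonoid f g)
  (sym (cong₂ _+_ (sumℚ≡sum f) (sumℚ≡sum g))))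

sumℚ-*ˡ : ∀ {k} c (f : Fin k → ℚ) → sumℚ (λ i → c * f i) ≡ c * sumℚ f
sumℚ-*ˡ {zero}  c f = sym (ℚP.*-zeroʳ c)
sumℚ-*ˡ {suc k} c f = trans (cong (c * f zero +_) (sumℚ-*ˡ c (f ∘ suc))) (sym (ℚP.*-distribˡ-+ c _ _))

sumℚ-*ʳ : ∀ {k} (f : Fin k → ℚ) c → sumℚ (λ i → f i * c) ≡ sumℚ f * c
sumℚ-*ʳ f c = trans (sumℚ-cong λ i → ℚP.*-comm (f i) c) (trans (sumℚ-*ˡ c f) (ℚP.*-comm c _))

sumℚ-linear : ∀ {k} c (f g : Fin k → ℚ) → sumℚ (λ i → f i + c * g i) ≡ sumℚ f + c * sumℚ g
sumℚ-linear c f g = trans (sumℚ-+ f (λ i → c * g i)) (cong (sumℚ f +_) (sumℚ-*ˡ c g))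

sumℚ-comm : ∀ {k l} (f : Fin k → Fin l → ℚ) →
  sumℚ (λ i → sumℚ (λ j → f i j)) ≡ sumℚ (λ j → sumℚ (λ i → f i j))
sumℚ-comm {zero} {l} f = sym (sumℚ-zero {l} _ λ _ → refl)
sumℚ-comm {suc k} f = trans (cong (sumℚ (f zero) +_) (sumℚ-comm (f ∘ suc)))
  (sym (sumℚ-+ (f zero) (λ j → sumℚ (λ i → f (suc i) j))))

nonzero-or-zero : ∀ {k} (f : Fin k → ℚ) → (∃ λ i → f i ≢ 0ℚ) ⊎ (∀ i → f i ≡ 0ℚ)
nonzero-or-zero {zero}  f = inj₂ λ ()
nonzero-or-zero {suc k} f with f zero ℚP.≟ 0ℚ | nonzero-or-zero (f ∘ suc)
... | no ≢0 | _                = inj₁ (zero , ≢0)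
... | yes _ | inj₁ (i , fi≢0) = inj₁ (suc i , fi≢0)
... | yes 0≡ | inj₂ h         = inj₂ λ { zero → 0≡ ; (suc i) → h i }

-- Gaussian elimination: a coordinate `i` at which the first vector is nonzero is cleared from the
-- others, which then live in one dimension less. If the first vector is zero, it is a dependence by
-- itself; this covers dimension 0.
linearly-dependent : ∀ n {k} → n < k → (v : Fin k → Fin n → ℚ) →
  ∃ λ (coef : Fin k → ℚ) → (∃ λ i → coef i ≢ 0ℚ) × (∀ x → sumℚ (λ i → coef i * v i x) ≡ 0ℚ)
linearly-dependent n {suc k} n<k v with nonzero-or-zero (v zero)
... | inj₂ v₀≡0 = coef , (zero , λ ()) , λ x →
  trans (cong₂ _+_ (trans (ℚP.*-identityˡ _) (v₀≡0 x)) (sumℚ-zero _ λ i → ℚP.*-zeroˡ (v (suc i) x))) (ℚP.+-identityˡ 0ℚ)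
  where
  coef : Fin (suc k) → ℚ
  coef zero    = 1ℚ
  coef (suc _) = 0ℚ
linearly-dependent (suc n) {suc k} (s≤s n<k) v | inj₁ (i , p≢0) = coef , (suc j , cj≢0) , vanish
  where
  r = proj₁ (inverse (v zero i) p≢0)
  q : Fin k → ℚ
  q j = v (suc j) i * r
  u : Fin k → Fin (suc n) → ℚ
  u j x = v (suc j) x - q j * v zero x
  rec = linearly-dependent n n<k (λ j y → u j (punchIn i y))
  coef′ = proj₁ rec
  j = proj₁ (proj₁ (proj₂ rec))
  cj≢0 = proj₂ (proj₁ (proj₂ rec))
  coef : Fin (suc k) → ℚ
  -- Each `u j` contains `- q j` times the first vector; these contributions are collected here.
  coef zero    = - sumℚ (λ j → coef′ j * q j)
  coef (suc j) = coef′ j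
  open ≡-Reasoning
  ui≡0 : ∀ j → u j i ≡ 0ℚ
  ui≡0 j = begin
    v (suc j) i - v (suc j) i * r * v zero i    ≡⟨ cong (λ z → v (suc j) i - z) (ℚP.*-assoc (v (suc j) i) r _) ⟩
    v (suc j) i - v (suc j) i * (r * v zero i)
      ≡⟨ cong (λ z → v (suc j) i - v (suc j) i * z) (proj₂ (inverse (v zero i) p≢0)) ⟩
    v (suc j) i - v (suc j) i * 1ℚ              ≡⟨ cong (λ z → v (suc j) i - z) (ℚP.*-identityʳ _) ⟩
    v (suc j) i - v (suc j) i                   ≡⟨ ℚP.+-inverseʳ (v (suc j) i) ⟩
    0ℚ                                          ∎
  cu≡0 : ∀ x → sumℚ (λ j → coef′ j * u j x) ≡ 0ℚ
  cu≡0 x with i ≟F x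
  ... | yes refl = sumℚ-zero _ λ j → trans (cong (coef′ j *_) (ui≡0 j)) (ℚP.*-zeroʳ (coef′ j))
  ... | no i≢x   = subst (λ x → sumℚ (λ j → coef′ j * u j x) ≡ 0ℚ) (punchIn-punchOut i≢x)
                     (proj₂ (proj₂ rec) (punchOut i≢x))
  split : ∀ a v q z → a * (v - q * z) ≡ a * v + (- z) * (a * q)
  split = solve-∀ ℚ-ring
  swap-neg : ∀ s z t → (- s) * z + t ≡ t + (- z) * s
  swap-neg = solve-∀ ℚ-ring
  vanish : ∀ x → sumℚ (λ i → coef i * v i x) ≡ 0ℚ
  vanish x = begin
    (- sumℚ (λ j → coef′ j * q j)) * v zero x + sumℚ (λ j → coef′ j * v (suc j) x)
      ≡⟨ swap-neg (sumℚ (λ j → coef′ j * q j)) (v zero x) _ ⟩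
    sumℚ (λ j → coef′ j * v (suc j) x) + (- v zero x) * sumℚ (λ j → coef′ j * q j)
      ≡⟨ sumℚ-linear (- v zero x) (λ j → coef′ j * v (suc j) x) (λ j → coef′ j * q j) ⟨
    sumℚ (λ j → coef′ j * v (suc j) x + (- v zero x) * (coef′ j * q j))
      ≡⟨ sumℚ-cong (λ j → split (coef′ j) (v (suc j) x) (q j) (v zero x)) ⟨
    sumℚ (λ j → coef′ j * u j x)
      ≡⟨ cu≡0 x ⟩
    0ℚ ∎

-- Sums over edge sets and their reindexing.

Σ[_]_ : ∀ {A : Set} → List A → (A → ℚ) → ℚ
Σ[ xs ] f = sumListℚ (map f xs)

Σ-cong : ∀ {A : Set} (xs : List A) {f g : A → ℚ} → f ≗ g → Σ[ xs ] f ≡ Σ[ xs ] g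
Σ-cong []       h = refl
Σ-cong (x ∷ xs) h = cong₂ _+_ (h x) (Σ-cong xs h)

Σ-*ˡ : ∀ {A : Set} (xs : List A) c (f : A → ℚ) → Σ[ xs ] (λ x → c * f x) ≡ c * Σ[ xs ] f
Σ-*ˡ []       c f = sym (ℚP.*-zeroʳ c)
Σ-*ˡ (x ∷ xs) c f = trans (cong (c * f x +_) (Σ-*ˡ xs c f)) (sym (ℚP.*-distribˡ-+ c _ _))

Σ-*ʳ : ∀ {A : Set} (xs : List A) (f : A → ℚ) c → Σ[ xs ] (λ x → f x * c) ≡ (Σ[ xs ] f) * c
Σ-*ʳ xs f c = trans (Σ-cong xs λ x → ℚP.*-comm (f x) c) (trans (Σ-*ˡ xs c f) (ℚP.*-comm c _))

Σ-sumℚ : ∀ {A : Set} {k} (xs : List A) (f : Fin k → A → ℚ) →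
  sumℚ (λ i → Σ[ xs ] f i) ≡ Σ[ xs ] (λ x → sumℚ (λ i → f i x))
Σ-sumℚ {k = k} [] f = sumℚ-zero {k} _ λ _ → refl
Σ-sumℚ (x ∷ xs) f = trans (sumℚ-+ (λ i → f i x) (λ i → Σ[ xs ] f i)) (cong (sumℚ (λ i → f i x) +_) (Σ-sumℚ xs f))

Σ-filterᵇ : ∀ {A : Set} (p : A → Bool) (f : A → ℚ) xs →
  Σ[ filterᵇ p xs ] f ≡ Σ[ xs ] (λ x → if p x then f x else 0ℚ)
Σ-filterᵇ p f [] = refl
Σ-filterᵇ p f (x ∷ xs) with p x
... | true  = cong (f x +_) (Σ-filterᵇ p f xs)
... | false = trans (Σ-filterᵇ p f xs) (sym (ℚP.+-identityˡ _))

Σ-subsets-suc : ∀ m (f : EdgeSet (suc m) → ℚ) →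
  Σ[ subsets (suc m) ] f ≡ Σ[ subsets m ] (λ C → f (extend false C) + f (extend true C))
Σ-subsets-suc m f = go (subsets m)
  where
  go : ∀ Cs → Σ[ concatMap (λ C → extend false C ∷ extend true C ∷ []) Cs ] f
            ≡ Σ[ Cs ] (λ C → f (extend false C) + f (extend true C))
  go []       = refl
  go (C ∷ Cs) = trans (cong (λ s → f (extend false C) + (f (extend true C) + s)) (go Cs))
                      (sym (ℚP.+-assoc (f (extend false C)) (f (extend true C)) _))

-- Edge sets are compared pointwise, so the summands are related along the
-- bijection C ↦ M xor C instead of being composed with it.
Σ-subsets-xor : ∀ {m} (M : EdgeSet m) (f g : EdgeSet m → ℚ) →
  (∀ C D → (∀ i → D i ≡ M i xor C i) → f C ≡ g D) → Σ[ subsets m ] f ≡ Σ[ subsets m ] g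
Σ-subsets-xor {zero}  M f g h = cong (_+ 0ℚ) (h (λ ()) (λ ()) λ ())
Σ-subsets-xor {suc m} M f g h = trans (Σ-subsets-suc m f) (trans
  (Σ-subsets-xor (M ∘ suc) (λ C → f (extend false C) + f (extend true C))
                           (λ C → g (extend false C) + g (extend true C)) (step (M zero) refl))
  (sym (Σ-subsets-suc m g)))
  where
  related : ∀ b C D → (∀ i → D i ≡ M (suc i) xor C i) →
    f (extend b C) ≡ g (extend (M zero xor b) D)
  related b C D e = h (extend b C) (extend (M zero xor b) D) λ { zero → refl ; (suc i) → e i }
  step : ∀ b → M zero ≡ b → ∀ C D → (∀ i → D i ≡ M (suc i) xor C i) →
    f (extend false C) + f (extend true C) ≡ g (extend false D) + g (extend true D)
  step false M₀ C D e = cong₂ _+_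
    (subst (λ b → f (extend false C) ≡ g (extend (b xor false) D)) M₀ (related false C D e))
    (subst (λ b → f (extend true C) ≡ g (extend (b xor true) D)) M₀ (related true C D e))
  step true M₀ C D e = trans (cong₂ _+_
    (subst (λ b → f (extend false C) ≡ g (extend (b xor false) D)) M₀ (related false C D e))
    (subst (λ b → f (extend true C) ≡ g (extend (b xor true) D)) M₀ (related true C D e)))
    (ℚP.+-comm (g (extend true D)) (g (extend false D)))

-- Matrix products and weighted families of column bases.

·-cong : ∀ {r k s} {A A′ : Matrix ℚ r k} {B B′ : Matrix ℚ k s} → A ≐ A′ → B ≐ B′ → A · B ≐ A′ · B′
·-cong A≐ B≐ a b = sumℚ-cong λ t → cong₂ _*_ (A≐ a t) (B≐ t b)

·-assoc : ∀ {r k l s} (A : Matrix ℚ r k) (B : Matrix ℚ k l) (D : Matrix ℚ l s) →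
  (A · B) · D ≐ A · (B · D)
·-assoc A B D a d = begin
  sumℚ (λ t → sumℚ (λ u → A a u * B u t) * D t d)
    ≡⟨ sumℚ-cong (λ t → sumℚ-*ʳ (λ u → A a u * B u t) (D t d)) ⟨
  sumℚ (λ t → sumℚ (λ u → A a u * B u t * D t d))
    ≡⟨ sumℚ-comm (λ t u → A a u * B u t * D t d) ⟩
  sumℚ (λ u → sumℚ (λ t → A a u * B u t * D t d))
    ≡⟨ sumℚ-cong (λ u → trans (sumℚ-cong λ t → ℚP.*-assoc (A a u) (B u t) (D t d))
                              (sumℚ-*ˡ (A a u) (λ t → B u t * D t d))) ⟩
  sumℚ (λ u → A a u * sumℚ (λ t → B u t * D t d)) ∎
  where open ≡-Reasoning

dot : ∀ {n m} → Matrix ℚ n m → (Fin n → ℚ) → Fin m → ℚ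
dot A y f = sumℚ (λ v → y v * A v f)

dot-linear : ∀ {n m} (A : Matrix ℚ n m) a y z f → dot A (λ v → y v + a * z v) f ≡ dot A y f + a * dot A z f
dot-linear A a y z f = trans (sumℚ-cong λ v → split (y v) a (z v) (A v f))
                             (sumℚ-linear a (λ v → y v * A v f) (λ v → z v * A v f))
  where
  split : ∀ y a z x → (y + a * z) * x ≡ y * x + a * (z * x)
  split = solve-∀ ℚ-ring

dot-*ˡ : ∀ {n m} (A : Matrix ℚ n m) a y f → dot A (λ v → a * y v) f ≡ a * dot A y f
dot-*ˡ A a y f = trans (sumℚ-cong λ v → ℚP.*-assoc a (y v) (A v f)) (sumℚ-*ˡ a (λ v → y v * A v f))

dot-sumℚ : ∀ {n m k} (A : Matrix ℚ n m) (y : Fin k → Fin n → ℚ) f →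
  dot A (λ v → sumℚ (λ e → y e v)) f ≡ sumℚ (λ e → dot A (y e) f)
dot-sumℚ A y f = trans (sumℚ-cong λ v → sym (sumℚ-*ʳ (λ e → y e v) (A v f)))
                       (sumℚ-comm (λ v e → y e v * A v f))

dot-zero : ∀ {n m} (A : Matrix ℚ n m) f → dot A (λ _ → 0ℚ) f ≡ 0ℚ
dot-zero A f = sumℚ-zero _ λ v → ℚP.*-zeroˡ (A v f)

unit : ∀ {n} → Fin n → Fin n → ℚ
unit k v = if eqF k v then 1ℚ else 0ℚ

sumℚ-unit : ∀ {n} (k : Fin n) (f : Fin n → ℚ) → sumℚ (λ v → unit k v * f v) ≡ f k
sumℚ-unit k f = trans (sumℚ-single (λ v → unit k v * f v) k
    λ v v≢k → trans (cong (λ b → (if b then 1ℚ else 0ℚ) * f v) (eqF-no (v≢k ∘ sym))) (ℚP.*-zeroˡ (f v)))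
  (trans (cong (λ b → (if b then 1ℚ else 0ℚ) * f k) (eqF⁺ {a = k} refl)) (ℚP.*-identityˡ (f k)))

-- A weighted family of column bases of A.  For a basis H, the rows R H e are dual to
-- the columns in H and orthogonal to the left kernel of A, so that R H is the
-- pseudoinverse of the columns in H; wt H plays the role of det(A_H)².
record BasisFamily {n m} (A : Matrix ℚ n m) : Set where
  field
    member     : EdgeSet m → Bool
    wt         : EdgeSet m → ℚ
    row        : EdgeSet m → Fin m → Fin n → ℚ
    dual-self  : ∀ H e → member H ≡ true → H e ≡ true → dot A (row H e) e ≡ 1ℚ
    dual-other : ∀ H e g → member H ≡ true → H e ≡ true → H g ≡ true → g ≢ e → dot A (row H e) g ≡ 0ℚ
    spanning   : ∀ H → member H ≡ true → ∀ y →
                 (∀ g → H g ≡ true → dot A y g ≡ 0ℚ) → ∀ f → dot A y f ≡ 0ℚ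
    orthogonal : ∀ H e → member H ≡ true → H e ≡ true → ∀ z →
                 (∀ f → dot A z f ≡ 0ℚ) → sumℚ (λ v → row H e v * z v) ≡ 0ℚ
    exchange   : ∀ H H′ e f → member H ≡ true →
                 H e ≡ true → H f ≡ false → H′ e ≡ false → H′ f ≡ true →
                 (∀ g → g ≢ e → g ≢ f → H g ≡ H′ g) → dot A (row H e) f ≢ 0ℚ →
                 member H′ ≡ true × wt H′ ≡ dot A (row H e) f * dot A (row H e) f * wt H

  total : ℚ
  total = Σ[ subsets m ] (λ H → if member H then wt H else 0ℚ)

  weighted : EdgeSet m → Matrix ℚ m n
  weighted H e v = if member H ∧ H e then wt H * row H e v else 0ℚ

  sumOfRows : Matrix ℚ m n
  sumOfRows e v = Σ[ subsets m ] (λ H → weighted H e v)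

  weighted-dot : ∀ H e f →
    dot A (weighted H e) f ≡ (if member H ∧ H e then wt H * dot A (row H e) f else 0ℚ)
  weighted-dot H e f with member H ∧ H e
  ... | true  = dot-*ˡ A (wt H) (row H e) f
  ... | false = dot-zero A f

  sumOfRows-dot : ∀ e f → dot A (sumOfRows e) f ≡ Σ[ subsets m ] (λ H → dot A (weighted H e) f)
  sumOfRows-dot e f = trans (sumℚ-cong λ v → sym (Σ-*ʳ (subsets m) (λ H → weighted H e v) (A v f)))
                            (Σ-sumℚ (subsets m) (λ v H → weighted H e v * A v f))

  sumOfRows-orthogonal : ∀ z → (∀ f → dot A z f ≡ 0ℚ) → ∀ e → sumℚ (λ v → sumOfRows e v * z v) ≡ 0ℚ
  sumOfRows-orthogonal z z⊥ e = begin
    sumℚ (λ v → sumOfRows e v * z v)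
      ≡⟨ sumℚ-cong (λ v → sym (Σ-*ʳ (subsets m) (λ H → weighted H e v) (z v))) ⟩
    sumℚ (λ v → Σ[ subsets m ] (λ H → weighted H e v * z v))
      ≡⟨ Σ-sumℚ (subsets m) (λ v H → weighted H e v * z v) ⟩
    Σ[ subsets m ] (λ H → sumℚ (λ v → weighted H e v * z v))
      ≡⟨ Σ-cong (subsets m) summand ⟩
    -- Zero is written as a product so that `Σ-*ˡ` can pull out a factor zero.
    Σ[ subsets m ] (λ H → 0ℚ * 0ℚ)
      ≡⟨ Σ-*ˡ (subsets m) 0ℚ (λ _ → 0ℚ) ⟩
    0ℚ * Σ[ subsets m ] (λ H → 0ℚ)
      ≡⟨ ℚP.*-zeroˡ (Σ[ subsets m ] (λ H → 0ℚ)) ⟩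
    0ℚ ∎
    where
    open ≡-Reasoning
    summand : ∀ H → sumℚ (λ v → weighted H e v * z v) ≡ 0ℚ
    summand H with member H in mH | H e in He
    ... | false | _     = sumℚ-zero _ λ v → ℚP.*-zeroˡ (z v)
    ... | true  | false = sumℚ-zero _ λ v → ℚP.*-zeroˡ (z v)
    ... | true  | true  = begin
      sumℚ (λ v → wt H * row H e v * z v)    ≡⟨ sumℚ-cong (λ v → ℚP.*-assoc (wt H) (row H e v) (z v)) ⟩
      sumℚ (λ v → wt H * (row H e v * z v))  ≡⟨ sumℚ-*ˡ (wt H) (λ v → row H e v * z v) ⟩
      wt H * sumℚ (λ v → row H e v * z v)    ≡⟨ cong (wt H *_) (orthogonal H e mH He z z⊥) ⟩
      wt H * 0ℚ                              ≡⟨ ℚP.*-zeroʳ (wt H) ⟩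
      0ℚ                                     ∎

  -- The expansion of the column `f` in the basis `H`, read at coordinate `k`. By duality the vector
  -- `y`, the sum of the rows weighted by `A k e` minus `unit k`, annihilates the columns in `H`; by
  -- `spanning` it annihilates all columns.
  expand : ∀ H → member H ≡ true → ∀ k f →
    sumℚ (λ e → if H e then A k e * dot A (row H e) f else 0ℚ) ≡ A k f
  expand H mH k f = begin
    sumℚ (λ e → if H e then A k e * dot A (row H e) f else 0ℚ)
      ≡⟨ sumℚ-cong (λ e → x-dot e f) ⟨
    sumℚ (λ e → dot A (x e) f)
      ≡⟨ regroup (sumℚ λ e → dot A (x e) f) (A k f) ⟩
    sumℚ (λ e → dot A (x e) f) + - 1ℚ * A k f + A k f
      ≡⟨ cong (_+ A k f) (trans (sym (y-dot f)) (spanning H mH y y⊥ f)) ⟩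
    0ℚ + A k f
      ≡⟨ ℚP.+-identityˡ (A k f) ⟩
    A k f ∎
    where
    open ≡-Reasoning
    regroup : ∀ a b → a ≡ a + - 1ℚ * b + b
    regroup = solve-∀ ℚ-ring
    x : Fin m → Fin n → ℚ
    x e v = if H e then A k e * row H e v else 0ℚ
    x-dot : ∀ e f → dot A (x e) f ≡ (if H e then A k e * dot A (row H e) f else 0ℚ)
    x-dot e f with H e
    ... | true  = dot-*ˡ A (A k e) (row H e) f
    ... | false = dot-zero A f
    y : Fin n → ℚ
    y v = sumℚ (λ e → x e v) + - 1ℚ * unit k v
    y-dot : ∀ f → dot A y f ≡ sumℚ (λ e → dot A (x e) f) + - 1ℚ * A k f
    y-dot f = trans (dot-linear A (- 1ℚ) (λ v → sumℚ (λ e → x e v)) (unit k) f)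
      (cong₂ (λ a b → a + - 1ℚ * b) (dot-sumℚ A x f) (sumℚ-unit k (λ v → A v f)))
    off-diagonal : ∀ g → H g ≡ true → ∀ e → e ≢ g → dot A (x e) g ≡ 0ℚ
    off-diagonal g Hg e e≢g with x-dot e g
    ... | eq with H e in He
    ...   | false = eq
    ...   | true  = trans eq (trans (cong (A k e *_) (dual-other H e g mH He Hg (e≢g ∘ sym))) (ℚP.*-zeroʳ (A k e)))
    diagonal : ∀ g → H g ≡ true → dot A (x g) g ≡ A k g
    diagonal g Hg = trans (x-dot g g) (trans
      (cong (λ b → if b then A k g * dot A (row H g) g else 0ℚ) Hg)
      (trans (cong (A k g *_) (dual-self H g mH Hg)) (ℚP.*-identityʳ (A k g))))
    cancel : ∀ a → a + - 1ℚ * a ≡ 0ℚ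
    cancel = solve-∀ ℚ-ring
    y⊥ : ∀ g → H g ≡ true → dot A y g ≡ 0ℚ
    y⊥ g Hg = trans (y-dot g) (trans
      (cong (_+ - 1ℚ * A k g) (trans (sumℚ-single (λ e → dot A (x e) g) g (off-diagonal g Hg)) (diagonal g Hg)))
      (cancel (A k g)))

  inner-inverse : ∀ k f → (A · (sumOfRows · A)) k f ≡ total * A k f
  inner-inverse k f = begin
    sumℚ (λ e → A k e * dot A (sumOfRows e) f)
      ≡⟨ sumℚ-cong (λ e → trans (cong (A k e *_) (sumOfRows-dot e f))
                                 (sym (Σ-*ˡ (subsets m) (A k e) (λ H → dot A (weighted H e) f)))) ⟩
    sumℚ (λ e → Σ[ subsets m ] (λ H → A k e * dot A (weighted H e) f))
      ≡⟨ Σ-sumℚ (subsets m) (λ e H → A k e * dot A (weighted H e) f) ⟩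
    Σ[ subsets m ] (λ H → sumℚ (λ e → A k e * dot A (weighted H e) f))
      ≡⟨ Σ-cong (subsets m) summand ⟩
    Σ[ subsets m ] (λ H → (if member H then wt H else 0ℚ) * A k f)
      ≡⟨ Σ-*ʳ (subsets m) (λ H → if member H then wt H else 0ℚ) (A k f) ⟩
    total * A k f ∎
    where
    open ≡-Reasoning
    pull : ∀ a w d → a * (w * d) ≡ w * (a * d)
    pull = solve-∀ ℚ-ring
    summand : ∀ H → sumℚ (λ e → A k e * dot A (weighted H e) f) ≡ (if member H then wt H else 0ℚ) * A k f
    summand H with member H in mH | (λ e → weighted-dot H e f)
    ... | false | dots = trans (sumℚ-zero _ λ e → trans (cong (A k e *_) (dots e)) (ℚP.*-zeroʳ (A k e)))
                               (sym (ℚP.*-zeroˡ (A k f)))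
    ... | true  | dots = begin
      sumℚ (λ e → A k e * dot A (if-row e) f)
        ≡⟨ sumℚ-cong (λ e → trans (cong (A k e *_) (dots e)) (branch e (H e))) ⟩
      sumℚ (λ e → wt H * (if H e then A k e * dot A (row H e) f else 0ℚ))
        ≡⟨ sumℚ-*ˡ (wt H) (λ e → if H e then A k e * dot A (row H e) f else 0ℚ) ⟩
      wt H * sumℚ (λ e → if H e then A k e * dot A (row H e) f else 0ℚ)
        ≡⟨ cong (wt H *_) (expand H mH k f) ⟩
      wt H * A k f ∎
      where
      if-row : Fin m → Fin n → ℚ
      if-row e v = if H e then wt H * row H e v else 0ℚ
      branch : ∀ e b → A k e * (if b then wt H * dot A (row H e) f else 0ℚ)
                     ≡ wt H * (if b then A k e * dot A (row H e) f else 0ℚ)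
      branch e true  = pull (A k e) (wt H) (dot A (row H e) f)
      branch e false = trans (ℚP.*-zeroʳ (A k e)) (sym (ℚP.*-zeroʳ (wt H)))

  -- The row of `e` in `H` minus α times the row of `f` in `H′` annihilates the columns in `H′`,
  -- hence also the column `e`, which gives αβ = 1. Then `wt H′ * β` is α²β `wt H`, that is α
  -- `wt H`.
  exchange-symmetric : ∀ H H′ e f → member H ≡ true →
    H e ≡ true → H f ≡ false → H′ e ≡ false → H′ f ≡ true →
    (∀ g → g ≢ e → g ≢ f → H g ≡ H′ g) → dot A (row H e) f ≢ 0ℚ →
    member H′ ≡ true × wt H * dot A (row H e) f ≡ wt H′ * dot A (row H′ f) e
  exchange-symmetric H H′ e f mH He Hf H′e H′f agree α≢0 = mH′ , eq
    where
    open ≡-Reasoning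
    α = dot A (row H e) f
    β = dot A (row H′ f) e
    mH′ = proj₁ (exchange H H′ e f mH He Hf H′e H′f agree α≢0)
    y : Fin n → ℚ
    y v = row H e v + - α * row H′ f v
    y⊥ : ∀ g → H′ g ≡ true → dot A y g ≡ 0ℚ
    y⊥ g H′g with g ≟F f
    ... | yes refl = trans (dot-linear A (- α) (row H e) (row H′ f) g)
                           (trans (cong (λ z → α + - α * z) (dual-self H′ g mH′ H′g)) (cancel α))
      where
      cancel : ∀ a → a + - a * 1ℚ ≡ 0ℚ
      cancel = solve-∀ ℚ-ring
    ... | no g≢f = trans (dot-linear A (- α) (row H e) (row H′ f) g) (trans
        (cong₂ (λ a b → a + - α * b)
          (dual-other H e g mH He (trans (agree g g≢e g≢f) H′g) g≢e)
          (dual-other H′ f g mH′ H′f H′g g≢f))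
        (vanish α))
      where
      g≢e : g ≢ e
      g≢e refl = true≢false H′g H′e
      vanish : ∀ a → 0ℚ + - a * 0ℚ ≡ 0ℚ
      vanish = solve-∀ ℚ-ring
    αβ : 1ℚ + - α * β ≡ 0ℚ
    αβ = trans (sym (trans (dot-linear A (- α) (row H e) (row H′ f) e)
                           (cong (_+ - α * β) (dual-self H e mH He))))
               (spanning H′ mH′ y y⊥ e)
    -- The last summand carries the factor that vanishes by `αβ`.
    rearrange : ∀ a b w → w * a ≡ a * a * w * b + w * a * (1ℚ + - a * b)
    rearrange = solve-∀ ℚ-ring
    eq : wt H * α ≡ wt H′ * β
    eq = begin
      wt H * α                                          ≡⟨ rearrange α β (wt H) ⟩
      α * α * wt H * β + wt H * α * (1ℚ + - α * β)      ≡⟨ cong₂ (λ a b → a * β + wt H * α * b)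
                                                             (sym (proj₂ (exchange H H′ e f mH He Hf H′e H′f agree α≢0))) αβ ⟩
      wt H′ * β + wt H * α * 0ℚ                         ≡⟨ cong (wt H′ * β +_) (ℚP.*-zeroʳ (wt H * α)) ⟩
      wt H′ * β + 0ℚ                                    ≡⟨ ℚP.+-identityʳ (wt H′ * β) ⟩
      wt H′ * β                                         ∎

  -- The contribution of `H` to the entry of `sumOfRows · A` at `e` and `f`.
  coefficient : EdgeSet m → Fin m → Fin m → ℚ
  coefficient H e f = if member H ∧ H e then wt H * dot A (row H e) f else 0ℚ

  coefficient-zero : ∀ H e f → H e ≡ true → dot A (row H e) f ≡ 0ℚ → coefficient H e f ≡ 0ℚ
  coefficient-zero H e f He d≡0 with member H ∧ H e
  ... | true  = trans (cong (wt H *_) d≡0) (ℚP.*-zeroʳ (wt H))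
  ... | false = refl

  -- Neither set is assumed to be a member. A nonzero α on a member `H`, or a nonzero β on a member
  -- `H′`, makes the other set a member by exchange; in all remaining cases both coefficients
  -- vanish.
  coefficient-exchange : ∀ H H′ e f → H e ≡ true → H f ≡ false → H′ e ≡ false → H′ f ≡ true →
    (∀ g → g ≢ e → g ≢ f → H g ≡ H′ g) → coefficient H e f ≡ coefficient H′ f e
  coefficient-exchange H H′ e f He Hf H′e H′f agree = go (member H) (member H′) refl refl
    where
    α = dot A (row H e) f
    β = dot A (row H′ f) e
    value : ∀ H e f b → member H ≡ b → H e ≡ true →
      coefficient H e f ≡ (if b then wt H * dot A (row H e) f else 0ℚ)
    value H e f _ refl He = cong (λ b → if b then wt H * dot A (row H e) f else 0ℚ)
      (trans (cong (member H ∧_) He) (∧-true (member H)))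
      where
      ∧-true : ∀ b → b ∧ true ≡ b
      ∧-true true  = refl
      ∧-true false = refl
    go : ∀ b b′ → member H ≡ b → member H′ ≡ b′ → coefficient H e f ≡ coefficient H′ f e
    go true b′ mH mH′ with α ℚP.≟ 0ℚ
    ... | no α≢0 = let mH′ , eq = exchange-symmetric H H′ e f mH He Hf H′e H′f agree α≢0 in
      trans (value H e f true mH He) (trans eq (sym (value H′ f e true mH′ H′f)))
    go true true mH mH′ | yes α≡0 with β ℚP.≟ 0ℚ
    ... | yes β≡0 = trans (coefficient-zero H e f He α≡0) (sym (coefficient-zero H′ f e H′f β≡0))
    ... | no β≢0  =
      let _ , eq = exchange-symmetric H′ H f e mH′ H′f H′e Hf He (λ g g≢f g≢e → sym (agree g g≢e g≢f)) β≢0 in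
      trans (value H e f true mH He) (trans (sym eq) (sym (value H′ f e true mH′ H′f)))
    go true false mH mH′ | yes α≡0 = trans (coefficient-zero H e f He α≡0) (sym (value H′ f e false mH′ H′f))
    go false false mH mH′ = trans (value H e f false mH He) (sym (value H′ f e false mH′ H′f))
    go false true mH mH′ with β ℚP.≟ 0ℚ
    ... | yes β≡0 = trans (value H e f false mH He) (sym (coefficient-zero H′ f e H′f β≡0))
    ... | no β≢0  =
      let mH₁ , _ = exchange-symmetric H′ H f e mH′ H′f H′e Hf He (λ g g≢f g≢e → sym (agree g g≢e g≢f)) β≢0 in
      ⊥-elim (true≢false mH₁ mH)

  -- Symmetric difference with the pair `e`, `f` is an involution on all edge sets, so it reindexes
  -- the whole sum. It also pairs sets containing both edges with sets containing neither; there one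
  -- coefficient is zero by duality and the other by absence.
  coefficient-swap : ∀ e f → e ≢ f → ∀ H H′ → (∀ g → H′ g ≡ (eqF g e ∨ eqF g f) xor H g) →
    coefficient H e f ≡ coefficient H′ f e
  coefficient-swap e f e≢f H H′ rel = go (H e) (H f) refl refl
    where
    H′e : H′ e ≡ not (H e)
    H′e = trans (rel e) (cong (_xor H e) (∨⁺ˡ {b = eqF e f} (eqF⁺ {a = e} refl)))
    H′f : H′ f ≡ not (H f)
    H′f = trans (rel f) (cong (_xor H f) (∨⁺ʳ {eqF f e} (eqF⁺ {a = f} refl)))
    agree : ∀ g → g ≢ e → g ≢ f → H g ≡ H′ g
    agree g g≢e g≢f = sym (trans (rel g) (cong₂ (λ a b → (a ∨ b) xor H g) (eqF-no g≢e) (eqF-no g≢f)))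
    absent : ∀ H e f → H e ≡ false → coefficient H e f ≡ 0ℚ
    absent H e f He = cong (λ b → if b then wt H * dot A (row H e) f else 0ℚ) (∧-false (member H) He)
      where
      ∧-false : ∀ a {b} → b ≡ false → a ∧ b ≡ false
      ∧-false true  p = p
      ∧-false false p = refl
    present : ∀ H e f → e ≢ f → H e ≡ true → H f ≡ true → coefficient H e f ≡ 0ℚ
    present H e f e≢f He Hf with member H in mH
    ... | false = refl
    ... | true rewrite He =
      trans (cong (wt H *_) (dual-other H e f mH He Hf (e≢f ∘ sym))) (ℚP.*-zeroʳ (wt H))
    go : ∀ a b → H e ≡ a → H f ≡ b → coefficient H e f ≡ coefficient H′ f e
    go true  true  He Hf = trans (present H e f e≢f He Hf) (sym (absent H′ f e (trans H′f (cong not Hf))))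
    go true  false He Hf =
      coefficient-exchange H H′ e f He Hf (trans H′e (cong not He)) (trans H′f (cong not Hf)) agree
    go false true  He Hf = trans (absent H e f He) (sym (absent H′ f e (trans H′f (cong not Hf))))
    go false false He Hf = trans (absent H e f He)
      (sym (present H′ f e (e≢f ∘ sym) (trans H′f (cong not Hf)) (trans H′e (cong not He))))

  product-symmetric : ∀ e f → (sumOfRows · A) e f ≡ (sumOfRows · A) f e
  product-symmetric e f with e ≟F f
  ... | yes refl = refl
  ... | no e≢f   = trans (as-coefficients e f) (trans
    (Σ-subsets-xor (λ g → eqF g e ∨ eqF g f) (λ H → coefficient H e f) (λ H → coefficient H f e)
      (coefficient-swap e f e≢f))
    (sym (as-coefficients f e)))
    where
    as-coefficients : ∀ e f → (sumOfRows · A) e f ≡ Σ[ subsets m ] (λ H → coefficient H e f)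
    as-coefficients e f = trans (sumOfRows-dot e f) (Σ-cong (subsets m) λ H → weighted-dot H e f)

  -- With Y = `sumOfRows`, the inner-inverse property gives (XA)(YA) = `total` XA. As XA and YA are
  -- symmetric, transposing turns the left side into (YA)(XA) = YA, so `total` XA = YA. Multiplying
  -- by X on the right leaves YAX = Y to be shown.
  moorePenrose : ∀ X → IsMoorePenroseInverse A X → ∀ e v → total * X e v ≡ sumOfRows e v
  moorePenrose X (AXA , XAX , AXsym , XAsym) e v = begin
    total * X e v                 ≡⟨ cong (total *_) (XAX e v) ⟨
    total * ((X · A) · X) e v     ≡⟨ sumℚ-*ˡ total (λ t → (X · A) e t * X t v) ⟨
    sumℚ (λ t → total * ((X · A) e t * X t v))
      ≡⟨ sumℚ-cong (λ t → trans (sym (ℚP.*-assoc total ((X · A) e t) (X t v))) (cong (_* X t v) (total-XA e t))) ⟩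
    ((Y · A) · X) e v             ≡⟨ ·-assoc Y A X e v ⟩
    (Y · (A · X)) e v             ≡⟨ YAX e ⟩
    Y e v                         ∎
    where
    open ≡-Reasoning
    Y = sumOfRows
    YA-XA : (Y · A) · (X · A) ≐ Y · A
    YA-XA a b = begin
      ((Y · A) · (X · A)) a b  ≡⟨ ·-assoc Y A (X · A) a b ⟩
      (Y · (A · (X · A))) a b  ≡⟨ ·-cong {A = Y} {Y} (λ _ _ → refl) (λ c d → trans (sym (·-assoc A X A c d)) (AXA c d)) a b ⟩
      (Y · A) a b              ∎
    XA-YA : ∀ a b → ((X · A) · (Y · A)) a b ≡ total * (X · A) a b
    XA-YA a b = begin
      ((X · A) · (Y · A)) a b               ≡⟨ ·-assoc X A (Y · A) a b ⟩
      sumℚ (λ t → X a t * (A · (Y · A)) t b) ≡⟨ sumℚ-cong (λ t → trans (cong (X a t *_) (inner-inverse t b)) (pull (X a t) total (A t b))) ⟩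
      sumℚ (λ t → total * (X a t * A t b))  ≡⟨ sumℚ-*ˡ total (λ t → X a t * A t b) ⟩
      total * (X · A) a b                   ∎
      where
      pull : ∀ x w a → x * (w * a) ≡ w * (x * a)
      pull = solve-∀ ℚ-ring
    total-XA : ∀ a b → total * (X · A) a b ≡ (Y · A) a b
    total-XA a b = begin
      total * (X · A) a b                     ≡⟨ XA-YA a b ⟨
      sumℚ (λ t → (X · A) a t * (Y · A) t b)  ≡⟨ sumℚ-cong (λ t → trans (ℚP.*-comm ((X · A) a t) _)
                                                   (cong₂ _*_ (product-symmetric t b) (sym (XAsym a t)))) ⟩
      ((Y · A) · (X · A)) b a                 ≡⟨ YA-XA b a ⟩
      (Y · A) b a                             ≡⟨ product-symmetric b a ⟩
      (Y · A) a b                             ∎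
    -- Row `v` of I - AX lies in the left kernel because AXA = A. By symmetry of AX it is also
    -- column `v`, the form in which it meets `Y` below.
    z : Fin n → ℚ
    z t = unit v t + - 1ℚ * (A · X) v t
    z⊥ : ∀ f → dot A z f ≡ 0ℚ
    z⊥ f = trans (dot-linear A (- 1ℚ) (unit v) ((A · X) v) f)
      (trans (cong₂ (λ a b → a + - 1ℚ * b) (sumℚ-unit v (λ t → A t f)) (AXA v f)) (cancel (A v f)))
      where
      cancel : ∀ a → a + - 1ℚ * a ≡ 0ℚ
      cancel = solve-∀ ℚ-ring
    YAX : ∀ e → (Y · (A · X)) e v ≡ Y e v
    YAX e = begin
      sumℚ (λ t → Y e t * (A · X) t v)
        ≡⟨ sumℚ-cong (λ t → trans (cong (Y e t *_) (AXsym v t)) (split (Y e t) (unit v t) ((A · X) v t))) ⟩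
      sumℚ (λ t → unit v t * Y e t + - 1ℚ * (Y e t * z t))
        ≡⟨ sumℚ-linear (- 1ℚ) (λ t → unit v t * Y e t) (λ t → Y e t * z t) ⟩
      sumℚ (λ t → unit v t * Y e t) + - 1ℚ * sumℚ (λ t → Y e t * z t)
        ≡⟨ cong₂ (λ a b → a + - 1ℚ * b) (sumℚ-unit v (Y e)) (sumOfRows-orthogonal z z⊥ e) ⟩
      Y e v + - 1ℚ * 0ℚ
        ≡⟨ drop (Y e v) ⟩
      Y e v ∎
      where
      split : ∀ y u q → y * q ≡ u * y + - 1ℚ * (y * (u + - 1ℚ * q))
      split = solve-∀ ℚ-ring
      drop : ∀ a → a + - 1ℚ * 0ℚ ≡ a
      drop = solve-∀ ℚ-ring

-- Walks, paths and connectivity.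

lookup-injective : ∀ {A : Set} {xs : List A} → Unique xs → ∀ i j → lookup xs i ≡ lookup xs j → i ≡ j
lookup-injective (x∉ ∷ _) zero    zero    _  = refl
lookup-injective (x∉ ∷ _) zero    (suc j) eq = ⊥-elim (All.lookup x∉ (∈-lookup j) eq)
lookup-injective (x∉ ∷ _) (suc i) zero    eq = ⊥-elim (All.lookup x∉ (∈-lookup i) (sym eq))
lookup-injective (_ ∷ u)  (suc i) (suc j) eq = cong suc (lookup-injective u i j eq)

unique-length : ∀ {n} {xs : List (Fin n)} → Unique xs → length xs ≤ n
unique-length u = injective⇒≤ (lookup-injective u _ _)

module Walks {n m : ℕ} (Γ : SignedGraph n m) where
  open SignedGraph Γ public

  Joins : Fin m → Fin n → Fin n → Set
  Joins g a b = ends g ≡ (a , b) ⊎ ends g ≡ (b , a)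

  joins-sym : ∀ {g a b} → Joins g a b → Joins g b a
  joins-sym (inj₁ p) = inj₂ p
  joins-sym (inj₂ p) = inj₁ p

  joins-ends : ∀ g → Joins g (proj₁ (ends g)) (proj₂ (ends g))
  joins-ends g = inj₁ refl

  joins-irrefl : ∀ {g a b} → Joins g a b → a ≢ b
  joins-irrefl {g} (inj₁ p) a≡b = loopless g (trans (cong proj₁ p) (trans a≡b (sym (cong proj₂ p))))
  joins-irrefl {g} (inj₂ p) a≡b = loopless g (trans (cong proj₁ p) (trans (sym a≡b) (sym (cong proj₂ p))))

  joins-functional : ∀ {g a b x y} → Joins g a b → Joins g x y → (a ≡ x × b ≡ y) ⊎ (a ≡ y × b ≡ x)
  joins-functional (inj₁ p) (inj₁ q) = inj₁ (cong proj₁ (trans (sym p) q) , cong proj₂ (trans (sym p) q))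
  joins-functional (inj₁ p) (inj₂ q) = inj₂ (cong proj₁ (trans (sym p) q) , cong proj₂ (trans (sym p) q))
  joins-functional (inj₂ p) (inj₁ q) = inj₂ (cong proj₂ (trans (sym p) q) , cong proj₁ (trans (sym p) q))
  joins-functional (inj₂ p) (inj₂ q) = inj₁ (cong proj₂ (trans (sym p) q) , cong proj₁ (trans (sym p) q))

  incident⁺ : ∀ {g a b} → Joins g a b → incident Γ g a ≡ true
  incident⁺ (inj₁ p) = ∨⁺ˡ (eqF⁺ (cong proj₁ p))
  incident⁺ {g} {a} (inj₂ p) = ∨⁺ʳ {eqF (proj₁ (ends g)) a} (eqF⁺ (cong proj₂ p))

  incident⁻ : ∀ {g a} → incident Γ g a ≡ true → ∃ λ b → Joins g a b
  incident⁻ {g} {a} h with ∨⁻ {eqF (proj₁ (ends g)) a} h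
  ... | inj₁ p = proj₂ (ends g) , inj₁ (cong (_, proj₂ (ends g)) (eqF⁻ p))
  ... | inj₂ p = proj₁ (ends g) , inj₂ (cong (proj₁ (ends g) ,_) (eqF⁻ p))

  other-joins : ∀ {g a b} → Joins g a b → other Γ g a ≡ b
  other-joins {g} {a} {b} j with proj₁ (ends g) ≟F a | j
  ... | yes _  | inj₁ p = cong proj₂ p
  ... | no ≢a  | inj₁ p = ⊥-elim (≢a (cong proj₁ p))
  ... | yes ≡a | inj₂ p = ⊥-elim (joins-irrefl j (sym (trans (sym (cong proj₁ p)) ≡a)))
  ... | no _   | inj₂ p = cong proj₁ p

  remove⁺ : ∀ (S : EdgeSet m) {e f} → S f ≡ true → f ≢ e → remove Γ S e f ≡ true
  remove⁺ S Sf f≢e = ∧⁺ Sf (not⁺ (eqF-no f≢e))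

  remove⁻ : ∀ (S : EdgeSet m) {e f} → remove Γ S e f ≡ true → S f ≡ true × f ≢ e
  remove⁻ S {e} {f} h = let Sf , ne = ∧⁻ {S f} h in Sf , λ f≡e → true≢false (eqF⁺ f≡e) (not⁻ ne)

  remove-self : ∀ (S : EdgeSet m) e → remove Γ S e e ≡ false
  remove-self S e = ¬true⇒false λ h → proj₂ (remove⁻ S h) refl

  infix 4 _⊑_
  _⊑_ : EdgeSet m → EdgeSet m → Set
  S ⊑ S′ = ∀ g → S g ≡ true → S′ g ≡ true

  remove-⊑ : ∀ (S : EdgeSet m) e → remove Γ S e ⊑ S
  remove-⊑ S e g h = proj₁ (remove⁻ S h)

  data Reach (S : EdgeSet m) : Fin n → Fin n → Set where
    here : ∀ {u} → Reach S u u
    step : ∀ {u x v} g → S g ≡ true → Joins g u x → Reach S x v → Reach S u v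

  reach-edge : ∀ {S g a b} → S g ≡ true → Joins g a b → Reach S a b
  reach-edge Sg j = step _ Sg j here

  reach-trans : ∀ {S u v x} → Reach S u v → Reach S v x → Reach S u x
  reach-trans here          q = q
  reach-trans (step g s j p) q = step g s j (reach-trans p q)

  reach-sym : ∀ {S u v} → Reach S u v → Reach S v u
  reach-sym here           = here
  reach-sym (step g s j p) = reach-trans (reach-sym p) (reach-edge s (joins-sym j))

  reach-bind : ∀ {S S′ u v} → (∀ g a b → S g ≡ true → Joins g a b → Reach S′ a b) → Reach S u v → Reach S′ u v
  reach-bind h here           = here
  reach-bind h (step g s j p) = reach-trans (h g _ _ s j) (reach-bind h p)

  reach-mono : ∀ {S S′ u v} → S ⊑ S′ → Reach S u v → Reach S′ u v
  reach-mono h = reach-bind λ g a b s j → reach-edge (h g s) j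

  data Path (S : EdgeSet m) : Fin n → Fin n → List (Fin m) → List (Fin n) → Set where
    stop : ∀ {v} → Path S v v [] (v ∷ [])
    step : ∀ {u x v es vs} g → S g ≡ true → Joins g u x → u ∉ vs → Path S x v es vs →
           Path S u v (g ∷ es) (u ∷ vs)

  path-suffix : ∀ {S x v es vs u} → Path S x v es vs → u ∈ vs →
    ∃₂ λ es′ vs′ → Path S u v es′ vs′ × (∀ {y} → y ∈ vs′ → y ∈ vs)
  path-suffix stop (here refl) = _ , _ , stop , id
  path-suffix p@(step _ _ _ _ _) (here refl) = _ , _ , p , id
  path-suffix (step g s j x∉ p) (there u∈) =
    let es′ , vs′ , q , sub = path-suffix p u∈ in es′ , vs′ , q , there ∘ sub

  -- Loop erasure: if the new vertex `u` already lies on the path, everything before that occurrence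
  -- is dropped.
  reach⇒path : ∀ {S u v} → Reach S u v → ∃₂ (Path S u v)
  reach⇒path here = _ , _ , stop
  reach⇒path {u = u} (step g s j r) with reach⇒path r
  ... | es , vs , p with mem? _≟F_ u vs
  ...   | yes u∈ = let es′ , vs′ , q , _ = path-suffix p u∈ in es′ , vs′ , q
  ...   | no u∉  = g ∷ es , u ∷ vs , step g s j u∉ p

  path-unique-vertices : ∀ {S u v es vs} → Path S u v es vs → Unique vs
  path-unique-vertices stop              = [] ∷ []
  path-unique-vertices (step g s j u∉ p) = AllP.¬Any⇒All¬ _ u∉ ∷ path-unique-vertices p

  path-length : ∀ {S u v es vs} → Path S u v es vs → length vs ≡ suc (length es)
  path-length stop             = refl
  path-length (step g s j _ p) = cong suc (path-length p)

  -- The pigeonhole bound that makes the cut-off `n` in `conn` and in `pathSgn` large enough.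
  path-bound : ∀ {S u v es vs} → Path S u v es vs → length es < n
  path-bound p = subst (_≤ n) (path-length p) (unique-length (path-unique-vertices p))

  reachN-suc : ∀ S k {u v} → reachN Γ S k u v ≡ true → reachN Γ S (suc k) u v ≡ true
  reachN-suc S k = ∨⁺ˡ

  reachN-mono : ∀ S {k l} {u v} → k ℕ.≤′ l → reachN Γ S k u v ≡ true → reachN Γ S l u v ≡ true
  reachN-mono S ℕ.≤′-refl h = h
  reachN-mono S {l = suc l} (ℕ.≤′-step k≤l) h = reachN-suc S l (reachN-mono S k≤l h)

  reachN-step : ∀ S k {u x v g} → reachN Γ S k u x ≡ true → S g ≡ true → Joins g x v →
    reachN Γ S (suc k) u v ≡ true
  reachN-step S k {u} {x} {v} {g} h s j = ∨⁺ʳ {reachN Γ S k u v} (anyF⁺ _ g (∧⁺ s (via j)))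
    where
    via : Joins g x v → ((reachN Γ S k u (proj₁ (ends g)) ∧ eqF (proj₂ (ends g)) v) ∨
                         (reachN Γ S k u (proj₂ (ends g)) ∧ eqF (proj₁ (ends g)) v)) ≡ true
    via (inj₁ p) = ∨⁺ˡ (∧⁺ (trans (cong (reachN Γ S k u) (cong proj₁ p)) h) (eqF⁺ (cong proj₂ p)))
    via (inj₂ p) = ∨⁺ʳ {reachN Γ S k u (proj₁ (ends g)) ∧ eqF (proj₂ (ends g)) v}
      (∧⁺ (trans (cong (reachN Γ S k u) (cong proj₂ p)) h) (eqF⁺ (cong proj₁ p)))

  -- The direction is reversed because `reachN` grows at its target while `Path` grows at its
  -- source.
  path⇒reachN : ∀ {S u v es vs} → Path S v u es vs → reachN Γ S (length es) u v ≡ true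
  path⇒reachN stop = eqF⁺ refl
  path⇒reachN {S} (step {es = es} g s j _ p) = reachN-step S (length es) (path⇒reachN p) s (joins-sym j)

  reachN⇒reach : ∀ S k {u v} → reachN Γ S k u v ≡ true → Reach S u v
  reachN⇒reach S zero h = subst (Reach S _) (eqF⁻ h) here
  reachN⇒reach S (suc k) {u} {v} h with ∨⁻ {reachN Γ S k u v} h
  ... | inj₁ h′ = reachN⇒reach S k h′
  ... | inj₂ h′ with anyF⁻ _ h′
  ...   | g , hg with ∧⁻ {S g} hg
  ...     | s , via with ∨⁻ {reachN Γ S k u (proj₁ (ends g)) ∧ eqF (proj₂ (ends g)) v} via
  ...       | inj₁ q = let r , e = ∧⁻ {reachN Γ S k u (proj₁ (ends g))} q in
    reach-trans (reachN⇒reach S k r) (reach-edge s (inj₁ (cong (proj₁ (ends g) ,_) (eqF⁻ e))))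
  ...       | inj₂ q = let r , e = ∧⁻ {reachN Γ S k u (proj₂ (ends g))} q in
    reach-trans (reachN⇒reach S k r) (reach-edge s (inj₂ (cong (_, proj₂ (ends g)) (eqF⁻ e))))

  conn⁺ : ∀ {S u v} → Reach S u v → conn Γ S u v ≡ true
  conn⁺ {S} r = let _ , _ , p = reach⇒path (reach-sym r) in
    reachN-mono S (ℕP.≤⇒≤′ (ℕP.<⇒≤ (path-bound p))) (path⇒reachN p)

  conn⁻ : ∀ {S u v} → conn Γ S u v ≡ true → Reach S u v
  conn⁻ {S} = reachN⇒reach S n

  conn-no : ∀ {S u v} → ¬ Reach S u v → conn Γ S u v ≡ false
  conn-no ¬r = ¬true⇒false (¬r ∘ conn⁻)

  reach? : ∀ S u v → Dec (Reach S u v)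
  reach? S u v with conn Γ S u v in eq
  ... | true  = yes (conn⁻ eq)
  ... | false = no λ r → true≢false (conn⁺ r) eq

  conn-cong : ∀ {S S′} → S ≗ S′ → ∀ u v → conn Γ S u v ≡ conn Γ S′ u v
  conn-cong h u v = iff⇒≡
    (λ r → conn⁺ (reach-mono (λ g s → trans (sym (h g)) s) (conn⁻ r)))
    (λ r → conn⁺ (reach-mono (λ g s → trans (h g) s) (conn⁻ r)))

  distinct⁻ : ∀ {k} (x : Fin k) xs → distinct (x ∷ xs) ≡ true → x ∉ xs × distinct xs ≡ true
  distinct⁻ x xs h = let a , d = ∧⁻ {not (anyList (eqF x) xs)} h in
    (λ x∈ → true≢false (anyList⁺ (eqF x) x∈ (eqF⁺ refl)) (not⁻ a)) , d

  distinct⁺ : ∀ {k} (x : Fin k) xs → x ∉ xs → distinct xs ≡ true → distinct (x ∷ xs) ≡ true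
  distinct⁺ x xs x∉ d = ∧⁺ (not⁺ (¬true⇒false λ h →
    let y , y∈ , x≡y = anyList⁻ (eqF x) xs h in x∉ (subst (_∈ xs) (sym (eqF⁻ x≡y)) y∈))) d

  path⇒walkVerts : ∀ {S u v es vs} → Path S u v es vs → walkVerts Γ S u es ≡ just vs
  path⇒walkVerts stop = refl
  path⇒walkVerts {S} {u} (step {es = es} g s j _ p)
    rewrite s | incident⁺ j | other-joins j | path⇒walkVerts p = refl

  path⇒distinct : ∀ {S u v es vs} → Path S u v es vs → distinct vs ≡ true × lastIs vs v ≡ true
  path⇒distinct stop = refl , eqF⁺ refl
  path⇒distinct (step g s j u∉ p) = let d , l = path⇒distinct p in distinct⁺ _ _ u∉ d , last p l
    where
    last : ∀ {S u x v es vs} → Path S x v es vs → lastIs vs v ≡ true → lastIs (u ∷ vs) v ≡ true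
    last stop             l = l
    last (step _ _ _ _ _) l = l

  isPath⁺ : ∀ {S u v es vs} → Path S u v es vs → isPath Γ S u es v ≡ true
  isPath⁺ p rewrite path⇒walkVerts p = let d , l = path⇒distinct p in ∧⁺ d l

  walkVerts⇒path : ∀ S es u v vs → walkVerts Γ S u es ≡ just vs → distinct vs ≡ true → lastIs vs v ≡ true →
    Path S u v es vs
  walkVerts⇒path S [] u v _ refl d l rewrite eqF⁻ l = stop
  walkVerts⇒path S (g ∷ es) u v vs eq d l with S g in s | incident Γ g u in i
  walkVerts⇒path S (g ∷ es) u v vs () d l | true | false
  walkVerts⇒path S (g ∷ es) u v vs () d l | false | _
  ... | true | true with walkVerts Γ S (other Γ g u) es in eq′
  walkVerts⇒path S (g ∷ es) u v vs () d l | true | true | nothing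
  -- A successful walk lists at least its starting vertex.
  walkVerts⇒path S (g ∷ es) u v _ refl d l | true | true | just [] = ⊥-elim (nonempty es _ eq′)
    where
    nonempty : ∀ es u → walkVerts Γ S u es ≢ just []
    nonempty [] u ()
    nonempty (g ∷ es) u h with S g ∧ incident Γ g u | walkVerts Γ S (other Γ g u) es
    nonempty (g ∷ es) u () | true  | just _
    nonempty (g ∷ es) u () | true  | nothing
    nonempty (g ∷ es) u () | false | _
  walkVerts⇒path S (g ∷ es) u v _ refl d l | true | true | just vs@(y ∷ ys) =
    let u∉ , d′ = distinct⁻ u vs d
        x , j = incident⁻ i
    in step g s (subst (Joins g u) (sym (other-joins j)) j) u∉ (walkVerts⇒path S es _ v vs eq′ d′ l)

  isPath⁻ : ∀ S u es v → isPath Γ S u es v ≡ true → ∃ (Path S u v es)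
  isPath⁻ S u es v h with walkVerts Γ S u es in eq
  ... | just vs = let d , l = ∧⁻ {distinct vs} h in vs , walkVerts⇒path S es u v vs eq d l

  listsUpTo-complete : ∀ k es → length es ≤ k → es ∈ listsUpTo Γ k
  listsUpTo-complete zero    [] _ = here refl
  listsUpTo-complete (suc k) [] _ = here refl
  listsUpTo-complete (suc k) (e ∷ es) (s≤s l) =
    there (∈-concatMap⁺ (λ e → map (e ∷_) (listsUpTo Γ k))
      (lose (∈-allFin e) (∈-map⁺ (e ∷_) (listsUpTo-complete k es l))))

  listsUpTo-unique : ∀ k → Unique (listsUpTo Γ k)
  listsUpTo-unique zero    = [] ∷ []
  listsUpTo-unique (suc k) = AllP.¬Any⇒All¬ _ []∉ ∷
    UniqueP.concat⁺ (AllP.map⁺ (All.tabulate λ {e} _ → UniqueP.map⁺ (λ { refl → refl }) (listsUpTo-unique k)))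
      (AllPairsP.map⁺ (AllPairs.map disjoint (UniqueP.allFin⁺ m)))
    where
    []∉ : [] ∉ concatMap (λ e → map (e ∷_) (listsUpTo Γ k)) (allFin m)
    []∉ h with find (∈-concatMap⁻ (λ e → map (e ∷_) (listsUpTo Γ k)) {xs = allFin m} h)
    ... | e , _ , h′ with ∈-map⁻ (e ∷_) h′
    ...   | _ , _ , ()
    disjoint : ∀ {e f} → e ≢ f → ∀ {es} → ¬ (es ∈ map (e ∷_) (listsUpTo Γ k) × es ∈ map (f ∷_) (listsUpTo Γ k))
    disjoint {e} {f} e≢f (p , q) with ∈-map⁻ (e ∷_) p | ∈-map⁻ (f ∷_) q
    ... | _ , _ , refl | _ , _ , refl = e≢f refl

  -- `pathSgn` sums over all paths. The candidate lists are pairwise distinct, so a unique path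
  -- contributes exactly one summand.
  pathSgn-unique : ∀ {S u v es vs} → Path S u v es vs →
    (∀ {es′ vs′} → Path S u v es′ vs′ → es′ ≡ es) → pathSgn Γ S u v ≡ sgnList Γ es
  pathSgn-unique {S} {u} {v} {es} p uniq = trans
    (cong (λ l → sumListℤ (map (sgnList Γ) l))
      (filterᵇ-single (λ es → isPath Γ S u es v) (listsUpTo-unique n)
        (λ es′ h → uniq (proj₂ (isPath⁻ S u es′ v h)))
        (listsUpTo-complete n es (ℕP.<⇒≤ (path-bound p))) (isPath⁺ p)))
    (ℤP.+-identityʳ (sgnList Γ es))

-- Cycles: parity arguments and sign holonomy.

toℚ : ℤ → ℚ
toℚ z = z ℚ./ 1

x≡-x⇒x≡0 : ∀ x → x ≡ - x → x ≡ 0ℚ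
x≡-x⇒x≡0 x h = begin
  x            ≡⟨ halve x ⟩
  ½ * (x + x)  ≡⟨ cong (λ z → ½ * (x + z)) h ⟩
  ½ * (x - x)  ≡⟨ cong (½ *_) (ℚP.+-inverseʳ x) ⟩
  ½ * 0ℚ       ≡⟨ ℚP.*-zeroʳ ½ ⟩
  0ℚ           ∎
  where
  open ≡-Reasoning
  halve : ∀ x → x ≡ ½ * (x + x)
  halve x = trans (sym (ℚP.*-identityˡ x)) (trans (ℚP.*-distribʳ-+ x ½ ½) (sym (ℚP.*-distribˡ-+ ½ x x)))

neg-involutive : ∀ x → - (- x) ≡ x
neg-involutive = solve-∀ ℚ-ring

neg-swap : ∀ {x y} → x ≡ - y → y ≡ - x
neg-swap {y = y} refl = sym (neg-involutive y)

module Cycles {n m : ℕ} (Γ : SignedGraph n m) where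
  open Walks Γ

  deg-cong : ∀ {C D} → C ≗ D → ∀ v → deg Γ C v ≡ deg Γ D v
  deg-cong h v = countF-cong λ e → cong (_∧ incident Γ e v) (h e)

  isCycle-cong : ∀ {C D} → C ≗ D → isCycle Γ C ≡ isCycle Γ D
  isCycle-cong h = cong₂ _∧_ (anyF-cong h) (cong₂ _∧_
    (allF-cong λ v → cong (λ d → eqℕ d 0 ∨ eqℕ d 2) (deg-cong h v))
    (allF-cong λ u → allF-cong λ v → cong₂ (λ x b → not x ∨ b)
      (cong₂ (λ d d′ → eqℕ d 2 ∧ eqℕ d′ 2) (deg-cong h u) (deg-cong h v)) (conn-cong h u v)))

  balancedCycle-cong : ∀ {C D} → C ≗ D → balancedCycle Γ C ≡ balancedCycle Γ D
  balancedCycle-cong h = cong even (countF-cong λ e → cong (_∧ isNeg Γ e) (h e))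

  subsetOf⁺ : ∀ {C S} → C ⊑ S → subsetOf Γ C S ≡ true
  subsetOf⁺ h = allF⁺ λ e → impl⁺ (h e)

  subsetOf⁻ : ∀ {C S} → subsetOf Γ C S ≡ true → C ⊑ S
  subsetOf⁻ h e = impl⁻ (allF⁻ _ h e)

  cycle-edge : ∀ {C} → isCycle Γ C ≡ true → ∃ λ e → C e ≡ true
  cycle-edge {C} h = anyF⁻ C (proj₁ (∧⁻ {anyF C} h))

  cycle-degree : ∀ {C} → isCycle Γ C ≡ true → ∀ v → deg Γ C v ≡ 0 ⊎ deg Γ C v ≡ 2
  cycle-degree {C} h v with ∨⁻ {eqℕ (deg Γ C v) 0} (allF⁻ _ (proj₁ (∧⁻ (proj₂ (∧⁻ {anyF C} h)))) v)
  ... | inj₁ p = inj₁ (⌊⌋⁻ (_ ℕP.≟ 0) p)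
  ... | inj₂ p = inj₂ (⌊⌋⁻ (_ ℕP.≟ 2) p)

  cycle-even : ∀ {C} → isCycle Γ C ≡ true → ∀ v → even (deg Γ C v) ≡ true
  cycle-even h v with cycle-degree h v
  ... | inj₁ p = cong even p
  ... | inj₂ p = cong even p

  cycle-connected : ∀ {C} → isCycle Γ C ≡ true → ∀ {e f a b x y} → C e ≡ true → Joins e a b →
    C f ≡ true → Joins f x y → Reach C a x
  cycle-connected {C} h {a = a} {x = x} Ce je Cf jf = conn⁻ (impl⁻
      (allF⁻ (λ v → pair a v) (allF⁻ (λ u → allF (pair u))
        (proj₂ (∧⁻ {allF (λ v → eqℕ (deg Γ C v) 0 ∨ eqℕ (deg Γ C v) 2)} (proj₂ (∧⁻ {anyF C} h)))) a) x)
      (∧⁺ (two Ce je) (two Cf jf)))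
    where
    pair : Fin n → Fin n → Bool
    pair u v = not (eqℕ (deg Γ C u) 2 ∧ eqℕ (deg Γ C v) 2) ∨ conn Γ C u v
    two : ∀ {e a b} → C e ≡ true → Joins e a b → eqℕ (deg Γ C a) 2 ≡ true
    two {e} {a} Ce j with cycle-degree h a
    ... | inj₂ p = ⌊⌋⁺ (_ ℕP.≟ 2) p
    ... | inj₁ p = ⊥-elim (countF-positive (λ g → C g ∧ incident Γ g a) e (∧⁺ Ce (incident⁺ j)) p)

  incident-xor : ∀ g v → incident Γ g v ≡ eqF (proj₁ (ends g)) v xor eqF (proj₂ (ends g)) v
  incident-xor g v with proj₁ (ends g) ≟F v | proj₂ (ends g) ≟F v
  ... | yes p | yes q = ⊥-elim (loopless g (trans p (sym q)))
  ... | yes _ | no _  = refl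
  ... | no _  | _     = refl

  -- The coboundary of `z` over the field with two elements: the indicator of the cut that `z`
  -- defines.
  boundary : (Fin n → Bool) → Fin m → Bool
  boundary z g = z (proj₁ (ends g)) xor z (proj₂ (ends g))

  boundary-incident : ∀ z g → ⊕.sum (λ v → z v ∧ incident Γ g v) ≡ boundary z g
  boundary-incident z g = trans
    (⊕.sum-cong-≗ λ v → trans (cong (z v ∧_) (incident-xor g v))
                              (∧-distribˡ-xor (z v) (eqF (proj₁ (ends g)) v) (eqF (proj₂ (ends g)) v)))
    (trans (⊕.∑-distrib-+ (λ v → z v ∧ eqF (proj₁ (ends g)) v) (λ v → z v ∧ eqF (proj₂ (ends g)) v))
           (cong₂ _xor_ (at (proj₁ (ends g))) (at (proj₂ (ends g)))))
    where
    ∧-false : ∀ a {b} → b ≡ false → a ∧ b ≡ false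
    ∧-false true  p = p
    ∧-false false p = refl
    ∧-true : ∀ a {b} → b ≡ true → a ∧ b ≡ a
    ∧-true true  p = p
    ∧-true false p = refl
    at : ∀ p → ⊕.sum (λ v → z v ∧ eqF p v) ≡ z p
    at p = trans (⊕.sum-single (λ v → z v ∧ eqF p v) p λ v v≢p → ∧-false (z v) (eqF-no (v≢p ∘ sym)))
                 (∧-true (z p) (eqF⁺ {a = p} refl))

  -- Even edge sets are orthogonal to cuts: after interchanging the sums, each vertex contributes
  -- `z v` times the parity of its degree.
  handshake : ∀ C → (∀ v → even (deg Γ C v) ≡ true) → ∀ z → ⊕.sum (λ g → C g ∧ boundary z g) ≡ false
  handshake C evenDeg z = begin
    ⊕.sum (λ g → C g ∧ boundary z g)
      ≡⟨ ⊕.sum-cong-≗ (λ g → trans (cong (C g ∧_) (sym (boundary-incident z g)))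
                                   (⊕.*-distribˡ-sum (C g) (λ v → z v ∧ incident Γ g v))) ⟩
    ⊕.sum (λ g → ⊕.sum (λ v → C g ∧ (z v ∧ incident Γ g v)))
      ≡⟨ ⊕.∑-comm (λ g v → C g ∧ (z v ∧ incident Γ g v)) ⟩
    ⊕.sum (λ v → ⊕.sum (λ g → C g ∧ (z v ∧ incident Γ g v)))
      ≡⟨ ⊕.sum-cong-≗ (λ v → ⊕.sum-cong-≗ λ g → exchange (C g) (z v) (incident Γ g v)) ⟩
    ⊕.sum (λ v → ⊕.sum (λ g → z v ∧ (C g ∧ incident Γ g v)))
      ≡⟨ ⊕.sum-zero _ (λ v → trans (sym (⊕.*-distribˡ-sum (z v) (λ g → C g ∧ incident Γ g v))) (vertex v)) ⟩
    false ∎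
    where
    open ≡-Reasoning
    exchange : ∀ a b d → a ∧ (b ∧ d) ≡ b ∧ (a ∧ d)
    exchange true  b d = refl
    exchange false true  d = refl
    exchange false false d = refl
    vertex : ∀ v → z v ∧ ⊕.sum (λ g → C g ∧ incident Γ g v) ≡ false
    vertex v with z v
    ... | false = refl
    ... | true  = not⁻ (trans (sym (even-countF (λ g → C g ∧ incident Γ g v))) (evenDeg v))

  -- Orthogonality to cuts determines the coboundary on the last edge from the others: in the sum of
  -- coboundary plus label over `C`, only the term of `e` survives. This replaces walking around the
  -- cycle, whose definition supplies no cyclic order.
  boundary-on-cycle : ∀ {C} → isCycle Γ C ≡ true → ∀ {e} → C e ≡ true → ∀ z (label : Fin m → Bool) →
    (∀ g → C g ≡ true → g ≢ e → boundary z g ≡ label g) →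
    boundary z e ≡ label e xor ⊕.sum (λ g → C g ∧ label g)
  boundary-on-cycle {C} h {e} Ce z label agree = solve (boundary z e) (label e) _ (begin
    boundary z e xor label e
      ≡⟨ cong (λ b → (b ∧ boundary z e) xor (b ∧ label e)) Ce ⟨
    (C e ∧ boundary z e) xor (C e ∧ label e)
      ≡⟨ ⊕.sum-single (λ g → (C g ∧ boundary z g) xor (C g ∧ label g)) e elsewhere ⟨
    ⊕.sum (λ g → (C g ∧ boundary z g) xor (C g ∧ label g))
      ≡⟨ ⊕.∑-distrib-+ (λ g → C g ∧ boundary z g) (λ g → C g ∧ label g) ⟩
    ⊕.sum (λ g → C g ∧ boundary z g) xor ⊕.sum (λ g → C g ∧ label g)
      ≡⟨ cong (_xor ⊕.sum (λ g → C g ∧ label g)) (handshake C (cycle-even h) z) ⟩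
    ⊕.sum (λ g → C g ∧ label g) ∎)
    where
    open ≡-Reasoning
    elsewhere : ∀ g → g ≢ e → (C g ∧ boundary z g) xor (C g ∧ label g) ≡ false
    elsewhere g g≢e with C g in Cg
    ... | false = refl
    ... | true  = trans (cong (_xor label g) (agree g Cg g≢e)) (xor-same (label g))
    solve : ∀ a b s → a xor b ≡ s → a ≡ b xor s
    solve true  true  s refl = refl
    solve true  false s refl = refl
    solve false true  s refl = refl
    solve false false s refl = refl

  boundary-joins : ∀ z {g a b} → Joins g a b → boundary z g ≡ z a xor z b
  boundary-joins z (inj₁ p) = cong₂ _xor_ (cong (z ∘ proj₁) p) (cong (z ∘ proj₂) p)
  boundary-joins z {a = a} {b} (inj₂ p) =
    trans (cong₂ _xor_ (cong (z ∘ proj₁) p) (cong (z ∘ proj₂) p)) (xor-comm (z b) (z a))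

  -- Let `z` mark the component of `a` in C - e. No other edge of `C` crosses this cut, and a cycle
  -- meets a cut evenly, so `e` does not cross it either.
  cycle-bypass : ∀ {C} → isCycle Γ C ≡ true → ∀ {e a b} → C e ≡ true → Joins e a b → Reach (remove Γ C e) a b
  cycle-bypass {C} h {e} {a} {b} Ce j = conn⁻ (same (conn⁺ here) (begin
    z a xor z b                                        ≡⟨ boundary-joins z j ⟨
    boundary z e                                       ≡⟨ boundary-on-cycle h Ce z (λ _ → false) closed ⟩
    ⊕.sum (λ g → C g ∧ false)                          ≡⟨ ⊕.sum-zero _ (λ g → ∧-zeroʳ (C g)) ⟩
    false                                              ∎))
    where
    open ≡-Reasoning
    z : Fin n → Bool
    z = conn Γ (remove Γ C e) a
    same : ∀ {x y} → x ≡ true → x xor y ≡ false → y ≡ true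
    same {y = true} refl _ = refl
    closed : ∀ g → C g ≡ true → g ≢ e → boundary z g ≡ false
    closed g Cg g≢e = trans (cong (z (proj₁ (ends g)) xor_) (sym (iff⇒≡
        (λ r → conn⁺ (reach-trans (conn⁻ r) edge)) (λ r → conn⁺ (reach-trans (conn⁻ r) (reach-sym edge))))))
      (xor-same (z (proj₁ (ends g))))
      where
      edge : Reach (remove Γ C e) (proj₁ (ends g)) (proj₂ (ends g))
      edge = reach-edge (remove⁺ C Cg g≢e) (joins-ends g)

  reach-bypass : ∀ {S e a b} → Joins e a b → Reach (remove Γ S e) a b → ∀ {u v} → Reach S u v →
    Reach (remove Γ S e) u v
  reach-bypass {S} {e} {a} {b} je around = reach-bind detour
    where
    detour : ∀ g x y → S g ≡ true → Joins g x y → Reach (remove Γ S e) x y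
    detour g x y Sg j with g ≟F e
    ... | no g≢e   = reach-edge (remove⁺ S Sg g≢e) j
    ... | yes refl with joins-functional je j
    ...   | inj₁ (refl , refl) = around
    ...   | inj₂ (refl , refl) = reach-sym around

  -- Along the walk each vertex is an end of `e` or inherits the side of its successor. The
  -- hypothesis on `v` starts the induction; in applications `v` is an end of `e`.
  reach-split : ∀ {S e a b} → Joins e a b → ∀ {u v} → Reach S u v → Reach (remove Γ S e) v a ⊎ Reach (remove Γ S e) v b →
    Reach (remove Γ S e) u a ⊎ Reach (remove Γ S e) u b
  reach-split je here d = d
  reach-split {S} {e} je (step g Sg j r) d with reach-split je r d | g ≟F e
  ... | inj₁ p | no g≢e = inj₁ (step g (remove⁺ S Sg g≢e) j p)
  ... | inj₂ p | no g≢e = inj₂ (step g (remove⁺ S Sg g≢e) j p)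
  ... | _ | yes refl with joins-functional je j
  ...   | inj₁ (refl , refl) = inj₁ here
  ...   | inj₂ (refl , refl) = inj₂ here

  sg : Fin m → ℚ
  sg g = toℚ (signℤ (σ g))

  sg-square : ∀ g → sg g * sg g ≡ 1ℚ
  sg-square g with σ g
  ... | Sign.+ = refl
  ... | Sign.- = refl

  -- The combinatorial form of annihilating the columns in `S`; see `dot⇒sat` and `sat⇒dot`.
  Sat : EdgeSet m → (Fin n → ℚ) → Set
  Sat S y = ∀ {g a b} → S g ≡ true → Joins g a b → y a ≡ sg g * y b

  sat-⊑ : ∀ {S S′ y} → S ⊑ S′ → Sat S′ y → Sat S y
  sat-⊑ h sat Sg = sat (h _ Sg)

  sg-flip : ∀ g {x y} → x ≡ sg g * y → y ≡ sg g * x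
  sg-flip g {x} {y} h = begin
    y                  ≡⟨ ℚP.*-identityˡ y ⟨
    1ℚ * y             ≡⟨ cong (_* y) (sg-square g) ⟨
    sg g * sg g * y    ≡⟨ ℚP.*-assoc (sg g) (sg g) y ⟩
    sg g * (sg g * y)  ≡⟨ cong (sg g *_) h ⟨
    sg g * x           ∎
    where open ≡-Reasoning

  sg-times : ∀ g x → (sg g * x ≡ x × isNeg Γ g ≡ false) ⊎ (sg g * x ≡ - x × isNeg Γ g ≡ true)
  sg-times g x with σ g
  ... | Sign.+ = inj₁ (ℚP.*-identityˡ x , refl)
  ... | Sign.- = inj₂ (trans (sym (ℚP.neg-distribˡ-* 1ℚ x)) (cong -_ (ℚP.*-identityˡ x)) , refl)

  reach-sign : ∀ {S y u v} → Sat S y → Reach S u v → y v ≡ y u ⊎ y v ≡ - y u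
  reach-sign sat here = inj₁ refl
  reach-sign {y = y} {u} {v} sat (step {x = x} g Sg j r)
    with reach-sign sat r | sg-times g (y u) | sg-flip g (sat Sg j)
  ... | inj₁ v≡x | inj₁ (s , _) | x≡ = inj₁ (trans v≡x (trans x≡ s))
  ... | inj₁ v≡x | inj₂ (s , _) | x≡ = inj₂ (trans v≡x (trans x≡ s))
  ... | inj₂ v≡x | inj₁ (s , _) | x≡ = inj₂ (trans v≡x (cong -_ (trans x≡ s)))
  ... | inj₂ v≡x | inj₂ (s , _) | x≡ = inj₁ (trans v≡x (trans (cong -_ (trans x≡ s)) (neg-involutive (y u))))

  reach-zero : ∀ {S y u v} → Sat S y → Reach S u v → y u ≡ 0ℚ → y v ≡ 0ℚ
  reach-zero sat r yu≡0 with reach-sign sat r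
  ... | inj₁ p = trans p yu≡0
  ... | inj₂ p = trans p (cong -_ yu≡0)

  -- The factor is the product of the signs on C - e, which is the sign of `e` times the sign of the
  -- cycle. If `y a` is nonzero, `y` takes only the values `y a` and `- y a` on the cycle, and
  -- parity decides which one occurs at `b`.
  holonomy : ∀ {C} → isCycle Γ C ≡ true → ∀ {e a b y} → C e ≡ true → Joins e a b → Sat (remove Γ C e) y →
    y a ≡ (if balancedCycle Γ C then sg e else - sg e) * y b
  holonomy {C} h {e} {a} {b} {y} Ce j sat with y a ℚP.≟ 0ℚ
  ... | yes ya≡0 = trans ya≡0 (sym (trans (cong (s *_) (reach-zero sat (cycle-bypass h Ce j) ya≡0)) (ℚP.*-zeroʳ s)))
    where s = if balancedCycle Γ C then sg e else - sg e
  ... | no ya≢0 = conclude (sg-times e (y b)) (reach-sign sat (cycle-bypass h Ce j)) (balancedCycle Γ C) refl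
    where
    -- On the edges of C - e the cut of `z` consists exactly of the negative edges, so
    -- `boundary-on-cycle` with label `isNeg Γ` applies.
    z : Fin n → Bool
    z v = ⌊ y v ℚP.≟ y a ⌋
    z-yes : ∀ {v} → y v ≡ y a → z v ≡ true
    z-yes {v} = ⌊⌋⁺ (y v ℚP.≟ y a)
    z-no : ∀ {v} → y v ≡ - y a → z v ≡ false
    z-no {v} p = ⌊⌋-no (y v ℚP.≟ y a) λ q → ya≢0 (x≡-x⇒x≡0 (y a) (trans (sym q) p))
    reached : ∀ {g x x′} → C g ≡ true → Joins g x x′ → Reach (remove Γ C e) a x
    reached Cg jg = reach-bypass j (cycle-bypass h Ce j) (cycle-connected h Ce j Cg jg)
    labelled : ∀ g → C g ≡ true → g ≢ e → boundary z g ≡ isNeg Γ g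
    labelled g Cg g≢e with sat (remove⁺ C Cg g≢e) (joins-ends g) | sg-times g (y (proj₂ (ends g)))
                         | reach-sign sat (reached Cg (joins-sym (joins-ends g)))
    ... | p | inj₁ (s , g+) | inj₁ q = trans (cong₂ _xor_ (z-yes (trans p (trans s q))) (z-yes q)) (sym g+)
    ... | p | inj₁ (s , g+) | inj₂ q = trans (cong₂ _xor_ (z-no (trans p (trans s q))) (z-no q)) (sym g+)
    ... | p | inj₂ (s , g-) | inj₁ q = trans (cong₂ _xor_ (z-no (trans p (trans s (cong -_ q)))) (z-yes q)) (sym g-)
    ... | p | inj₂ (s , g-) | inj₂ q = trans
      (cong₂ _xor_ (z-yes (trans p (trans s (trans (cong -_ q) (neg-involutive (y a)))))) (z-no q)) (sym g-)
    parity : z a xor z b ≡ isNeg Γ e xor not (balancedCycle Γ C)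
    parity = trans (sym (boundary-joins z j)) (trans (boundary-on-cycle h Ce z (isNeg Γ) labelled)
      (cong (isNeg Γ e xor_) (trans (sym (not-involutive _))
        (cong not (sym (even-countF (λ g → C g ∧ isNeg Γ g)))))))
    -- Of the eight combinations of edge sign, value at `b` and balance, four contradict `parity`;
    -- they are dismissed through this lemma.
    contra : ∀ {u v x s} {A : Set} → z a ≡ true → z b ≡ u → isNeg Γ e ≡ x → balancedCycle Γ C ≡ s →
      not u ≡ v → x xor not s ≡ not v → A
    contra {u} {v} {x} {s} za zb ne bal p q =
      ⊥-elim (absurd (trans (sym p) (trans (sym (cong₂ _xor_ za zb)) (trans parity (trans (cong₂ (λ a b → a xor not b) ne bal) q)))))
      where
      absurd : ∀ {v} → v ≡ not v → ⊥
      absurd {true} ()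
      absurd {false} ()
    conclude : (sg e * y b ≡ y b × isNeg Γ e ≡ false) ⊎ (sg e * y b ≡ - y b × isNeg Γ e ≡ true) →
      y b ≡ y a ⊎ y b ≡ - y a → ∀ s → balancedCycle Γ C ≡ s →
      y a ≡ (if s then sg e else - sg e) * y b
    conclude (inj₁ (p , _)) (inj₁ q) true  _ = trans (sym q) (sym p)
    conclude (inj₂ (p , _)) (inj₂ q) true  _ = trans (neg-swap q) (sym p)
    conclude (inj₂ (p , _)) (inj₁ q) false _ =
      trans (sym q) (trans (neg-swap p) (ℚP.neg-distribˡ-* (sg e) (y b)))
    conclude (inj₁ (p , _)) (inj₂ q) false _ =
      trans (neg-swap q) (trans (cong -_ (sym p)) (ℚP.neg-distribˡ-* (sg e) (y b)))
    conclude (inj₁ (_ , ne)) (inj₂ q) true  bal = contra {u = false} {true} (z-yes refl) (z-no q) ne bal refl refl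
    conclude (inj₁ (_ , ne)) (inj₁ q) false bal = contra {u = true} {false} (z-yes refl) (z-yes q) ne bal refl refl
    conclude (inj₂ (_ , ne)) (inj₁ q) true  bal = contra {u = true} {false} (z-yes refl) (z-yes q) ne bal refl refl
    conclude (inj₂ (_ , ne)) (inj₂ q) false bal = contra {u = false} {true} (z-yes refl) (z-no q) ne bal refl refl

-- Fundamental cycles, unique paths and sign potentials.

toℚᵘ-toℚ : ∀ z → ℚ.toℚᵘ (toℚ z) ℚᵘ.≃ ℚᵘ.mkℚᵘ z 0
toℚᵘ-toℚ z = ℚP.toℚᵘ-fromℚᵘ (ℚᵘ.mkℚᵘ z 0)

toℚ-* : ∀ a b → toℚ (a ℤ.* b) ≡ toℚ a * toℚ b
toℚ-* a b = ℚP.toℚᵘ-injective (begin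
  ℚ.toℚᵘ (toℚ (a ℤ.* b))                  ≈⟨ toℚᵘ-toℚ (a ℤ.* b) ⟩
  ℚᵘ.mkℚᵘ a 0 ℚᵘ.* ℚᵘ.mkℚᵘ b 0            ≈⟨ ℚᵘP.*-cong (toℚᵘ-toℚ a) (toℚᵘ-toℚ b) ⟨
  ℚ.toℚᵘ (toℚ a) ℚᵘ.* ℚ.toℚᵘ (toℚ b)      ≈⟨ ℚP.toℚᵘ-homo-* (toℚ a) (toℚ b) ⟨
  ℚ.toℚᵘ (toℚ a * toℚ b)                  ∎)
  where open ℚᵘP.≃-Reasoning

module Potentials {n m : ℕ} (Γ : SignedGraph n m) where
  open Walks Γ
  open Cycles Γ

  path-start : ∀ {S u v es vs} → Path S u v es vs → u ∈ vs
  path-start stop             = here refl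
  path-start (step _ _ _ _ _) = here refl

  path-end : ∀ {S u v es vs} → Path S u v es vs → v ∈ vs
  path-end stop             = here refl
  path-end (step _ _ _ _ p) = there (path-end p)

  path-avoids : ∀ {S x v es vs g u y} → Path S x v es vs → Joins g u y → u ∉ vs → Reach (remove Γ S g) x v
  path-avoids stop jg u∉ = here
  path-avoids {S} {g = g} (step h Sh jh _ p) jg u∉ =
    step h (remove⁺ S Sh h≢g) jh (path-avoids p jg (u∉ ∘ there))
    where
    h≢g : h ≢ g
    h≢g refl with joins-functional jg jh
    ... | inj₁ (refl , _) = u∉ (here refl)
    ... | inj₂ (refl , _) = u∉ (there (path-start p))

  edgesOf : List (Fin m) → EdgeSet m
  edgesOf es g = anyList (eqF g) es

  path-edges : ∀ {S u v es vs} → Path S u v es vs → edgesOf es ⊑ S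
  path-edges {S} (step g s j _ p) h h∈ with ∨⁻ {eqF h g} h∈
  ... | inj₁ q  = trans (cong S (eqF⁻ q)) s
  ... | inj₂ h∈ = path-edges p h h∈

  path-edge-vertex : ∀ {S x v es vs g u y} → Path S x v es vs → edgesOf es g ≡ true → Joins g u y → u ∈ vs
  path-edge-vertex {g = g} (step h _ jh _ p) g∈ jg with ∨⁻ {eqF g h} g∈
  ... | inj₂ g∈′ = there (path-edge-vertex p g∈′ jg)
  ... | inj₁ q with eqF⁻ q
  ...   | refl with joins-functional jg jh
  ...     | inj₁ (refl , _) = here refl
  ...     | inj₂ (refl , _) = there (path-start p)

  incident-indicator : ∀ {g a b} → Joins g a b → ∀ x →
    indicator (incident Γ g x) ≡ indicator (eqF x a) ℕ.+ indicator (eqF x b)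
  incident-indicator {g} {a} {b} j x with x ≟F a | x ≟F b
  ... | yes refl | yes refl = ⊥-elim (joins-irrefl j refl)
  ... | yes refl | no _     = cong indicator (incident⁺ j)
  ... | no _     | yes refl = cong indicator (incident⁺ (joins-sym j))
  ... | no x≢a   | no x≢b   = cong indicator (¬true⇒false λ i → [ x≢a ∘ proj₁ , x≢b ∘ proj₁ ]′
                                (joins-functional (proj₂ (incident⁻ i)) j))

  deg-insert : ∀ {C D g} → C g ≡ true → D g ≡ false → (∀ h → h ≢ g → C h ≡ D h) → ∀ x →
    deg Γ C x ≡ indicator (incident Γ g x) ℕ.+ deg Γ D x
  deg-insert {C} {D} {g} Cg Dg agree x = trans
    (countF-remove (λ e → C e ∧ incident Γ e x) (λ e → D e ∧ incident Γ e x) g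
      (λ h h≢g → cong (_∧ incident Γ h x) (agree h h≢g)) (cong (_∧ incident Γ g x) Dg))
    (cong (λ b → indicator (b ∧ incident Γ g x) ℕ.+ deg Γ D x) Cg)

  edgesOf-∷-self : ∀ g es → edgesOf (g ∷ es) g ≡ true
  edgesOf-∷-self g es = ∨⁺ˡ (eqF⁺ {a = g} refl)

  edgesOf-∷-other : ∀ g es h → h ≢ g → edgesOf (g ∷ es) h ≡ edgesOf es h
  edgesOf-∷-other g es h h≢g = cong (_∨ edgesOf es h) (eqF-no h≢g)

  -- The two ends are counted separately because the edge that closes the path supplies exactly
  -- these degrees; every vertex of the closed path then has degree 2.
  path-degree : ∀ {S u v es vs} → Path S u v es vs → ∀ x →
    indicator (eqF x u) ℕ.+ indicator (eqF x v) ℕ.+ deg Γ (edgesOf es) x ≡ 2 ℕ.* indicator (anyList (eqF x) vs)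
  path-degree {v = v} stop x = trans (cong (indicator (eqF x v) ℕ.+ indicator (eqF x v) ℕ.+_) (countF-false {m}))
    (double (eqF x v))
    where
    double : ∀ b → indicator b ℕ.+ indicator b ℕ.+ 0 ≡ 2 ℕ.* indicator (b ∨ false)
    double true  = refl
    double false = refl
  path-degree {u = u} {v} {g ∷ es} {_ ∷ vs} (step {x = y} g _ j u∉ p) x = begin
    U ℕ.+ V ℕ.+ deg Γ (edgesOf (g ∷ es)) x    ≡⟨ cong (U ℕ.+ V ℕ.+_) (trans
        (deg-insert (edgesOf-∷-self g es) (¬true⇒false λ g∈ → u∉ (path-edge-vertex p g∈ j)) (edgesOf-∷-other g es) x)
        (cong (ℕ._+ D) (incident-indicator j x))) ⟩
    U ℕ.+ V ℕ.+ (U ℕ.+ Y ℕ.+ D)               ≡⟨ regroup U V Y D ⟩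
    2 ℕ.* U ℕ.+ (Y ℕ.+ V ℕ.+ D)               ≡⟨ cong (2 ℕ.* U ℕ.+_) (path-degree p x) ⟩
    2 ℕ.* U ℕ.+ 2 ℕ.* indicator (anyList (eqF x) vs)
      ≡⟨ either ⟩
    2 ℕ.* indicator (eqF x u ∨ anyList (eqF x) vs) ∎
    where
    open ≡-Reasoning
    U = indicator (eqF x u)
    V = indicator (eqF x v)
    Y = indicator (eqF x y)
    D = deg Γ (edgesOf es) x
    regroup : ∀ u v y d → u ℕ.+ v ℕ.+ (u ℕ.+ y ℕ.+ d) ≡ 2 ℕ.* u ℕ.+ (y ℕ.+ v ℕ.+ d)
    regroup = ℕ-Ring.solve-∀
    either : 2 ℕ.* U ℕ.+ 2 ℕ.* indicator (anyList (eqF x) vs) ≡ 2 ℕ.* indicator (eqF x u ∨ anyList (eqF x) vs)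
    either with x ≟F u | anyList (eqF x) vs in x∈
    ... | no _     | _     = refl
    ... | yes _    | false = refl
    ... | yes refl | true  = let z , z∈ , x≡z = anyList⁻ (eqF x) vs x∈ in
      ⊥-elim (u∉ (subst (_∈ vs) (sym (eqF⁻ x≡z)) z∈))

  path-inside : ∀ {S u v es vs x} → Path S u v es vs → x ∈ vs → Reach (edgesOf es) u x
  path-inside p (here refl) with p
  ... | stop           = here
  ... | step _ _ _ _ _ = here
  path-inside (step {es = es} g _ j _ p) (there x∈) = step g (edgesOf-∷-self g es) j
    (reach-mono (λ h h∈ → ∨⁺ʳ {eqF h g} h∈) (path-inside p x∈))

  closed-path-isCycle : ∀ {F e a b es vs} → F e ≡ false → Joins e a b → Path F a b es vs →
    isCycle Γ (edgesOf (e ∷ es)) ≡ true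
  closed-path-isCycle {F} {e} {a} {b} {es} {vs} Fe j p = ∧⁺ (anyF⁺ C e (edgesOf-∷-self e es))
    (∧⁺ (allF⁺ λ v → zero-or-two (anyList (eqF v) vs) (degree v))
        (allF⁺ λ u → allF⁺ λ v → impl⁺ λ both → let du , dv = ∧⁻ {eqℕ (deg Γ C u) 2} both in
          conn⁺ (reach-trans (reach-sym (reached u du)) (reached v dv))))
    where
    C = edgesOf (e ∷ es)
    degree : ∀ x → deg Γ C x ≡ 2 ℕ.* indicator (anyList (eqF x) vs)
    degree x = trans (trans
      (deg-insert (edgesOf-∷-self e es) (¬true⇒false λ e∈ → true≢false (path-edges p e e∈) Fe) (edgesOf-∷-other e es) x)
      (cong (ℕ._+ deg Γ (edgesOf es) x) (incident-indicator j x))) (path-degree p x)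
    zero-or-two : ∀ {d} b → d ≡ 2 ℕ.* indicator b → eqℕ d 0 ∨ eqℕ d 2 ≡ true
    zero-or-two true  refl = refl
    zero-or-two false refl = refl
    reached : ∀ x → eqℕ (deg Γ C x) 2 ≡ true → Reach C a x
    reached x d with anyList (eqF x) vs in x∈ | degree x
    ... | true  | _ = let z , z∈ , x≡z = anyList⁻ (eqF x) vs x∈ in
      reach-mono (λ h h∈ → ∨⁺ʳ {eqF h e} h∈) (path-inside p (subst (_∈ vs) (sym (eqF⁻ x≡z)) z∈))
    ... | false | d≡0 = case trans (sym (⌊⌋⁻ (_ ℕP.≟ 2) d)) d≡0 of λ ()

  -- The fundamental cycle of `e` with respect to `F`: a path between the ends, closed by `e`.
  closing-cycle : ∀ {F e a b} → F e ≡ false → Joins e a b → Reach F a b →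
    ∃ λ C → isCycle Γ C ≡ true × C e ≡ true × (∀ g → C g ≡ true → g ≢ e → F g ≡ true)
  closing-cycle {e = e} Fe j r = let es , vs , p = reach⇒path r in
    edgesOf (e ∷ es) , closed-path-isCycle Fe j p , edgesOf-∷-self e es ,
    λ g g∈ g≢e → path-edges p g (trans (sym (edgesOf-∷-other e es g g≢e)) g∈)

  -- Local to the component of `v`, since in a TU-subgraph the other components keep their cycles.
  AcyclicAt : EdgeSet m → Fin n → Set
  AcyclicAt F v = ∀ C {e a b} → isCycle Γ C ≡ true → C ⊑ F → C e ≡ true → Joins e a b → Reach F v a → ⊥

  acyclicAt-reach : ∀ {F u v} → AcyclicAt F u → Reach F u v → AcyclicAt F v
  acyclicAt-reach ac r C h C⊑ Ce j r′ = ac C h C⊑ Ce j (reach-trans r r′)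

  acyclicAt-bridge : ∀ {F u x g} → AcyclicAt F u → F g ≡ true → Joins g u x → ¬ Reach (remove Γ F g) u x
  acyclicAt-bridge {F} {g = g} ac Fg j r =
    let C , h , Cg , rest = closing-cycle (remove-self F g) j r in
    ac C h (λ f Cf → case f ≟F g of λ { (yes refl) → Fg ; (no f≢g) → remove-⊑ F g f (rest f Cf f≢g) }) Cg j here

  -- If the first edges differ, both remainders avoid `u`; together with the second first edge they
  -- join the ends of the first one without using it, although it is a bridge.
  path-unique : ∀ {F u v es vs es′ vs′} → AcyclicAt F u → Path F u v es vs → Path F u v es′ vs′ → es ≡ es′
  path-unique ac stop stop = refl
  path-unique ac stop (step _ _ _ v∉ q) = ⊥-elim (v∉ (path-end q))
  path-unique ac (step _ _ _ v∉ p) stop = ⊥-elim (v∉ (path-end p))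
  path-unique {F} ac (step g Fg j u∉ p) (step g′ Fg′ j′ u∉′ q) with g ≟F g′
  ... | no g≢g′ = ⊥-elim (acyclicAt-bridge ac Fg j
    (step g′ (remove⁺ F Fg′ (g≢g′ ∘ sym)) j′ (reach-trans (path-avoids q j u∉′) (reach-sym (path-avoids p j u∉)))))
  ... | yes refl with joins-functional j j′
  ...   | inj₁ (_ , refl) = cong (g ∷_) (path-unique (acyclicAt-reach ac (reach-edge Fg j)) p q)
  ...   | inj₂ (refl , _) = ⊥-elim (joins-irrefl j′ refl)

  sgnℚ : List (Fin m) → ℚ
  sgnℚ es = toℚ (sgnList Γ es)

  sgnℚ-∷ : ∀ g es → sgnℚ (g ∷ es) ≡ sg g * sgnℚ es
  sgnℚ-∷ g es = toℚ-* (signℤ (σ g)) (sgnList Γ es)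

  path-sat : ∀ {S y u v es vs} → Sat S y → Path S u v es vs → y v ≡ sgnℚ es * y u
  path-sat {y = y} {u} sat stop = sym (ℚP.*-identityˡ (y u))
  path-sat {y = y} {u} {v} sat (step {x = x} {es = es} g Sg j _ p) = begin
    y v                          ≡⟨ path-sat sat p ⟩
    sgnℚ es * y x                ≡⟨ cong (sgnℚ es *_) (sat Sg (joins-sym j)) ⟩
    sgnℚ es * (sg g * y u)       ≡⟨ pull (sgnℚ es) (sg g) (y u) ⟩
    sg g * sgnℚ es * y u         ≡⟨ cong (_* y u) (sgnℚ-∷ g es) ⟨
    sgnℚ (g ∷ es) * y u          ∎
    where
    open ≡-Reasoning
    pull : ∀ a b d → a * (b * d) ≡ b * a * d
    pull = solve-∀ ℚ-ring

  -- Either the path from `x` misses `u` and is extended by `g`, or by uniqueness it begins with `g`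
  -- and continues as the path from `u`. As the sign of `g` squares to 1, both cases give the same
  -- relation.
  path-sign-step : ∀ {F u x v g es vs es′ vs′} → AcyclicAt F u → F g ≡ true → Joins g u x →
    Path F u v es vs → Path F x v es′ vs′ → sgnℚ es ≡ sg g * sgnℚ es′
  path-sign-step {F} {u} {x} {v} {g} {es} {vs} {es′} {vs′} ac Fg j p q with mem? _≟F_ u vs′
  ... | no u∉  = trans (cong sgnℚ (path-unique ac p (step g Fg j u∉ q))) (sgnℚ-∷ g es′)
  ... | yes u∈ = later q u∈
    where
    later : ∀ {vs′} → Path F x v es′ vs′ → u ∈ vs′ → sgnℚ es ≡ sg g * sgnℚ es′
    later stop (here refl) = ⊥-elim (joins-irrefl j refl)
    later (step _ _ _ _ _) (here refl) = ⊥-elim (joins-irrefl j refl)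
    later q@(step _ _ _ x∉ q′) (there u∈) =
      let es″ , vs″ , q″ , sub = path-suffix q′ u∈
          es′≡ = path-unique (acyclicAt-reach ac (reach-edge Fg j)) q (step g Fg (joins-sym j) (x∉ ∘ sub) q″)
      in sg-flip g (trans (cong sgnℚ es′≡) (trans (sgnℚ-∷ g es″) (cong (λ l → sg g * sgnℚ l) (path-unique ac q″ p))))

  -- Path signs from `v`, continued by zero so that compatibility also holds on edges of other
  -- components.
  pot : EdgeSet m → Fin n → Fin n → ℚ
  pot F v x = if conn Γ F v x then toℚ (pathSgn Γ F v x) else 0ℚ

  pot-in : ∀ {F v x} → Reach F v x → pot F v x ≡ toℚ (pathSgn Γ F v x)
  pot-in {F} {v} {x} r = cong (λ b → if b then toℚ (pathSgn Γ F v x) else 0ℚ) (conn⁺ r)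

  pot-out : ∀ {F v x} → ¬ Reach F v x → pot F v x ≡ 0ℚ
  pot-out {F} {v} {x} ¬r = cong (λ b → if b then toℚ (pathSgn Γ F v x) else 0ℚ) (conn-no ¬r)

  -- pathSgn F v follows paths that start at v, whereas edges are prepended to paths that end
  -- at v; path-sat turns the sign function of the latter into that of the former.
  signTo : EdgeSet m → Fin n → Fin n → ℚ
  signTo F v u with reach? F u v
  ... | yes r = sgnℚ (proj₁ (reach⇒path r))
  ... | no _  = 0ℚ

  signTo-sat : ∀ {F v} → AcyclicAt F v → Sat F (signTo F v)
  signTo-sat {F} {v} ac {g} {a} {b} Fg j with reach? F a v | reach? F b v
  ... | yes r | yes r′ = path-sign-step (acyclicAt-reach ac (reach-sym r)) Fg j
                           (proj₂ (proj₂ (reach⇒path r))) (proj₂ (proj₂ (reach⇒path r′)))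
  ... | yes r | no ¬r′ = ⊥-elim (¬r′ (reach-trans (reach-edge Fg (joins-sym j)) r))
  ... | no ¬r | yes r′ = ⊥-elim (¬r (reach-trans (reach-edge Fg j) r′))
  ... | no _  | no _   = sym (ℚP.*-zeroʳ (sg g))

  signTo-self : ∀ {F v} → AcyclicAt F v → signTo F v v ≡ 1ℚ
  signTo-self {F} {v} ac with reach? F v v
  ... | yes r = cong sgnℚ (path-unique ac (proj₂ (proj₂ (reach⇒path r))) stop)
  ... | no ¬r = ⊥-elim (¬r here)

  pot≡signTo : ∀ {F v} → AcyclicAt F v → ∀ x → pot F v x ≡ signTo F v x
  pot≡signTo {F} {v} ac x with reach? F v x
  ... | no ¬r = trans (pot-out ¬r) (sym out)
    where
    out : signTo F v x ≡ 0ℚ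
    out with reach? F x v
    ... | yes r = ⊥-elim (¬r (reach-sym r))
    ... | no _  = refl
  ... | yes r = let es , vs , p = reach⇒path r in begin
    pot F v x                   ≡⟨ pot-in r ⟩
    toℚ (pathSgn Γ F v x)       ≡⟨ cong toℚ (pathSgn-unique p λ q → path-unique ac q p) ⟩
    sgnℚ es                     ≡⟨ ℚP.*-identityʳ (sgnℚ es) ⟨
    sgnℚ es * 1ℚ                ≡⟨ cong (sgnℚ es *_) (signTo-self ac) ⟨
    sgnℚ es * signTo F v v      ≡⟨ path-sat (signTo-sat ac) p ⟨
    signTo F v x                ∎
    where open ≡-Reasoning

  pot-sat : ∀ {F v} → AcyclicAt F v → Sat F (pot F v)
  pot-sat {F} {v} ac {g} {a} {b} Fg j =
    trans (pot≡signTo ac a) (trans (signTo-sat ac Fg j) (cong (sg g *_) (sym (pot≡signTo ac b))))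

  pot-self : ∀ {F v} → AcyclicAt F v → pot F v v ≡ 1ℚ
  pot-self ac = trans (pot≡signTo ac _) (signTo-self ac)

  pot-unit : ∀ {F v x} → AcyclicAt F v → Reach F v x → pot F v x ≡ 1ℚ ⊎ pot F v x ≡ - 1ℚ
  pot-unit ac r with reach-sign (pot-sat ac) r
  ... | inj₁ p = inj₁ (trans p (pot-self ac))
  ... | inj₂ p = inj₂ (trans p (cong -_ (pot-self ac)))

-- Columns of the incidence matrix.

sumℚ-pair : ∀ {k} (f : Fin k → ℚ) p q → p ≢ q → (∀ j → j ≢ p → j ≢ q → f j ≡ 0ℚ) → sumℚ f ≡ f p + f q
sumℚ-pair f p q p≢q h = begin
  sumℚ f                                                        ≡⟨ sumℚ-cong split ⟩
  sumℚ (λ v → unit p v * f v + unit q v * f v)                  ≡⟨ sumℚ-+ (λ v → unit p v * f v) (λ v → unit q v * f v) ⟩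
  sumℚ (λ v → unit p v * f v) + sumℚ (λ v → unit q v * f v)     ≡⟨ cong₂ _+_ (sumℚ-unit p f) (sumℚ-unit q f) ⟩
  f p + f q                                                     ∎
  where
  open ≡-Reasoning
  left : ∀ x → x ≡ 1ℚ * x + 0ℚ * x
  left = solve-∀ ℚ-ring
  right : ∀ x → x ≡ 0ℚ * x + 1ℚ * x
  right = solve-∀ ℚ-ring
  neither : ∀ x → x ≡ 0ℚ → x ≡ 0ℚ * x + 0ℚ * x
  neither _ refl = refl
  split : ∀ v → f v ≡ unit p v * f v + unit q v * f v
  split v with p ≟F v | q ≟F v
  ... | yes refl | yes refl = ⊥-elim (p≢q refl)
  ... | yes refl | no _     = left (f v)
  ... | no _     | yes refl = right (f v)
  ... | no p≢v   | no q≢v   = neither (f v) (h v (p≢v ∘ sym) (q≢v ∘ sym))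

module Incidence {n m : ℕ} (Γ : SignedGraph n m) (N : Matrix ℤ n m) (inc : IsIncidenceMatrix Γ N) where
  open Walks Γ
  open Cycles Γ
  open Potentials Γ

  A : Matrix ℚ n m
  A = toℚM N

  tl hd : Fin m → Fin n
  tl = tail Γ N
  hd = head Γ N

  wℚ : Fin m → ℚ
  wℚ e = toℚ (w Γ N e)

  tail-head : ∀ e → Joins e (tl e) (hd e)
  tail-head e with σ e
  ... | Sign.+ with eqℤ (N (proj₁ (ends e)) e) (ℤ.+ 1)
  ...   | true  = inj₁ refl
  ...   | false = inj₂ refl
  tail-head e | Sign.- with toℕ (proj₁ (ends e)) ℕ.<ᵇ toℕ (proj₂ (ends e))
  ...   | true  = inj₁ refl
  ...   | false = inj₂ refl

  w-square : ∀ e → wℚ e * wℚ e ≡ 1ℚ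
  w-square e with isNeg Γ e ∧ eqℤ (N (proj₁ (ends e)) e) (ℤ.- (ℤ.+ 1)) ∧ eqℤ (N (proj₂ (ends e)) e) (ℤ.- (ℤ.+ 1))
  ... | true  = refl
  ... | false = refl

  dot-ends : ∀ y e → dot A y e ≡
    y (proj₁ (ends e)) * A (proj₁ (ends e)) e + y (proj₂ (ends e)) * A (proj₂ (ends e)) e
  dot-ends y e = sumℚ-pair (λ v → y v * A v e) (proj₁ (ends e)) (proj₂ (ends e)) (loopless e)
    λ v v≢p v≢q → trans (cong (λ z → y v * toℚ z) (proj₁ (inc e) v v≢p v≢q)) (ℚP.*-zeroʳ (y v))

  -- All conventions on head, tail and `w` are absorbed by this formula: it is checked on the four
  -- sign patterns allowed for a column, and afterwards the entries of `N` are not inspected again.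
  dot-tail-head : ∀ y e → dot A y e ≡ wℚ e * (y (tl e) - sg e * y (hd e))
  dot-tail-head y e = trans (dot-ends y e) (go (σ e) refl (proj₁ (proj₂ (inc e))) (proj₁ (proj₂ (proj₂ (inc e)))))
    where
    p = proj₁ (ends e)
    q = proj₂ (ends e)
    out-in : ∀ a b → a * 1ℚ + b * - 1ℚ ≡ 1ℚ * (a - 1ℚ * b)
    out-in = solve-∀ ℚ-ring
    in-out : ∀ a b → a * - 1ℚ + b * 1ℚ ≡ 1ℚ * (b - 1ℚ * a)
    in-out = solve-∀ ℚ-ring
    out-out : ∀ a b → a * 1ℚ + b * 1ℚ ≡ 1ℚ * (a - (- 1ℚ) * b)
    out-out = solve-∀ ℚ-ring
    out-out′ : ∀ a b → a * 1ℚ + b * 1ℚ ≡ 1ℚ * (b - (- 1ℚ) * a)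
    out-out′ = solve-∀ ℚ-ring
    in-in : ∀ a b → a * - 1ℚ + b * - 1ℚ ≡ - 1ℚ * (a - (- 1ℚ) * b)
    in-in = solve-∀ ℚ-ring
    in-in′ : ∀ a b → a * - 1ℚ + b * - 1ℚ ≡ - 1ℚ * (b - (- 1ℚ) * a)
    in-in′ = solve-∀ ℚ-ring
    Goal = y p * A p e + y q * A q e ≡ wℚ e * (y (tl e) - sg e * y (hd e))
    one : ∀ {x} → x ≡ ℤ.+ 1 → x ≡ ℤ.- (ℤ.+ 1) → ⊥
    one refl ()
    positive-out : σ e ≡ Sign.+ → N p e ≡ ℤ.+ 1 → N q e ≡ ℤ.- (ℤ.+ 1) → Goal
    positive-out s P Q rewrite s | P | Q = out-in (y p) (y q)
    positive-in : σ e ≡ Sign.+ → N p e ≡ ℤ.- (ℤ.+ 1) → N q e ≡ ℤ.+ 1 → Goal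
    positive-in s P Q rewrite s | P | Q = in-out (y p) (y q)
    negative-out : σ e ≡ Sign.- → N p e ≡ ℤ.+ 1 → N q e ≡ ℤ.+ 1 → Goal
    negative-out s P Q rewrite s | P | Q with toℕ p ℕ.<ᵇ toℕ q
    ... | true  = out-out (y p) (y q)
    ... | false = out-out′ (y p) (y q)
    negative-in : σ e ≡ Sign.- → N p e ≡ ℤ.- (ℤ.+ 1) → N q e ≡ ℤ.- (ℤ.+ 1) → Goal
    negative-in s P Q rewrite s | P | Q with toℕ p ℕ.<ᵇ toℕ q
    ... | true  = in-in (y p) (y q)
    ... | false = in-in′ (y p) (y q)
    neg = proj₁ (proj₂ (proj₂ (proj₂ (inc e))))
    pos = proj₂ (proj₂ (proj₂ (proj₂ (inc e))))
    go : ∀ s → σ e ≡ s → N p e ≡ ℤ.+ 1 ⊎ N p e ≡ ℤ.- (ℤ.+ 1) → N q e ≡ ℤ.+ 1 ⊎ N q e ≡ ℤ.- (ℤ.+ 1) → Goal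
    go Sign.+ s (inj₁ P) (inj₁ Q) = ⊥-elim (one P (trans (pos s) (cong ℤ.-_ Q)))
    go Sign.+ s (inj₁ P) (inj₂ Q) = positive-out s P Q
    go Sign.+ s (inj₂ P) (inj₁ Q) = positive-in s P Q
    go Sign.+ s (inj₂ P) (inj₂ Q) = ⊥-elim (one (trans (pos s) (cong ℤ.-_ Q)) P)
    go Sign.- s (inj₁ P) (inj₁ Q) = negative-out s P Q
    go Sign.- s (inj₁ P) (inj₂ Q) = ⊥-elim (one P (trans (neg s) Q))
    go Sign.- s (inj₂ P) (inj₁ Q) = ⊥-elim (one (trans (neg s) Q) P)
    go Sign.- s (inj₂ P) (inj₂ Q) = negative-in s P Q

  difference-zero : ∀ {x y} → x ≡ y → x - y ≡ 0ℚ
  difference-zero {x} refl = ℚP.+-inverseʳ x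

  zero-difference : ∀ {x y} → x - y ≡ 0ℚ → x ≡ y
  zero-difference {x} {y} h = trans (regroup x y) (trans (cong (_+ y) h) (ℚP.+-identityˡ y))
    where
    regroup : ∀ x y → x ≡ x - y + y
    regroup = solve-∀ ℚ-ring

  w-cancel : ∀ e {x} → wℚ e * x ≡ 0ℚ → x ≡ 0ℚ
  w-cancel e {x} h = begin
    x                      ≡⟨ ℚP.*-identityˡ x ⟨
    1ℚ * x                 ≡⟨ cong (_* x) (w-square e) ⟨
    wℚ e * wℚ e * x        ≡⟨ ℚP.*-assoc (wℚ e) (wℚ e) x ⟩
    wℚ e * (wℚ e * x)      ≡⟨ cong (wℚ e *_) h ⟩
    wℚ e * 0ℚ              ≡⟨ ℚP.*-zeroʳ (wℚ e) ⟩
    0ℚ                     ∎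
    where open ≡-Reasoning

  balanced⇒dot : ∀ {y} e {a b} → Joins e a b → y a ≡ sg e * y b → dot A y e ≡ 0ℚ
  balanced⇒dot {y} e j h = trans (dot-tail-head y e)
    (trans (cong (wℚ e *_) (difference-zero {y (tl e)} {sg e * y (hd e)} at-tail)) (ℚP.*-zeroʳ (wℚ e)))
    where
    at-tail : y (tl e) ≡ sg e * y (hd e)
    at-tail with joins-functional j (tail-head e)
    ... | inj₁ (refl , refl) = h
    ... | inj₂ (refl , refl) = sg-flip e h

  dot⇒balanced : ∀ {y} e {a b} → Joins e a b → dot A y e ≡ 0ℚ → y a ≡ sg e * y b
  dot⇒balanced {y} e j h with joins-functional j (tail-head e)
                            | zero-difference {y (tl e)} {sg e * y (hd e)} (w-cancel e (trans (sym (dot-tail-head y e)) h))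
  ... | inj₁ (refl , refl) | p = p
  ... | inj₂ (refl , refl) | p = sg-flip e p

  dot⇒sat : ∀ {S y} → (∀ g → S g ≡ true → dot A y g ≡ 0ℚ) → Sat S y
  dot⇒sat {y = y} h {g} Sg j = dot⇒balanced {y} g j (h g Sg)

  sat⇒dot : ∀ {S y} → Sat S y → ∀ g → S g ≡ true → dot A y g ≡ 0ℚ
  sat⇒dot {y = y} sat g Sg = balanced⇒dot {y} g (tail-head g) (sat Sg (tail-head g))

  IsUnit : ℚ → Set
  IsUnit x = x ≡ 1ℚ ⊎ x ≡ - 1ℚ

  sg-unit : ∀ g → IsUnit (sg g)
  sg-unit g with σ g
  ... | Sign.+ = inj₁ refl
  ... | Sign.- = inj₂ refl

  -- The value of the potential on the column `f`, up to the sign `wℚ f`: the failure of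
  -- compatibility across `f`.
  jump : EdgeSet m → Fin n → Fin m → ℚ
  jump F s f = pot F s (tl f) - sg f * pot F s (hd f)

  dot-pot : ∀ κ F s f → dot A (λ v → κ * pot F s v) f ≡ κ * (wℚ f * jump F s f)
  dot-pot κ F s f = trans (dot-*ˡ A κ (pot F s) f) (cong (κ *_) (dot-tail-head (pot F s) f))

  dot-pot-square : ∀ κ F s f →
    dot A (λ v → κ * pot F s v) f * dot A (λ v → κ * pot F s v) f ≡ κ * κ * (jump F s f * jump F s f)
  dot-pot-square κ F s f = trans (cong₂ _*_ (dot-pot κ F s f) (dot-pot κ F s f))
    (trans (regroup κ (wℚ f) (jump F s f)) (trans (cong (_* (κ * κ * (jump F s f * jump F s f))) (w-square f))
      (ℚP.*-identityˡ (κ * κ * (jump F s f * jump F s f)))))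
    where
    regroup : ∀ k w j → k * (w * j) * (k * (w * j)) ≡ w * w * (k * k * (j * j))
    regroup = solve-∀ ℚ-ring

  -- The origin of the constant 4: the jump is a difference of two units, hence 0 or ±2.
  jump-both : ∀ {F s f} → AcyclicAt F s → Reach F s (tl f) → Reach F s (hd f) →
    jump F s f ≡ 0ℚ ⊎ jump F s f * jump F s f ≡ toℚ (ℤ.+ 4)
  jump-both {F} {s} {f} ac r r′ = units (sg-unit f) (pot-unit ac r) (pot-unit ac r′)
    where
    units : ∀ {s p q} → IsUnit s → IsUnit p → IsUnit q →
      p - s * q ≡ 0ℚ ⊎ (p - s * q) * (p - s * q) ≡ toℚ (ℤ.+ 4)
    units (inj₁ refl) (inj₁ refl) (inj₁ refl) = inj₁ refl
    units (inj₁ refl) (inj₁ refl) (inj₂ refl) = inj₂ refl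
    units (inj₁ refl) (inj₂ refl) (inj₁ refl) = inj₂ refl
    units (inj₁ refl) (inj₂ refl) (inj₂ refl) = inj₁ refl
    units (inj₂ refl) (inj₁ refl) (inj₁ refl) = inj₂ refl
    units (inj₂ refl) (inj₁ refl) (inj₂ refl) = inj₁ refl
    units (inj₂ refl) (inj₂ refl) (inj₁ refl) = inj₁ refl
    units (inj₂ refl) (inj₂ refl) (inj₂ refl) = inj₂ refl

  jump-tail : ∀ {F s f} → AcyclicAt F s → Reach F s (tl f) → ¬ Reach F s (hd f) → jump F s f * jump F s f ≡ 1ℚ
  jump-tail {F} {s} {f} ac r ¬r = units (sg-unit f) (pot-unit ac r) (pot-out ¬r)
    where
    units : ∀ {s p q} → IsUnit s → IsUnit p → q ≡ 0ℚ → (p - s * q) * (p - s * q) ≡ 1ℚ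
    units (inj₁ refl) (inj₁ refl) refl = refl
    units (inj₁ refl) (inj₂ refl) refl = refl
    units (inj₂ refl) (inj₁ refl) refl = refl
    units (inj₂ refl) (inj₂ refl) refl = refl

  jump-head : ∀ {F s f} → AcyclicAt F s → ¬ Reach F s (tl f) → Reach F s (hd f) → jump F s f * jump F s f ≡ 1ℚ
  jump-head {F} {s} {f} ac ¬r r = units (sg-unit f) (pot-out ¬r) (pot-unit ac r)
    where
    units : ∀ {s p q} → IsUnit s → p ≡ 0ℚ → IsUnit q → (p - s * q) * (p - s * q) ≡ 1ℚ
    units (inj₁ refl) refl (inj₁ refl) = refl
    units (inj₁ refl) refl (inj₂ refl) = refl
    units (inj₂ refl) refl (inj₁ refl) = refl
    units (inj₂ refl) refl (inj₂ refl) = refl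

  jump-none : ∀ {F s f} → ¬ Reach F s (tl f) → ¬ Reach F s (hd f) → jump F s f ≡ 0ℚ
  jump-none {F} {s} {f} ¬r ¬r′ = difference-zero {pot F s (tl f)} {sg f * pot F s (hd f)} (trans (pot-out ¬r)
    (sym (trans (cong (sg f *_) (pot-out ¬r′)) (ℚP.*-zeroʳ (sg f)))))

  joined-weight : EdgeSet m → Fin m → ℚ
  joined-weight F f = if conn Γ F (tl f) (hd f) then toℚ (ℤ.+ 4) else 1ℚ

  joined-weight-yes : ∀ {F f} → Reach F (tl f) (hd f) → joined-weight F f ≡ toℚ (ℤ.+ 4)
  joined-weight-yes {F} {f} r = cong (λ b → if b then toℚ (ℤ.+ 4) else 1ℚ) (conn⁺ r)

  joined-weight-no : ∀ {F f} → ¬ Reach F (tl f) (hd f) → joined-weight F f ≡ 1ℚ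
  joined-weight-no {F} {f} ¬r = cong (λ b → if b then toℚ (ℤ.+ 4) else 1ℚ) (conn-no ¬r)

  -- The right side no longer mentions the anchor `s`: it only asks whether `f` closes a cycle over
  -- `F`. This makes it comparable with a ratio of weights 4^c.
  jump-square : ∀ {F s f} → AcyclicAt F s → jump F s f ≢ 0ℚ → jump F s f * jump F s f ≡ joined-weight F f
  jump-square {F} {s} {f} ac ≢0 with reach? F s (tl f) | reach? F s (hd f)
  ... | no ¬t | no ¬h = ⊥-elim (≢0 (jump-none ¬t ¬h))
  ... | yes t | no ¬h = trans (jump-tail ac t ¬h) (sym (joined-weight-no λ r → ¬h (reach-trans t r)))
  ... | no ¬t | yes h = trans (jump-head ac ¬t h) (sym (joined-weight-no λ r → ¬t (reach-trans h (reach-sym r))))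
  ... | yes t | yes h with jump-both ac t h
  ...   | inj₁ ≡0 = ⊥-elim (≢0 ≡0)
  ...   | inj₂ ≡4 = trans ≡4 (sym (joined-weight-yes (reach-trans (reach-sym t) h)))

-- Unbalanced unicyclic components: dual rows and weights.

module Bicircular {n m : ℕ} (Γ : SignedGraph n m) (N : Matrix ℤ n m) (inc : IsIncidenceMatrix Γ N) where
  open Walks Γ
  open Cycles Γ
  open Potentials Γ
  open Incidence Γ N inc

  isCycleIn : EdgeSet m → EdgeSet m → Bool
  isCycleIn H C = isCycle Γ C ∧ subsetOf Γ C H

  cyclesIn⁺ : ∀ {H C} → isCycle Γ C ≡ true → C ⊑ H → ∃ λ D → D ∈ cyclesIn Γ H × D ≗ C
  cyclesIn⁺ {H} {C} h C⊑ =
    let D , D∈ , D≗ = subsets-complete m C in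
    D , ∈-filterᵇ⁺ (isCycleIn H) D∈ (∧⁺ (trans (isCycle-cong D≗) h)
          (subsetOf⁺ λ g Dg → C⊑ g (trans (sym (D≗ g)) Dg))) , D≗

  cyclesIn⁻ : ∀ {H C} → C ∈ cyclesIn Γ H → isCycle Γ C ≡ true × C ⊑ H
  cyclesIn⁻ {H} {C} C∈ =
    let h , C⊑ = ∧⁻ {isCycle Γ C} (proj₂ (∈-filterᵇ⁻ (isCycleIn H) {xs = subsets m} C∈)) in h , subsetOf⁻ {C} {H} C⊑

  inComp⁺ : ∀ {H v C e a b} → isCycle Γ C ≡ true → C ⊑ H → C e ≡ true → Joins e a b → Reach H v a →
    inComp Γ N H v C ≡ true
  inComp⁺ h C⊑ Ce j r = allF⁺ λ g → impl⁺ λ Cg →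
    conn⁺ (reach-trans r (reach-mono C⊑ (cycle-connected h Ce j Cg (joins-ends g))))

  inComp⁻ : ∀ {H v C e} → inComp Γ N H v C ≡ true → C e ≡ true → Reach H v (proj₁ (ends e))
  inComp⁻ {e = e} h Ce = conn⁻ (impl⁻ (allF⁻ _ h e) Ce)

  cyclesAt : EdgeSet m → Fin n → List (EdgeSet m)
  cyclesAt H v = filterᵇ (inComp Γ N H v) (cyclesIn Γ H)

  cyclesAt⁻ : ∀ {H v C} → C ∈ cyclesAt H v → isCycle Γ C ≡ true × C ⊑ H × inComp Γ N H v C ≡ true
  cyclesAt⁻ {H} {v} C∈ =
    let C∈′ , at = ∈-filterᵇ⁻ (inComp Γ N H v) {xs = cyclesIn Γ H} C∈
        h , C⊑ = cyclesIn⁻ C∈′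
    in h , C⊑ , at

  componentsOK : EdgeSet m → Bool
  componentsOK H = allF (λ v → compOK Γ N (cyclesAt H v))

  record UnbalancedUnicyclic (H : EdgeSet m) : Set where
    field
      unbalanced : ∀ {C} → isCycle Γ C ≡ true → C ⊑ H → balancedCycle Γ C ≡ false
      single     : ∀ {C D e f a b x y} → isCycle Γ C ≡ true → isCycle Γ D ≡ true → C ⊑ H → D ⊑ H →
                   C e ≡ true → Joins e a b → D f ≡ true → Joins f x y → Reach H a x → C ≗ D
  open UnbalancedUnicyclic

  compOK-member : ∀ {L C D} → compOK Γ N L ≡ true → C ∈ L → D ∈ L → C ≡ D × balancedCycle Γ C ≡ false
  compOK-member {_ ∷ []} ok (here refl) (here refl) = refl , not⁻ ok

  componentsOK⇒unicyclic : ∀ {H} → componentsOK H ≡ true → UnbalancedUnicyclic H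
  componentsOK⇒unicyclic {H} ok = record
    { unbalanced = λ {C} h C⊑ →
        let e , Ce = cycle-edge h
            D , D∈ , D≗ = listed h C⊑ Ce (joins-ends e) here
        in trans (sym (balancedCycle-cong D≗)) (proj₂ (compOK-member (okAt _) D∈ D∈))
    ; single = λ {C} {D} h h′ C⊑ D⊑ Ce je Df jf r →
        let C′ , C′∈ , C≗ = listed h C⊑ Ce je here
            D′ , D′∈ , D≗ = listed h′ D⊑ Df jf r
            C′≡D′ , _ = compOK-member (okAt _) C′∈ D′∈
        in λ g → trans (sym (C≗ g)) (trans (cong (λ E → E g) C′≡D′) (D≗ g))
    }
    where
    okAt : ∀ v → compOK Γ N (cyclesAt H v) ≡ true
    okAt = allF⁻ (λ v → compOK Γ N (cyclesAt H v)) ok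
    listed : ∀ {C e a b v} → isCycle Γ C ≡ true → C ⊑ H → C e ≡ true → Joins e a b → Reach H v a →
      ∃ λ D → D ∈ cyclesAt H v × D ≗ C
    listed {v = v} h C⊑ Ce j r =
      let D , D∈ , D≗ = cyclesIn⁺ h C⊑
          h′ , D⊑ = cyclesIn⁻ D∈
      in D , ∈-filterᵇ⁺ (inComp Γ N H v) D∈ (inComp⁺ h′ D⊑ (trans (D≗ _) Ce) j r) , D≗

  HasBalancedCycle : EdgeSet m → Set
  HasBalancedCycle H = ∃ λ C → isCycle Γ C ≡ true × C ⊑ H × balancedCycle Γ C ≡ true

  -- The edge `e` can be deleted while `D` survives and, by the bypass along `C`, the component
  -- stays connected.
  record TwoCycles (H : EdgeSet m) : Set where
    field
      C D      : EdgeSet m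
      C-cycle  : isCycle Γ C ≡ true
      D-cycle  : isCycle Γ D ≡ true
      C⊑H      : C ⊑ H
      D⊑H      : D ⊑ H
      e        : Fin m
      e∈C      : C e ≡ true
      e∉D      : D e ≡ false
      together : ∀ {g f a b x y} → C g ≡ true → Joins g a b → D f ≡ true → Joins f x y → Reach H a x

  pointwise-different : ∀ {k} (C D : Fin k → Bool) → ¬ C ≗ D →
    (∃ λ e → C e ≡ true × D e ≡ false) ⊎ (∃ λ e → D e ≡ true × C e ≡ false)
  pointwise-different {zero}  C D h = ⊥-elim (h λ ())
  pointwise-different {suc k} C D h with C zero ≟B D zero
  ... | yes p = shift (pointwise-different (C ∘ suc) (D ∘ suc) λ e → h λ { zero → p ; (suc i) → e i })
    where
    shift : (∃ λ e → C (suc e) ≡ true × D (suc e) ≡ false) ⊎ (∃ λ e → D (suc e) ≡ true × C (suc e) ≡ false) → _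
    shift (inj₁ (e , r)) = inj₁ (suc e , r)
    shift (inj₂ (e , r)) = inj₂ (suc e , r)
  ... | no p≢q with C zero in p | D zero in q
  ...   | true  | false = inj₁ (zero , p , q)
  ...   | false | true  = inj₂ (zero , q , p)
  ...   | true  | true  = ⊥-elim (p≢q refl)
  ...   | false | false = ⊥-elim (p≢q refl)

  ¬componentsOK : ∀ {H} → componentsOK H ≡ false → HasBalancedCycle H ⊎ TwoCycles H
  ¬componentsOK {H} bad with allF-false (λ v → compOK Γ N (cyclesAt H v)) bad
  ... | v , bad-v = go (cyclesAt H v) refl bad-v
    where
    distinctCycles : AllPairs (λ C D → ¬ C ≗ D) (cyclesAt H v)
    distinctCycles = AllPairsP.filter⁺ (T? ∘ inComp Γ N H v)
      (AllPairsP.filter⁺ (T? ∘ isCycleIn H) (subsets-distinct m))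
    at : ∀ {C} → C ∈ cyclesAt H v → ∀ {g a b} → C g ≡ true → Joins g a b → Reach H v a
    at C∈ {g} Cg j with cyclesAt⁻ C∈ | joins-functional j (joins-ends g)
    ... | h , C⊑ , r | inj₁ (refl , _) = inComp⁻ r Cg
    ... | h , C⊑ , r | inj₂ (refl , _) = reach-trans (inComp⁻ r Cg) (reach-edge (C⊑ g Cg) (joins-ends g))
    go : ∀ L → cyclesAt H v ≡ L → compOK Γ N L ≡ false → HasBalancedCycle H ⊎ TwoCycles H
    go (C ∷ []) eq b =
      let h , C⊑ , _ = cyclesAt⁻ (subst (C ∈_) (sym eq) (here refl)) in
      inj₁ (C , h , C⊑ , trans (sym (not-involutive _)) (cong not b))
    go (C ∷ D ∷ _) eq _ with subst (AllPairs (λ C D → ¬ C ≗ D)) eq distinctCycles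
    ... | (C≠D ∷ _) ∷ _ = inj₂ (build (pointwise-different C D C≠D))
      where
      C∈ = subst (C ∈_) (sym eq) (here refl)
      D∈ = subst (D ∈_) (sym eq) (there (here refl))
      build : (∃ λ e → C e ≡ true × D e ≡ false) ⊎ (∃ λ e → D e ≡ true × C e ≡ false) → TwoCycles H
      build (inj₁ (e , Ce , De)) = record
        { C = C ; D = D ; C-cycle = proj₁ (cyclesAt⁻ C∈) ; D-cycle = proj₁ (cyclesAt⁻ D∈)
        ; C⊑H = proj₁ (proj₂ (cyclesAt⁻ C∈)) ; D⊑H = proj₁ (proj₂ (cyclesAt⁻ D∈))
        ; e = e ; e∈C = Ce ; e∉D = De
        ; together = λ Cg jg Df jf → reach-trans (reach-sym (at C∈ Cg jg)) (at D∈ Df jf) }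
      build (inj₂ (e , De , Ce)) = record
        { C = D ; D = C ; C-cycle = proj₁ (cyclesAt⁻ D∈) ; D-cycle = proj₁ (cyclesAt⁻ C∈)
        ; C⊑H = proj₁ (proj₂ (cyclesAt⁻ D∈)) ; D⊑H = proj₁ (proj₂ (cyclesAt⁻ C∈))
        ; e = e ; e∈C = De ; e∉D = Ce
        ; together = λ Dg jg Cf jf → reach-trans (reach-sym (at D∈ Dg jg)) (at C∈ Cf jf) }

  CycleAt : EdgeSet m → Fin n → Set
  CycleAt F v = ∃ λ C → isCycle Γ C ≡ true × C ⊑ F × (∃ λ e → C e ≡ true × Reach F v (proj₁ (ends e)))

  acyclicAt? : ∀ F v → CycleAt F v ⊎ AcyclicAt F v
  acyclicAt? F v with searchSubsets p ext
    where
    touches : EdgeSet m → Bool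
    touches C = anyF (λ e → C e ∧ conn Γ F v (proj₁ (ends e)))
    p : EdgeSet m → Bool
    p C = isCycle Γ C ∧ subsetOf Γ C F ∧ touches C
    ext : ∀ {C D} → C ≗ D → p C ≡ true → p D ≡ true
    ext {C} {D} C≗D = trans (sym (cong₂ _∧_ (isCycle-cong C≗D) (cong₂ _∧_
      (allF-cong λ e → cong (λ b → not b ∨ F e) (C≗D e))
      (anyF-cong λ e → cong (_∧ conn Γ F v (proj₁ (ends e))) (C≗D e)))))
  ... | inj₁ (C , pC) =
    let h , pC′ = ∧⁻ {isCycle Γ C} pC
        C⊑ , t = ∧⁻ {subsetOf Γ C F} pC′
        e , te = anyF⁻ (λ e → C e ∧ conn Γ F v (proj₁ (ends e))) t
        Ce , r = ∧⁻ {C e} te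
    in inj₁ (C , h , subsetOf⁻ {C} {F} C⊑ , e , Ce , conn⁻ r)
  ... | inj₂ none = inj₂ λ C {e} h C⊑ Ce j r → true≢false
    (∧⁺ h (∧⁺ (subsetOf⁺ C⊑) (anyF⁺ _ e (∧⁺ Ce (conn⁺ (to-first C⊑ Ce j r)))))) (none C)
    where
    to-first : ∀ {C e a b} → C ⊑ F → C e ≡ true → Joins e a b → Reach F v a → Reach F v (proj₁ (ends e))
    to-first {e = e} C⊑ Ce j r with joins-functional j (joins-ends e)
    ... | inj₁ (refl , _) = r
    ... | inj₂ (refl , refl) = reach-trans r (reach-edge (C⊑ e Ce) j)

  -- How the row dual to e is obtained: e lies on the cycle of its component, or e is a bridge
  -- and the row is supported on the side of e that carries no cycle.
  data DualShape (H : EdgeSet m) (e : Fin m) : Set where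
    on-cycle  : Reach (remove Γ H e) (tl e) (hd e) → AcyclicAt (remove Γ H e) (tl e) →
                pot (remove Γ H e) (tl e) (tl e) ≡ - sg e * pot (remove Γ H e) (tl e) (hd e) → DualShape H e
    tail-side : ¬ Reach (remove Γ H e) (tl e) (hd e) → AcyclicAt (remove Γ H e) (tl e) → DualShape H e
    head-side : ¬ Reach (remove Γ H e) (tl e) (hd e) → CycleAt (remove Γ H e) (tl e) →
                AcyclicAt (remove Γ H e) (hd e) → DualShape H e

  anchor : ∀ {H e} → DualShape H e → Fin n
  anchor {e = e} (on-cycle _ _ _)  = tl e
  anchor {e = e} (tail-side _ _)   = tl e
  anchor {e = e} (head-side _ _ _) = hd e

  -- Normalises the value on the column `e` to 1. The jump across `e` is 2 on the cycle, where going
  -- around reverses the sign; it is 1 from the tail side and `- sg e` from the head side.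
  scale : ∀ {H e} → DualShape H e → ℚ
  scale {e = e} (on-cycle _ _ _)  = wℚ e * ½
  scale {e = e} (tail-side _ _)   = wℚ e
  scale {e = e} (head-side _ _ _) = wℚ e * - sg e

  dualRow : ∀ {H e} → DualShape H e → Fin n → ℚ
  dualRow {H} {e} d v = scale d * pot (remove Γ H e) (anchor d) v

  dual-acyclic : ∀ {H e} (d : DualShape H e) → AcyclicAt (remove Γ H e) (anchor d)
  dual-acyclic (on-cycle _ ac _)  = ac
  dual-acyclic (tail-side _ ac)   = ac
  dual-acyclic (head-side _ _ ac) = ac

  dualRow-self : ∀ {H e} (d : DualShape H e) → dot A (dualRow d) e ≡ 1ℚ
  dualRow-self {H} {e} d = trans (dot-pot (scale d) (remove Γ H e) (anchor d) e) (value d)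
    where
    F = remove Γ H e
    value : ∀ d → scale d * (wℚ e * jump F (anchor d) e) ≡ 1ℚ
    value (on-cycle _ ac turn) = trans
      (cong (λ j → wℚ e * ½ * (wℚ e * j)) (trans (double (pot F (tl e) (tl e)) (sg e) _ turn) (cong₂ _+_ (pot-self ac) (pot-self ac))))
      (trans (half (wℚ e)) (w-square e))
      where
      half : ∀ w → w * ½ * (w * (1ℚ + 1ℚ)) ≡ w * w
      half w = trans (regroup w ½ (1ℚ + 1ℚ)) (ℚP.*-identityʳ (w * w))
        where
        regroup : ∀ w h t → w * h * (w * t) ≡ w * w * (h * t)
        regroup = solve-∀ ℚ-ring
      double : ∀ a s b → a ≡ - s * b → a - s * b ≡ a + a
      double a s b h = trans (rewrite-neg a s b) (cong (a +_) (sym h))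
        where
        rewrite-neg : ∀ a s b → a - s * b ≡ a + - s * b
        rewrite-neg = solve-∀ ℚ-ring
    value (tail-side ¬r ac) = trans
      (cong₂ (λ a b → wℚ e * (wℚ e * (a - sg e * b))) (pot-self ac) (pot-out ¬r))
      (trans (simplify (wℚ e) (sg e)) (w-square e))
      where
      simplify : ∀ w s → w * (w * (1ℚ - s * 0ℚ)) ≡ w * w
      simplify = solve-∀ ℚ-ring
    value (head-side ¬r _ ac) = trans
      (cong₂ (λ a b → wℚ e * - sg e * (wℚ e * (a - sg e * b))) (pot-out (¬r ∘ reach-sym)) (pot-self ac))
      (trans (simplify (wℚ e) (sg e)) (cong₂ _*_ (w-square e) (sg-square e)))
      where
      simplify : ∀ w s → w * - s * (w * (0ℚ - s * 1ℚ)) ≡ w * w * (s * s)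
      simplify = solve-∀ ℚ-ring

  dualRow-other : ∀ {H e} (d : DualShape H e) g → H g ≡ true → g ≢ e → dot A (dualRow d) g ≡ 0ℚ
  dualRow-other {H} {e} d g Hg g≢e = trans (dot-*ˡ A (scale d) (pot (remove Γ H e) (anchor d)) g)
    (trans (cong (scale d *_) (sat⇒dot (pot-sat (dual-acyclic d)) g (remove⁺ H Hg g≢e))) (ℚP.*-zeroʳ (scale d)))

  -- The factor ½ occurs exactly when `e` lies on a cycle, and its square cancels the 4 that the
  -- cycle contributes.
  scale-weight : ∀ {H e} (d : DualShape H e) → scale d * scale d * joined-weight (remove Γ H e) e ≡ 1ℚ
  scale-weight {H} {e} (on-cycle r _ _) = trans (cong (wℚ e * ½ * (wℚ e * ½) *_) (joined-weight-yes r))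
    (trans (regroup (wℚ e) ½ (toℚ (ℤ.+ 4))) (trans (ℚP.*-identityʳ (wℚ e * wℚ e)) (w-square e)))
    where
    regroup : ∀ w h t → w * h * (w * h) * t ≡ w * w * (h * h * t)
    regroup = solve-∀ ℚ-ring
  scale-weight {H} {e} (tail-side ¬r _) = trans (cong (wℚ e * wℚ e *_) (joined-weight-no ¬r))
    (trans (ℚP.*-identityʳ (wℚ e * wℚ e)) (w-square e))
  scale-weight {H} {e} (head-side ¬r _ _) = trans (cong (wℚ e * - sg e * (wℚ e * - sg e) *_) (joined-weight-no ¬r))
    (trans (regroup (wℚ e) (sg e)) (cong₂ _*_ (w-square e) (sg-square e)))
    where
    regroup : ∀ w s → w * - s * (w * - s) * 1ℚ ≡ w * w * (s * s)
    regroup = solve-∀ ℚ-ring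

  -- If the ends of `e` stay connected, `e` lies on the only cycle of its component, deleting it
  -- leaves no cycle there, and the holonomy of this unbalanced cycle gives the sign reversal.
  -- Otherwise `e` is a bridge, and cycles on both sides would be two cycles in one component of
  -- `H`.
  unicyclic-dual : ∀ {H e} → UnbalancedUnicyclic H → H e ≡ true → DualShape H e
  unicyclic-dual {H} {e} u He with reach? (remove Γ H e) (tl e) (hd e) | acyclicAt? (remove Γ H e) (tl e)
  ... | yes r | _ =
    let C , h , Ce , rest = closing-cycle (remove-self H e) (tail-head e) r
        C⊑H : C ⊑ H
        C⊑H g Cg = case g ≟F e of λ { (yes refl) → He ; (no g≢e) → remove-⊑ H e g (rest g Cg g≢e) }
        ac : AcyclicAt (remove Γ H e) (tl e)
        ac D h′ D⊑ Df jf r′ = true≢false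
          (D⊑ e (trans (sym (single u h h′ C⊑H (λ g Dg → remove-⊑ H e g (D⊑ g Dg)) Ce (tail-head e) Df jf
            (reach-mono (remove-⊑ H e) r′) e)) Ce))
          (remove-self H e)
    in on-cycle r ac (trans
      (holonomy h Ce (tail-head e) (sat-⊑ (λ g Cg → let Cg′ , g≢e = remove⁻ C Cg in rest g Cg′ g≢e) (pot-sat ac)))
      (cong (λ b → (if b then sg e else - sg e) * pot (remove Γ H e) (tl e) (hd e)) (unbalanced u h C⊑H)))
  ... | no ¬r | inj₂ ac = tail-side ¬r ac
  ... | no ¬r | inj₁ at@(C , h , C⊑ , f , Cf , rf) = head-side ¬r at λ D {g} h′ D⊑ Dg jg rg →
    let up : ∀ {S} → S ⊑ remove Γ H e → S ⊑ H
        up S⊑ k Sk = remove-⊑ H e k (S⊑ k Sk)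
        across = reach-trans (reach-sym (reach-mono (remove-⊑ H e) rf))
          (reach-trans (reach-edge He (tail-head e)) (reach-mono (remove-⊑ H e) rg))
        C≗D = single u h h′ (up C⊑) (up D⊑) Cf (joins-ends f) Dg jg across
    in ¬r (reach-trans rf (reach-trans (reach-mono C⊑ (cycle-connected h Cf (joins-ends f) (trans (C≗D g) Dg) jg)) (reach-sym rg)))

  cycleCount-cong : ∀ {H H′} → H ≗ H′ → c Γ N H ≡ c Γ N H′
  cycleCount-cong h = cong length (filterᵇ-cong
    (λ C → cong (isCycle Γ C ∧_) (allF-cong λ e → cong (not (C e) ∨_) (h e))) (subsets m))

  joined : EdgeSet m → Fin m → Bool
  joined F e = conn Γ F (tl e) (hd e)

  -- Cycles avoiding `e` are the cycles of H - e. A cycle through `e` exists exactly when the ends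
  -- of `e` stay connected, and `single` allows only one.
  cycleCount-remove : ∀ {H e} → UnbalancedUnicyclic H → H e ≡ true →
    c Γ N H ≡ c Γ N (remove Γ H e) ℕ.+ indicator (joined (remove Γ H e) e)
  cycleCount-remove {H} {e} u He = trans
    (length-filterᵇ-split (isCycleIn H) (isCycleIn F) through split (subsets m))
    (cong (c Γ N F ℕ.+_) count-through)
    where
    F = remove Γ H e
    through : EdgeSet m → Bool
    through C = isCycleIn H C ∧ C e
    avoiding : ∀ C → C e ≡ false → subsetOf Γ C H ≡ subsetOf Γ C F
    avoiding C Ce = iff⇒≡
      (λ s → subsetOf⁺ λ g Cg → remove⁺ H (subsetOf⁻ {C} {H} s g Cg) λ { refl → true≢false Cg Ce })
      (λ s → subsetOf⁺ λ g Cg → remove-⊑ H e g (subsetOf⁻ {C} {F} s g Cg))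
    split : ∀ C → indicator (isCycleIn H C) ≡ indicator (isCycleIn F C) ℕ.+ indicator (through C)
    split C with C e in Ce
    ... | false rewrite avoiding C Ce = add-none (isCycleIn F C)
      where
      add-none : ∀ b → indicator b ≡ indicator b ℕ.+ indicator (b ∧ false)
      add-none true  = refl
      add-none false = refl
    ... | true rewrite ¬true⇒false {subsetOf Γ C F} (λ s → true≢false (subsetOf⁻ {C} {F} s e Ce) (remove-self H e)) =
      add-all (isCycle Γ C) (subsetOf Γ C H)
      where
      add-all : ∀ a b → indicator (a ∧ b) ≡ indicator (a ∧ false) ℕ.+ indicator ((a ∧ b) ∧ true)
      add-all true  true  = refl
      add-all true  false = refl
      add-all false _     = refl
    through⁻ : ∀ {C} → through C ≡ true → isCycle Γ C ≡ true × C ⊑ H × C e ≡ true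
    through⁻ {C} t = let i , Ce = ∧⁻ {isCycleIn H C} t
                         h , s = ∧⁻ {isCycle Γ C} i in h , subsetOf⁻ {C} {H} s , Ce
    count-through : length (filterᵇ through (subsets m)) ≡ indicator (joined F e)
    count-through with reach? F (tl e) (hd e)
    ... | no ¬r rewrite conn-no ¬r = length-filterᵇ-none through (subsets m) λ C t →
      let h , C⊑ , Ce = through⁻ t in
      ¬r (reach-mono (λ g Cg → let Cg′ , g≢e = remove⁻ C Cg in remove⁺ H (C⊑ g Cg′) g≢e) (cycle-bypass h Ce (tail-head e)))
    ... | yes r rewrite conn⁺ r =
      let C , h , Ce , rest = closing-cycle (remove-self H e) (tail-head e) r
          C⊑H : C ⊑ H
          C⊑H g Cg = case g ≟F e of λ { (yes refl) → He ; (no g≢e) → remove-⊑ H e g (rest g Cg g≢e) }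
      in length-filterᵇ-subset through C
        (λ D D≗ → ∧⁺ (∧⁺ (trans (isCycle-cong D≗) h) (subsetOf⁺ λ g Dg → C⊑H g (trans (sym (D≗ g)) Dg))) (trans (D≗ e) Ce))
        (λ D t → let h′ , D⊑ , De = through⁻ t in
          single u h′ h D⊑ C⊑H De (tail-head e) Ce (tail-head e) here)

  cycleWeight : EdgeSet m → ℚ
  cycleWeight H = ℕtoℚ (4 ℕ.^ c Γ N H)

  cycleWeight-remove : ∀ {H e} → UnbalancedUnicyclic H → H e ≡ true →
    cycleWeight H ≡ joined-weight (remove Γ H e) e * cycleWeight (remove Γ H e)
  cycleWeight-remove {H} {e} u He = trans (cong (λ k → ℕtoℚ (4 ℕ.^ k)) (cycleCount-remove u He))
    (power (joined (remove Γ H e) e) (c Γ N (remove Γ H e)))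
    where
    power : ∀ b k → ℕtoℚ (4 ℕ.^ (k ℕ.+ indicator b)) ≡ (if b then toℚ (ℤ.+ 4) else 1ℚ) * ℕtoℚ (4 ℕ.^ k)
    power false k = trans (cong (λ l → ℕtoℚ (4 ℕ.^ l)) (ℕP.+-identityʳ k)) (sym (ℚP.*-identityˡ (ℕtoℚ (4 ℕ.^ k))))
    power true  k = trans (cong (λ l → ℕtoℚ (4 ℕ.^ l)) (ℕP.+-comm k 1))
      (trans (cong toℚ (ℤP.pos-* 4 (4 ℕ.^ k))) (toℚ-* (ℤ.+ 4) (ℤ.+ (4 ℕ.^ k))))

  -- Both weights are compared with that of the common part `F`. The ratio is `joined-weight F f`
  -- over `joined-weight F e`: the numerator is the squared jump, the inverse of the denominator is
  -- the squared scale.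
  cycleWeight-exchange : ∀ {H H′ e f} (d : DualShape H e) → UnbalancedUnicyclic H → UnbalancedUnicyclic H′ →
    H e ≡ true → H′ f ≡ true → remove Γ H e ≗ remove Γ H′ f → dot A (dualRow d) f ≢ 0ℚ →
    cycleWeight H′ ≡ dot A (dualRow d) f * dot A (dualRow d) f * cycleWeight H
  cycleWeight-exchange {H} {H′} {e} {f} d u u′ He H′f same a≢0 = begin
    cycleWeight H′
      ≡⟨ cycleWeight-remove u′ H′f ⟩
    joined-weight (remove Γ H′ f) f * cycleWeight (remove Γ H′ f)
      ≡⟨ cong₂ _*_ (cong (λ b → if b then toℚ (ℤ.+ 4) else 1ℚ) (sym (conn-cong same (tl f) (hd f))))
                   (cong (λ k → ℕtoℚ (4 ℕ.^ k)) (sym (cycleCount-cong same))) ⟩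
    joined-weight F f * cycleWeight F
      ≡⟨ ℚP.*-identityˡ (joined-weight F f * cycleWeight F) ⟨
    1ℚ * (joined-weight F f * cycleWeight F)
      ≡⟨ cong (_* (joined-weight F f * cycleWeight F)) (scale-weight d) ⟨
    κ * κ * joined-weight F e * (joined-weight F f * cycleWeight F)
      ≡⟨ regroup (κ * κ) (joined-weight F e) (joined-weight F f) (cycleWeight F) ⟩
    κ * κ * joined-weight F f * (joined-weight F e * cycleWeight F)
      ≡⟨ cong₂ (λ x y → κ * κ * x * y) (jump-square (dual-acyclic d) jump≢0) (cycleWeight-remove u He) ⟨
    κ * κ * (jump F s f * jump F s f) * cycleWeight H
      ≡⟨ cong (_* cycleWeight H) (dot-pot-square κ F s f) ⟨
    dot A (dualRow d) f * dot A (dualRow d) f * cycleWeight H ∎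
    where
    open ≡-Reasoning
    F = remove Γ H e
    κ = scale d
    s = anchor d
    regroup : ∀ k a b x → k * a * (b * x) ≡ k * b * (a * x)
    regroup = solve-∀ ℚ-ring
    jump≢0 : jump F s f ≢ 0ℚ
    jump≢0 j≡0 = a≢0 (trans (dot-pot κ F s f) (trans (cong (λ j → κ * (wℚ f * j)) j≡0) (zeros κ (wℚ f))))
      where
      zeros : ∀ k w → k * (w * 0ℚ) ≡ 0ℚ
      zeros = solve-∀ ℚ-ring

-- Integers and quotients as rationals.

toℚ-+ : ∀ a b → toℚ (a ℤ.+ b) ≡ toℚ a + toℚ b
toℚ-+ a b = ℚP.toℚᵘ-injective (begin
  ℚ.toℚᵘ (toℚ (a ℤ.+ b))                  ≈⟨ toℚᵘ-toℚ (a ℤ.+ b) ⟩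
  ℚᵘ.mkℚᵘ (a ℤ.+ b) 0                     ≡⟨ cong₂ (λ x y → ℚᵘ.mkℚᵘ (x ℤ.+ y) 0) (ℤP.*-identityʳ a) (ℤP.*-identityʳ b) ⟨
  ℚᵘ.mkℚᵘ a 0 ℚᵘ.+ ℚᵘ.mkℚᵘ b 0            ≈⟨ ℚᵘP.+-cong (toℚᵘ-toℚ a) (toℚᵘ-toℚ b) ⟨
  ℚ.toℚᵘ (toℚ a) ℚᵘ.+ ℚ.toℚᵘ (toℚ b)      ≈⟨ ℚP.toℚᵘ-homo-+ (toℚ a) (toℚ b) ⟨
  ℚ.toℚᵘ (toℚ a + toℚ b)                  ∎)
  where open ℚᵘP.≃-Reasoning

toℚ-neg : ∀ a → toℚ (ℤ.- a) ≡ - toℚ a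
toℚ-neg a = ℚP.toℚᵘ-injective (begin
  ℚ.toℚᵘ (toℚ (ℤ.- a))   ≈⟨ toℚᵘ-toℚ (ℤ.- a) ⟩
  ℚᵘ.- ℚᵘ.mkℚᵘ a 0       ≈⟨ ℚᵘP.-‿cong (toℚᵘ-toℚ a) ⟨
  ℚᵘ.- ℚ.toℚᵘ (toℚ a)    ≈⟨ ℚP.toℚᵘ-homo‿- (toℚ a) ⟨
  ℚ.toℚᵘ (- toℚ a)       ∎)
  where open ℚᵘP.≃-Reasoning

ℕtoℚ-+ : ∀ a b → ℕtoℚ (a ℕ.+ b) ≡ ℕtoℚ a + ℕtoℚ b
ℕtoℚ-+ a b = trans (cong toℚ (ℤP.pos-+ a b)) (toℚ-+ (ℤ.+ a) (ℤ.+ b))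

-- Zero at zero, as in `divℚ`, so that `divℚ-invℕ` holds for every denominator.
invℕ : ℕ → ℚ
invℕ zero    = 0ℚ
invℕ (suc d) = ℤ.+ 1 ℚ./ suc d

divℚ-invℕ : ∀ z k → divℚ z k ≡ toℚ z * invℕ k
divℚ-invℕ z zero    = sym (ℚP.*-zeroʳ (toℚ z))
divℚ-invℕ z (suc d) = ℚP.toℚᵘ-injective (begin
  ℚ.toℚᵘ (z ℚ./ suc d)                            ≈⟨ ℚP.toℚᵘ-fromℚᵘ (ℚᵘ.mkℚᵘ z d) ⟩
  ℚᵘ.mkℚᵘ z d                                     ≡⟨ cong₂ ℚᵘ.mkℚᵘ (ℤP.*-identityʳ z) (ℕP.+-identityʳ d) ⟨
  ℚᵘ.mkℚᵘ z 0 ℚᵘ.* ℚᵘ.mkℚᵘ (ℤ.+ 1) d              ≈⟨ ℚᵘP.*-cong (toℚᵘ-toℚ z) (ℚP.toℚᵘ-fromℚᵘ (ℚᵘ.mkℚᵘ (ℤ.+ 1) d)) ⟨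
  ℚ.toℚᵘ (toℚ z) ℚᵘ.* ℚ.toℚᵘ (ℤ.+ 1 ℚ./ suc d)    ≈⟨ ℚP.toℚᵘ-homo-* (toℚ z) (ℤ.+ 1 ℚ./ suc d) ⟨
  ℚ.toℚᵘ (toℚ z * invℕ (suc d))                   ∎)
  where open ℚᵘP.≃-Reasoning

invℕ-inverse : ∀ k → k ≢ 0 → ℕtoℚ k * invℕ k ≡ 1ℚ
invℕ-inverse zero    k≢0 = ⊥-elim (k≢0 refl)
invℕ-inverse (suc d) _   = trans (sym (divℚ-invℕ (ℤ.+ suc d) (suc d))) (ℚP.toℚᵘ-injective (begin
  ℚ.toℚᵘ (ℤ.+ suc d ℚ./ suc d)  ≈⟨ ℚP.toℚᵘ-fromℚᵘ (ℚᵘ.mkℚᵘ (ℤ.+ suc d) d) ⟩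
  ℚᵘ.mkℚᵘ (ℤ.+ suc d) d         ≈⟨ ℚᵘ.*≡* (ℤP.*-comm (ℤ.+ suc d) (ℤ.+ 1)) ⟩
  ℚ.toℚᵘ 1ℚ                     ∎))
  where open ℚᵘP.≃-Reasoning

÷ℕ-unique : ∀ k x q → k ≢ 0 → ℕtoℚ k * x ≡ q → x ≡ q ÷ℕ k
÷ℕ-unique zero x q k≢0 _ = ⊥-elim (k≢0 refl)
÷ℕ-unique (suc d) x q k≢0 h = begin
  x                           ≡⟨ ℚP.*-identityˡ x ⟨
  1ℚ * x                      ≡⟨ cong (_* x) (invℕ-inverse (suc d) k≢0) ⟨
  ℕtoℚ (suc d) * ν * x        ≡⟨ regroup (ℕtoℚ (suc d)) ν x ⟩
  ℕtoℚ (suc d) * x * ν        ≡⟨ cong (_* ν) h ⟩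
  q * ν                       ∎
  where
  open ≡-Reasoning
  ν = invℕ (suc d)
  regroup : ∀ a b x → a * b * x ≡ a * x * b
  regroup = solve-∀ ℚ-ring

sumℚ-indicator : ∀ {k} (p : Fin k → Bool) x → sumℚ (λ i → if p i then x else 0ℚ) ≡ ℕtoℚ (countF p) * x
sumℚ-indicator {zero}  p x = sym (ℚP.*-zeroˡ x)
sumℚ-indicator {suc k} p x = begin
  (if p zero then x else 0ℚ) + sumℚ (λ i → if p (suc i) then x else 0ℚ)
    ≡⟨ cong₂ _+_ (first (p zero)) (sumℚ-indicator (p ∘ suc) x) ⟩
  ℕtoℚ (indicator (p zero)) * x + ℕtoℚ (countF (p ∘ suc)) * x
    ≡⟨ ℚP.*-distribʳ-+ x (ℕtoℚ (indicator (p zero))) (ℕtoℚ (countF (p ∘ suc))) ⟨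
  (ℕtoℚ (indicator (p zero)) + ℕtoℚ (countF (p ∘ suc))) * x
    ≡⟨ cong (_* x) (ℕtoℚ-+ (indicator (p zero)) (countF (p ∘ suc))) ⟨
  ℕtoℚ (countF p) * x ∎
  where
  open ≡-Reasoning
  first : ∀ b → (if b then x else 0ℚ) ≡ ℕtoℚ (indicator b) * x
  first true  = sym (ℚP.*-identityˡ x)
  first false = sym (ℚP.*-zeroˡ x)

Σ-ℕtoℚ : ∀ {A : Set} (xs : List A) (f : A → ℕ) → Σ[ xs ] (ℕtoℚ ∘ f) ≡ ℕtoℚ (foldr ℕ._+_ 0 (map f xs))
Σ-ℕtoℚ []       f = refl
Σ-ℕtoℚ (x ∷ xs) f = trans (cong (ℕtoℚ (f x) +_) (Σ-ℕtoℚ xs f)) (sym (ℕtoℚ-+ (f x) (foldr ℕ._+_ 0 (map f xs))))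

Σ-filterᵇ² : ∀ {A : Set} (p q : A → Bool) (f : A → ℚ) xs →
  Σ[ filterᵇ p (filterᵇ q xs) ] f ≡ Σ[ xs ] (λ x → if q x ∧ p x then f x else 0ℚ)
Σ-filterᵇ² p q f xs = trans (Σ-filterᵇ p f (filterᵇ q xs)) (trans (Σ-filterᵇ q (λ x → if p x then f x else 0ℚ) xs)
  (Σ-cong xs λ x → merge (q x) (p x) (f x)))
  where
  merge : ∀ a b z → (if a then (if b then z else 0ℚ) else 0ℚ) ≡ (if a ∧ b then z else 0ℚ)
  merge true  b z = refl
  merge false b z = refl

countF-remove-edge : ∀ {n m} (Γ : SignedGraph n m) S e → S e ≡ true → countF S ≡ suc (countF (remove Γ S e))
countF-remove-edge Γ S e Se = trans
  (countF-remove S (remove Γ S e) e (λ f f≢e → agree f f≢e (S f)) (Walks.remove-self Γ S e))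
  (cong (λ b → indicator b ℕ.+ countF (remove Γ S e)) Se)
  where
  agree : ∀ f → f ≢ e → ∀ b → b ≡ b ∧ not (eqF f e)
  agree f f≢e true  = sym (not⁺ (eqF-no f≢e))
  agree f f≢e false = refl

-- Spanning trees and their rows.

module SpanningTrees {n m : ℕ} (Γ : SignedGraph n m) (N : Matrix ℤ n m) (inc : IsIncidenceMatrix Γ N) where
  open Walks Γ
  open Cycles Γ
  open Potentials Γ
  open Incidence Γ N inc
  open Bicircular Γ N inc

  AllReachable : EdgeSet m → Set
  AllReachable T = ∀ u v → Reach T u v

  CycleFree : EdgeSet m → Set
  CycleFree T = ∀ C → isCycle Γ C ≡ true → C ⊑ T → ⊥

  spanningTree⁻ : ∀ {T} → isSpanningTree Γ T ≡ true → AllReachable T × CycleFree T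
  spanningTree⁻ {T} h =
    let conns , none = ∧⁻ {allF (λ u → allF (λ v → conn Γ T u v))} h in
    (λ u v → conn⁻ (allF⁻ (conn Γ T u) (allF⁻ (λ u → allF (conn Γ T u)) conns u) v)) ,
    λ C cyc C⊑ → empty none (proj₁ (proj₂ (cyclesIn⁺ cyc C⊑)))
    where
    empty : ∀ {L : List (EdgeSet m)} {C} → List.null L ≡ true → C ∈ L → ⊥
    empty () (here _)
    empty () (there _)

  spanningTree⁺ : ∀ {T} → AllReachable T → CycleFree T → isSpanningTree Γ T ≡ true
  spanningTree⁺ {T} reach none = ∧⁺ (allF⁺ λ u → allF⁺ λ v → conn⁺ (reach u v)) (empty (cyclesIn Γ T) λ C∈ →
    let h , C⊑ = cyclesIn⁻ C∈ in none _ h C⊑)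
    where
    empty : ∀ (L : List (EdgeSet m)) → (∀ {C} → C ∈ L → ⊥) → List.null L ≡ true
    empty []      _ = refl
    empty (_ ∷ _) h = ⊥-elim (h (here refl))

  -- Edges of cycles are deleted until none is left; the bypass keeps the graph connected, and the
  -- bound on the edge count makes the recursion terminate.
  spanningTree-exists : AllReachable (allEdges Γ) → ∃ λ T → isSpanningTree Γ T ≡ true
  spanningTree-exists reach = prune (countF (allEdges Γ)) (allEdges Γ) ℕP.≤-refl reach
    where
    prune : ∀ k S → countF S ≤ k → AllReachable S → ∃ λ T → isSpanningTree Γ T ≡ true
    prune k S bound reachS = go (cyclesIn Γ S) refl k bound
      where
      go : ∀ L → cyclesIn Γ S ≡ L → ∀ k → countF S ≤ k → ∃ λ T → isSpanningTree Γ T ≡ true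
      go [] eq _ _ = S , spanningTree⁺ reachS λ C h C⊑ →
        case subst (_ ∈_) eq (proj₁ (proj₂ (cyclesIn⁺ h C⊑))) of λ ()
      go (C ∷ _) eq k bound with cyclesIn⁻ {S} (subst (C ∈_) (sym eq) (here refl))
      ... | h , C⊑ with cycle-edge h
      ...   | e , Ce with k | subst (_≤ k) (countF-remove-edge Γ S e (C⊑ e Ce)) bound
      ...     | suc k′ | s≤s bound′ = prune k′ (remove Γ S e) bound′ λ u v →
        reach-bypass (joins-ends e)
          (reach-mono (λ g Cg → let Cg′ , g≢e = remove⁻ C Cg in remove⁺ S (C⊑ g Cg′) g≢e) (cycle-bypass h Ce (joins-ends e)))
          (reachS u v)

  module _ {T : EdgeSet m} {e : Fin m} (tree : isSpanningTree Γ T ≡ true) (Te : T e ≡ true) where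
    private
      F = remove Γ T e
      t = tl e
      h = hd e

    tree-acyclicAt : ∀ v → AcyclicAt F v
    tree-acyclicAt v C cyc C⊑ _ _ _ = proj₂ (spanningTree⁻ tree) C cyc (λ g Cg → remove-⊑ T e g (C⊑ g Cg))

    tree-separated : ¬ Reach F t h
    tree-separated r = acyclicAt-bridge
      (λ C cyc C⊑ _ _ _ → proj₂ (spanningTree⁻ tree) C cyc C⊑) Te (tail-head e) r

    tree-side : ∀ v → Reach F v t ⊎ Reach F v h
    tree-side v = reach-split (tail-head e) (proj₁ (spanningTree⁻ tree) v t) (inj₁ here)

    tree-shape : DualShape T e
    tree-shape = tail-side tree-separated (tree-acyclicAt t)

    private
      |t| = ℕtoℚ (compSize Γ F t)
      |h| = ℕtoℚ (compSize Γ F h)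
      ν = invℕ n

    sizes : |t| + |h| ≡ ℕtoℚ n
    sizes = trans (sym (ℕtoℚ-+ (compSize Γ F t) (compSize Γ F h))) (cong ℕtoℚ
      (trans (cong (compSize Γ F t ℕ.+_) (countF-cong complement)) (countF-not (conn Γ F t))))
      where
      complement : ∀ v → conn Γ F h v ≡ not (conn Γ F t v)
      complement v with tree-side v
      ... | inj₁ r = trans (conn-no λ r′ → tree-separated (reach-sym (reach-trans r′ r))) (cong not (sym (conn⁺ (reach-sym r))))
      ... | inj₂ r = trans (conn⁺ (reach-sym r)) (cong not (sym (conn-no λ r′ → tree-separated (reach-trans r′ r))))

    -- The two cases of the definition become one expression, because at each vertex the potential
    -- of the opposite side is zero.
    NTdag-pot : ∀ v → NTdag Γ N T e v ≡ wℚ e * ν * (pot F t v * |h| - sg e * (pot F h v * |t|))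
    NTdag-pot v with tree-side v
    ... | inj₁ r rewrite conn⁺ (reach-sym r) | conn-no (λ r′ → tree-separated (reach-sym (reach-trans r′ r))) = begin
        divℚ (w Γ N e ℤ.* P ℤ.* S) n          ≡⟨ divℚ-invℕ (w Γ N e ℤ.* P ℤ.* S) n ⟩
        toℚ (w Γ N e ℤ.* P ℤ.* S) * ν         ≡⟨ cong (_* ν) (trans (toℚ-* (w Γ N e ℤ.* P) S)
                                                  (cong (_* |h|) (toℚ-* (w Γ N e) P))) ⟩
        wℚ e * toℚ P * |h| * ν                ≡⟨ regroup (wℚ e) (toℚ P) |h| ν (sg e) |t| ⟩
        wℚ e * ν * (toℚ P * |h| - sg e * (0ℚ * |t|)) ∎
      where
      open ≡-Reasoning
      P = pathSgn Γ F t v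
      S = ℤ.+ compSize Γ F h
      regroup : ∀ w p s n g u → w * p * s * n ≡ w * n * (p * s - g * (0ℚ * u))
      regroup = solve-∀ ℚ-ring
    ... | inj₂ r rewrite conn⁺ (reach-sym r) | conn-no (λ r′ → tree-separated (reach-trans r′ r)) = begin
        divℚ (w Γ N e ℤ.* P ℤ.* ℤ.- s ℤ.* S) n    ≡⟨ divℚ-invℕ (w Γ N e ℤ.* P ℤ.* ℤ.- s ℤ.* S) n ⟩
        toℚ (w Γ N e ℤ.* P ℤ.* ℤ.- s ℤ.* S) * ν   ≡⟨ cong (_* ν) (trans (toℚ-* (w Γ N e ℤ.* P ℤ.* ℤ.- s) S)
                                                      (cong (_* |t|) (trans (toℚ-* (w Γ N e ℤ.* P) (ℤ.- s))
                                                        (cong₂ _*_ (toℚ-* (w Γ N e) P) (toℚ-neg s))))) ⟩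
        wℚ e * toℚ P * - sg e * |t| * ν           ≡⟨ regroup (wℚ e) (toℚ P) |h| ν (sg e) |t| ⟩
        wℚ e * ν * (0ℚ * |h| - sg e * (toℚ P * |t|)) ∎
      where
      open ≡-Reasoning
      P = pathSgn Γ F h v
      s = signℤ (σ e)
      S = ℤ.+ compSize Γ F t
      regroup : ∀ w p s n g u → w * p * - g * u * n ≡ w * n * (0ℚ * s - g * (p * u))
      regroup = solve-∀ ℚ-ring

-- Balanced graphs: the family of spanning trees.

module BalancedCase {n m : ℕ} (Γ : SignedGraph n m) (N : Matrix ℤ n m) (inc : IsIncidenceMatrix Γ N)
                    (n≢0 : n ≢ 0) (connected : Connected Γ) (balanced : Balanced Γ) where
  open Walks Γ
  open Cycles Γ
  open Potentials Γ
  open Incidence Γ N inc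
  open Bicircular Γ N inc
  open SpanningTrees Γ N inc

  -- The point where balance enters: the fundamental cycle of `f` is balanced, so its holonomy
  -- forces compatibility on `f`.
  sat-closes : ∀ {S y f} → S f ≡ false → Sat S y → Reach S (tl f) (hd f) → y (tl f) ≡ sg f * y (hd f)
  sat-closes {S} {y} {f} Sf sat r =
    let C , h , Cf , rest = closing-cycle Sf (tail-head f) r in
    trans (holonomy h Cf (tail-head f) (sat-⊑ (λ g Cg → let Cg′ , g≢f = remove⁻ C Cg in rest g Cg′ g≢f) sat))
          (cong (λ b → (if b then sg f else - sg f) * y (hd f)) (balanced C h))

  tree-spans : ∀ {T} → isSpanningTree Γ T ≡ true → ∀ {y} → Sat T y → ∀ f → dot A y f ≡ 0ℚ
  tree-spans {T} tree {y} sat f with T f in Tf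
  ... | true  = sat⇒dot sat f Tf
  ... | false = balanced⇒dot {y} f (tail-head f) (sat-closes Tf sat (proj₁ (spanningTree⁻ tree) (tl f) (hd f)))

  -- Crossing an edge multiplies both factors by the same sign, which squares to 1.
  reach-product : ∀ {S y z u v} → Sat S y → Sat S z → Reach S u v → y v * z v ≡ y u * z u
  reach-product sy sz here = refl
  reach-product {y = y} {z} {u} sy sz (step {x = x} g Sg j r) = trans (reach-product sy sz r) (begin
    y x * z x                    ≡⟨ cong₂ _*_ (sy Sg (joins-sym j)) (sz Sg (joins-sym j)) ⟩
    sg g * y u * (sg g * z u)    ≡⟨ regroup (sg g) (y u) (z u) ⟩
    sg g * sg g * (y u * z u)    ≡⟨ cong (_* (y u * z u)) (sg-square g) ⟩
    1ℚ * (y u * z u)             ≡⟨ ℚP.*-identityˡ (y u * z u) ⟩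
    y u * z u                    ∎)
    where
    open ≡-Reasoning
    regroup : ∀ s a b → s * a * (s * b) ≡ s * s * (a * b)
    regroup = solve-∀ ℚ-ring

  module _ {T : EdgeSet m} {e : Fin m} (tree : isSpanningTree Γ T ≡ true) (Te : T e ≡ true) where
    private
      F = remove Γ T e
      t = tl e
      h = hd e
      |t| = ℕtoℚ (compSize Γ F t)
      |h| = ℕtoℚ (compSize Γ F h)
      ν = invℕ n
      d = tree-shape tree Te
      acyc = tree-acyclicAt tree Te

    -- The path signs of the whole tree from the tail of `e`, glued from the two sides of `e`. Being
    -- compatible with `T`, it lies in the left kernel by `tree-spans`.
    switching : Fin n → ℚ
    switching v = pot F t v + sg e * pot F h v

    switching-sat : Sat T switching
    switching-sat {g} {a} {b} Tg j with g ≟F e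
    ... | no g≢e = trans (cong₂ (λ x y → x + sg e * y) (pot-sat (acyc t) Fg j) (pot-sat (acyc h) Fg j))
                         (factor (sg g) (pot F t b) (sg e) (pot F h b))
      where
      Fg = remove⁺ T Tg g≢e
      factor : ∀ s x r y → s * x + r * (s * y) ≡ s * (x + r * y)
      factor = solve-∀ ℚ-ring
    ... | yes refl with joins-functional j (tail-head e)
    ...   | inj₁ (refl , refl) = at-tail
      where
      at-tail : switching t ≡ sg e * switching h
      at-tail = begin
        pot F t t + sg e * pot F h t             ≡⟨ cong₂ (λ x y → x + sg e * y) (pot-self (acyc t)) (pot-out (tree-separated tree Te ∘ reach-sym)) ⟩
        1ℚ + sg e * 0ℚ                           ≡⟨ cong (_+ sg e * 0ℚ) (sg-square e) ⟨
        sg e * sg e + sg e * 0ℚ                  ≡⟨ regroup (sg e) ⟩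
        sg e * (0ℚ + sg e * 1ℚ)                  ≡⟨ cong₂ (λ x y → sg e * (x + sg e * y)) (pot-out (tree-separated tree Te)) (pot-self (acyc h)) ⟨
        sg e * (pot F t h + sg e * pot F h h)    ∎
        where
        open ≡-Reasoning
        regroup : ∀ s → s * s + s * 0ℚ ≡ s * (0ℚ + s * 1ℚ)
        regroup = solve-∀ ℚ-ring
    ...   | inj₂ (refl , refl) = at-head
      where
      at-head : switching h ≡ sg e * switching t
      at-head = begin
        pot F t h + sg e * pot F h h             ≡⟨ cong₂ (λ x y → x + sg e * y) (pot-out (tree-separated tree Te)) (pot-self (acyc h)) ⟩
        0ℚ + sg e * 1ℚ                           ≡⟨ regroup (sg e) ⟩
        sg e * (1ℚ + sg e * 0ℚ)                  ≡⟨ cong₂ (λ x y → sg e * (x + sg e * y)) (pot-self (acyc t)) (pot-out (tree-separated tree Te ∘ reach-sym)) ⟨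
        sg e * (pot F t t + sg e * pot F h t)    ∎
        where
        open ≡-Reasoning
        regroup : ∀ s → 0ℚ + s * 1ℚ ≡ s * (1ℚ + s * 0ℚ)
        regroup = solve-∀ ℚ-ring

    -- The correction is an orthogonal projection: `dualRow d` pairs with `switching` to w·|t|, and
    -- `switching`, with values ±1, has squared norm n.
    NTdag-dualRow : ∀ v → NTdag Γ N T e v ≡ dualRow d v + - (wℚ e * |t| * ν) * switching v
    NTdag-dualRow v = begin
      NTdag Γ N T e v
        ≡⟨ NTdag-pot tree Te v ⟩
      wℚ e * ν * (x * |h| - sg e * (y * |t|))
        ≡⟨ regroup (wℚ e) ν x |h| (sg e) y |t| ⟩
      ((|t| + |h|) * ν) * (wℚ e * x) + - (wℚ e * |t| * ν) * (x + sg e * y)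
        ≡⟨ cong (λ z → z * (wℚ e * x) + - (wℚ e * |t| * ν) * (x + sg e * y))
                (trans (cong (_* ν) (sizes tree Te)) (invℕ-inverse n n≢0)) ⟩
      1ℚ * (wℚ e * x) + - (wℚ e * |t| * ν) * (x + sg e * y)
        ≡⟨ cong (_+ - (wℚ e * |t| * ν) * (x + sg e * y)) (ℚP.*-identityˡ (wℚ e * x)) ⟩
      wℚ e * x + - (wℚ e * |t| * ν) * (x + sg e * y) ∎
      where
      open ≡-Reasoning
      x = pot F t v
      y = pot F h v
      regroup : ∀ w n x b s y a →
        w * n * (x * b - s * (y * a)) ≡ ((a + b) * n) * (w * x) + - (w * a * n) * (x + s * y)
      regroup = solve-∀ ℚ-ring

    NTdag-dot : ∀ f → dot A (NTdag Γ N T e) f ≡ dot A (dualRow d) f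
    NTdag-dot f = begin
      dot A (NTdag Γ N T e) f
        ≡⟨ sumℚ-cong (λ v → cong (_* A v f) (NTdag-dualRow v)) ⟩
      dot A (λ v → dualRow d v + κ * switching v) f
        ≡⟨ dot-linear A κ (dualRow d) switching f ⟩
      dot A (dualRow d) f + κ * dot A switching f
        ≡⟨ cong (λ x → dot A (dualRow d) f + κ * x) (tree-spans tree switching-sat f) ⟩
      dot A (dualRow d) f + κ * 0ℚ
        ≡⟨ drop (dot A (dualRow d) f) κ ⟩
      dot A (dualRow d) f ∎
      where
      open ≡-Reasoning
      κ = - (wℚ e * |t| * ν)
      drop : ∀ x k → x + k * 0ℚ ≡ x
      drop = solve-∀ ℚ-ring

    pot-against : ∀ {u z} → Sat F z → sumℚ (λ v → pot F u v * z v) ≡ ℕtoℚ (compSize Γ F u) * z u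
    pot-against {u} {z} sat = trans (sumℚ-cong pointwise) (sumℚ-indicator (conn Γ F u) (z u))
      where
      pointwise : ∀ v → pot F u v * z v ≡ (if conn Γ F u v then z u else 0ℚ)
      pointwise v with reach? F u v
      ... | yes r = trans (reach-product (pot-sat (acyc u)) sat r) (trans (cong (_* z u) (pot-self (acyc u)))
        (trans (ℚP.*-identityˡ (z u)) (cong (λ b → if b then z u else 0ℚ) (sym (conn⁺ r)))))
      ... | no ¬r = trans (cong (_* z v) (pot-out ¬r)) (trans (ℚP.*-zeroˡ (z v))
        (cong (λ b → if b then z u else 0ℚ) (sym (conn-no ¬r))))

    -- On each side of `e` the product of the potential with `z` is constant, so each side
    -- contributes its size times the value of `z` at its end of `e`. Compatibility across `e` makes
    -- the two contributions cancel.
    NTdag-orthogonal : ∀ z → (∀ f → dot A z f ≡ 0ℚ) → sumℚ (λ v → NTdag Γ N T e v * z v) ≡ 0ℚ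
    NTdag-orthogonal z z⊥ = begin
      sumℚ (λ v → NTdag Γ N T e v * z v)
        ≡⟨ sumℚ-cong (λ v → trans (cong (_* z v) (NTdag-pot tree Te v))
             (expand (wℚ e * ν) (pot F t v) |h| (sg e) (pot F h v) |t| (z v))) ⟩
      sumℚ (λ v → α * (pot F t v * z v) + β * (pot F h v * z v))
        ≡⟨ sumℚ-linear β (λ v → α * (pot F t v * z v)) (λ v → pot F h v * z v) ⟩
      sumℚ (λ v → α * (pot F t v * z v)) + β * sumℚ (λ v → pot F h v * z v)
        ≡⟨ cong₂ (λ x y → x + β * y) (trans (sumℚ-*ˡ α (λ v → pot F t v * z v)) (cong (α *_) (pot-against satF)))
                                    (pot-against satF) ⟩
      α * (|t| * z t) + β * (|h| * z h)
        ≡⟨ cong (λ x → α * (|t| * x) + β * (|h| * z h)) (sat Te (tail-head e)) ⟩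
      α * (|t| * (sg e * z h)) + β * (|h| * z h)
        ≡⟨ cancel (wℚ e * ν) |t| |h| (sg e) (z h) ⟩
      0ℚ ∎
      where
      open ≡-Reasoning
      α = wℚ e * ν * |h|
      β = - (wℚ e * ν * sg e * |t|)
      sat : Sat T z
      sat = dot⇒sat {T} {z} λ g _ → z⊥ g
      satF : Sat F z
      satF = sat-⊑ (remove-⊑ T e) sat
      expand : ∀ k x b s y a z → k * (x * b - s * (y * a)) * z ≡ k * b * (x * z) + - (k * s * a) * (y * z)
      expand = solve-∀ ℚ-ring
      cancel : ∀ k a b s z → k * b * (a * (s * z)) + - (k * s * a) * (b * z) ≡ 0ℚ
      cancel = solve-∀ ℚ-ring

    -- By `sat-closes` a nonzero entry means that the ends of `f` lie on different sides of T - e.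
    -- Hence `f` reconnects the two sides without closing a cycle, and the jump is ±1.
    tree-exchange : ∀ {T′ f} → T f ≡ false → T′ e ≡ false → T′ f ≡ true →
      (∀ g → g ≢ e → g ≢ f → T g ≡ T′ g) → dot A (NTdag Γ N T e) f ≢ 0ℚ →
      isSpanningTree Γ T′ ≡ true × 1ℚ ≡ dot A (NTdag Γ N T e) f * dot A (NTdag Γ N T e) f * 1ℚ
    tree-exchange {T′} {f} Tf T′e T′f agree a≢0 = spanningTree⁺ reach′ cycleFree′ , sym (begin
      dot A (NTdag Γ N T e) f * dot A (NTdag Γ N T e) f * 1ℚ  ≡⟨ ℚP.*-identityʳ (dot A (NTdag Γ N T e) f * dot A (NTdag Γ N T e) f) ⟩
      dot A (NTdag Γ N T e) f * dot A (NTdag Γ N T e) f       ≡⟨ cong₂ _*_ (NTdag-dot f) (NTdag-dot f) ⟩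
      dot A (dualRow d) f * dot A (dualRow d) f               ≡⟨ dot-pot-square (wℚ e) F t f ⟩
      wℚ e * wℚ e * (jump F t f * jump F t f)                 ≡⟨ cong₂ _*_ (w-square e)
                                                                   (trans (jump-square (acyc t) jump≢0) (joined-weight-no apart)) ⟩
      1ℚ                                                      ∎)
      where
      open ≡-Reasoning
      jump≢0 : jump F t f ≢ 0ℚ
      jump≢0 j≡0 = a≢0 (trans (NTdag-dot f) (trans (dot-pot (wℚ e) F t f)
        (trans (cong (λ j → wℚ e * (wℚ f * j)) j≡0) (zeros (wℚ e) (wℚ f)))))
        where
        zeros : ∀ k w → k * (w * 0ℚ) ≡ 0ℚ
        zeros = solve-∀ ℚ-ring
      Ff : F f ≡ false
      Ff = ¬true⇒false λ Ff → true≢false (remove-⊑ T e f Ff) Tf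
      apart : ¬ Reach F (tl f) (hd f)
      apart r = jump≢0 (difference-zero {pot F t (tl f)} {sg f * pot F t (hd f)} (sat-closes Ff (pot-sat (acyc t)) r))
      F⊑T′ : F ⊑ T′
      F⊑T′ g Fg = let Tg , g≢e = remove⁻ T Fg in
        trans (sym (agree g g≢e λ { refl → true≢false Tg Tf })) Tg
      T′⊑F : ∀ {g} → T′ g ≡ true → g ≢ f → F g ≡ true
      T′⊑F {g} T′g g≢f = let g≢e = λ { refl → true≢false T′g T′e } in remove⁺ T (trans (agree g g≢e g≢f) T′g) g≢e
      up : ∀ {u v} → Reach F u v → Reach T′ u v
      up = reach-mono F⊑T′
      across : Reach T′ t h
      across with tree-side tree Te (tl f) | tree-side tree Te (hd f)
      ... | inj₁ p | inj₁ q = ⊥-elim (apart (reach-trans p (reach-sym q)))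
      ... | inj₂ p | inj₂ q = ⊥-elim (apart (reach-trans p (reach-sym q)))
      ... | inj₁ p | inj₂ q = reach-trans (up (reach-sym p)) (step f T′f (tail-head f) (up q))
      ... | inj₂ p | inj₁ q = reach-trans (up (reach-sym q)) (step f T′f (joins-sym (tail-head f)) (up p))
      to-tail : ∀ v → Reach T′ v t
      to-tail v with tree-side tree Te v
      ... | inj₁ p = up p
      ... | inj₂ p = reach-trans (up p) (reach-sym across)
      reach′ : AllReachable T′
      reach′ u v = reach-trans (to-tail u) (reach-sym (to-tail v))
      cycleFree′ : CycleFree T′
      cycleFree′ C cyc C⊑ with C f in Cf
      ... | true  = apart (reach-mono (λ g Cg → let Cg′ , g≢f = remove⁻ C Cg in T′⊑F (C⊑ g Cg′) g≢f)
                                      (cycle-bypass cyc Cf (tail-head f)))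
      ... | false = proj₂ (spanningTree⁻ tree) C cyc λ g Cg →
        remove-⊑ T e g (T′⊑F (C⊑ g Cg) λ { refl → true≢false Cg Cf })

  treeFamily : BasisFamily A
  treeFamily = record
    { member     = isSpanningTree Γ
    ; wt         = λ _ → 1ℚ
    ; row        = NTdag Γ N
    ; dual-self  = λ T e tree Te → trans (NTdag-dot tree Te e) (dualRow-self (tree-shape tree Te))
    ; dual-other = λ T e g tree Te Tg g≢e → trans (NTdag-dot tree Te g) (dualRow-other (tree-shape tree Te) g Tg g≢e)
    ; spanning   = λ T tree y y⊥ → tree-spans tree {y} (dot⇒sat {y = y} y⊥)
    ; orthogonal = λ T e tree Te → NTdag-orthogonal tree Te
    ; exchange   = λ T T′ e f tree Te Tf T′e T′f → tree-exchange tree Te Tf T′e T′f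
    }

  τ≢0 : τ Γ ≢ 0
  τ≢0 τ≡0 =
    let T , tree = spanningTree-exists λ u v → conn⁻ (connected u v)
        -- The tree just found need not itself be a member of `subsets m`, so the property is
        -- transported to its representative.
        T′ , T′∈ , T′≗ = subsets-complete m T
        reach , free = spanningTree⁻ tree
        tree′ : isSpanningTree Γ T′ ≡ true
        tree′ = spanningTree⁺ (λ u v → reach-mono (λ g Tg → trans (T′≗ g) Tg) (reach u v))
                  (λ C cyc C⊑ → free C cyc λ g Cg → trans (sym (T′≗ g)) (C⊑ g Cg))
    in empty (∈-filterᵇ⁺ (isSpanningTree Γ) T′∈ tree′) τ≡0
    where
    empty : ∀ {x : EdgeSet m} {L} → x ∈ L → length L ≢ 0
    empty (here _)  ()
    empty (there _) ()

  balanced-formula : ∀ X → IsMoorePenroseInverse A X → ∀ i j → X i j ≡ formulaA Γ N i j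
  balanced-formula X mp i j = ÷ℕ-unique (τ Γ) (X i j) _ τ≢0 (begin
    ℕtoℚ (τ Γ) * X i j                                              ≡⟨ cong (_* X i j) total-τ ⟨
    BasisFamily.total treeFamily * X i j                            ≡⟨ BasisFamily.moorePenrose treeFamily X mp i j ⟩
    BasisFamily.sumOfRows treeFamily i j
      ≡⟨ Σ-cong (subsets m) (λ T → cong (λ x → if isSpanningTree Γ T ∧ T i then x else 0ℚ) (ℚP.*-identityˡ (NTdag Γ N T i j))) ⟩
    Σ[ subsets m ] (λ T → if isSpanningTree Γ T ∧ T i then NTdag Γ N T i j else 0ℚ)
      ≡⟨ Σ-filterᵇ² (λ T → T i) (isSpanningTree Γ) (λ T → NTdag Γ N T i j) (subsets m) ⟨
    Σ[ filterᵇ (λ T → T i) (spanningTrees Γ) ] (λ T → NTdag Γ N T i j) ∎)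
    where
    open ≡-Reasoning
    Σ-one : ∀ (L : List (EdgeSet m)) → Σ[ L ] (λ _ → 1ℚ) ≡ ℕtoℚ (length L)
    Σ-one []      = refl
    Σ-one (_ ∷ L) = trans (cong (1ℚ +_) (Σ-one L)) (sym (ℕtoℚ-+ 1 (length L)))
    total-τ : BasisFamily.total treeFamily ≡ ℕtoℚ (τ Γ)
    total-τ = trans (sym (Σ-filterᵇ (isSpanningTree Γ) (λ _ → 1ℚ) (subsets m))) (Σ-one (spanningTrees Γ))

-- Dimension counts for sets of columns.

enumerate : ∀ {m} (H : EdgeSet m) → ∃ λ (enum : Fin (countF H) → Fin m) →
  (∀ x → H (enum x) ≡ true) × (∀ x y → enum x ≡ enum y → x ≡ y) × (∀ g → H g ≡ true → ∃ λ x → enum x ≡ g)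
enumerate {zero}  H = (λ ()) , (λ ()) , (λ ()) , λ ()
enumerate {suc m} H with H zero in H₀ | enumerate (H ∘ suc)
... | false | enum , inside , inj , surj = suc ∘ enum , inside , (λ x y → inj x y ∘ suc-injective) ,
  λ { zero H₀′ → ⊥-elim (true≢false H₀′ H₀) ; (suc g) Hg → let x , eq = surj g Hg in x , cong suc eq }
... | true  | enum , inside , inj , surj = enum′ , inside′ , inj′ , surj′
  where
  enum′ : Fin (suc (countF (H ∘ suc))) → Fin (suc m)
  enum′ zero    = zero
  enum′ (suc x) = suc (enum x)
  inside′ : ∀ x → H (enum′ x) ≡ true
  inside′ zero    = H₀
  inside′ (suc x) = inside x
  inj′ : ∀ x y → enum′ x ≡ enum′ y → x ≡ y
  inj′ zero    zero    _  = refl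
  inj′ (suc x) (suc y) eq = cong suc (inj x y (suc-injective eq))
  surj′ : ∀ g → H g ≡ true → ∃ λ x → enum′ x ≡ g
  surj′ zero    _  = zero , refl
  surj′ (suc g) Hg = let x , eq = surj g Hg in suc x , cong suc eq

module DualBasis {n m : ℕ} (A : Matrix ℚ n m) (H : EdgeSet m) where

  -- The `n` rows of the submatrix on `H` live in a space of smaller dimension; `y` consists of the
  -- coefficients of a dependence.
  few-columns : countF H < n → ∃ λ (y : Fin n → ℚ) → (∃ λ v → y v ≢ 0ℚ) × (∀ g → H g ≡ true → dot A y g ≡ 0ℚ)
  few-columns k<n =
    let enum , _ , _ , surj = enumerate H
        y , nonzero , y⊥ = linearly-dependent (countF H) k<n (λ v x → A v (enum x))
    in y , nonzero , λ g Hg → let x , eq = surj g Hg in subst (λ g → dot A y g ≡ 0ℚ) eq (y⊥ x)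

  module _ (r : ∀ e → H e ≡ true → Fin n → ℚ)
           (r-self : ∀ e He → dot A (r e He) e ≡ 1ℚ)
           (r-other : ∀ e He g → H g ≡ true → g ≢ e → dot A (r e He) g ≡ 0ℚ) where
    private
      enum   = proj₁ (enumerate H)
      inside = proj₁ (proj₂ (enumerate H))
      inj    = proj₁ (proj₂ (proj₂ (enumerate H)))
      row : Fin (countF H) → Fin n → ℚ
      row x = r (enum x) (inside x)

    combination-dot : ∀ (coef : Fin (countF H) → ℚ) i → dot A (λ v → sumℚ (λ x → coef x * row x v)) (enum i) ≡ coef i
    combination-dot coef i = begin
      dot A (λ v → sumℚ (λ x → coef x * row x v)) (enum i)
        ≡⟨ dot-sumℚ A (λ x v → coef x * row x v) (enum i) ⟩
      sumℚ (λ x → dot A (λ v → coef x * row x v) (enum i))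
        ≡⟨ sumℚ-cong (λ x → dot-*ˡ A (coef x) (row x) (enum i)) ⟩
      sumℚ (λ x → coef x * dot A (row x) (enum i))
        ≡⟨ sumℚ-single (λ x → coef x * dot A (row x) (enum i)) i (λ x x≢i →
             trans (cong (coef x *_) (r-other (enum x) (inside x) (enum i) (inside i) (λ eq → x≢i (sym (inj i x eq)))))
                   (ℚP.*-zeroʳ (coef x))) ⟩
      coef i * dot A (row i) (enum i)
        ≡⟨ trans (cong (coef i *_) (r-self (enum i) (inside i))) (ℚP.*-identityʳ (coef i)) ⟩
      coef i ∎
      where open ≡-Reasoning

    -- Pairing a combination of dual rows with the columns in `H` reads off its coefficients, so the
    -- rows are independent.
    dual-size : countF H ≤ n
    dual-size = ℕP.≮⇒≥ λ n<k →
      let coef , (i , ci≢0) , vanish = linearly-dependent n n<k row in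
      ci≢0 (trans (sym (combination-dot coef i))
        (trans (sumℚ-cong λ v → cong (_* A v (enum i)) (vanish v)) (dot-zero A (enum i))))

    -- `y` together with the `n` dual rows is dependent. Pairing with the columns in `H` kills every
    -- coefficient except that of `y`, which is then nonzero.
    dual-kernel : countF H ≡ n → ∀ y → (∀ g → H g ≡ true → dot A y g ≡ 0ℚ) → ∀ v → y v ≡ 0ℚ
    dual-kernel size y y⊥ v = first-nonzero nonzero
      where
      vectors : Fin (suc (countF H)) → Fin n → ℚ
      vectors zero    = y
      vectors (suc x) = row x
      dependence = linearly-dependent n (s≤s (ℕP.≤-reflexive (sym size))) vectors
      coef = proj₁ dependence
      nonzero = proj₁ (proj₂ dependence)
      vanish = proj₂ (proj₂ dependence)
      rest : Fin n → ℚ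
      rest v = sumℚ (λ x → coef (suc x) * row x v)
      others-zero : ∀ x → coef (suc x) ≡ 0ℚ
      others-zero x = begin
        coef (suc x)                                          ≡⟨ drop (coef (suc x)) (coef zero) ⟩
        coef (suc x) + coef zero * 0ℚ                         ≡⟨ cong₂ (λ a b → a + coef zero * b)
                                                                   (combination-dot (coef ∘ suc) x) (y⊥ (enum x) (inside x)) ⟨
        dot A rest (enum x) + coef zero * dot A y (enum x)    ≡⟨ dot-linear A (coef zero) rest y (enum x) ⟨
        dot A (λ v → rest v + coef zero * y v) (enum x)       ≡⟨ sumℚ-cong (λ v → cong (_* A v (enum x))
                                                                   (trans (ℚP.+-comm (rest v) (coef zero * y v)) (vanish v))) ⟩
        dot A (λ _ → 0ℚ) (enum x)                             ≡⟨ dot-zero A (enum x) ⟩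
        0ℚ                                                    ∎
        where
        open ≡-Reasoning
        drop : ∀ a b → a ≡ a + b * 0ℚ
        drop = solve-∀ ℚ-ring
      first-nonzero : (∃ λ i → coef i ≢ 0ℚ) → y v ≡ 0ℚ
      first-nonzero (suc x , c≢0) = ⊥-elim (c≢0 (others-zero x))
      first-nonzero (zero , c≢0)  = no-zero-divisors (coef zero) (y v) (begin
        coef zero * y v              ≡⟨ ℚP.+-identityʳ (coef zero * y v) ⟨
        coef zero * y v + 0ℚ         ≡⟨ cong (coef zero * y v +_) (sumℚ-zero _ λ x →
                                          trans (cong (_* row x v) (others-zero x)) (ℚP.*-zeroˡ (row x v))) ⟨
        coef zero * y v + rest v     ≡⟨ vanish v ⟩
        0ℚ                           ∎) c≢0
        where open ≡-Reasoning

-- TU-subgraphs and trivial left kernels.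

module TUSubgraphs {n m : ℕ} (Γ : SignedGraph n m) (N : Matrix ℤ n m) (inc : IsIncidenceMatrix Γ N) where
  open Walks Γ
  open Cycles Γ
  open Potentials Γ
  open Incidence Γ N inc
  open Bicircular Γ N inc

  TrivialKernel : EdgeSet m → Set
  TrivialKernel S = ∀ y → Sat S y → ∀ v → y v ≡ 0ℚ

  trivial⇒large : ∀ {S} → TrivialKernel S → n ≤ countF S
  trivial⇒large {S} triv = ℕP.≮⇒≥ λ k<n →
    let y , (v , yv≢0) , y⊥ = DualBasis.few-columns A S k<n in yv≢0 (triv y (dot⇒sat y⊥) v)

  unicyclic-size : ∀ {H} → UnbalancedUnicyclic H → countF H ≤ n
  unicyclic-size {H} u = DualBasis.dual-size A H (λ e He → dualRow (unicyclic-dual u He))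
    (λ e He → dualRow-self (unicyclic-dual u He)) (λ e He g → dualRow-other (unicyclic-dual u He) g)

  unicyclic-trivial : ∀ {H} → UnbalancedUnicyclic H → countF H ≡ n → TrivialKernel H
  unicyclic-trivial {H} u size y sat = DualBasis.dual-kernel A H (λ e He → dualRow (unicyclic-dual u He))
    (λ e He → dualRow-self (unicyclic-dual u He)) (λ e He g → dualRow-other (unicyclic-dual u He) g)
    size y (sat⇒dot sat)

  sat-restore : ∀ {S e y} → Sat (remove Γ S e) y → y (tl e) ≡ sg e * y (hd e) → Sat S y
  sat-restore {S} {e} sat at-e {g} Sg j with g ≟F e
  ... | no g≢e = sat (remove⁺ S Sg g≢e) j
  ... | yes refl with joins-functional j (tail-head e)
  ...   | inj₁ (refl , refl) = at-e
  ...   | inj₂ (refl , refl) = sg-flip e at-e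

  -- Going once around the cycle turns `y a` into `- y a`.
  unbalanced-zero : ∀ {C S y f a b} → isCycle Γ C ≡ true → balancedCycle Γ C ≡ false → C ⊑ S → Sat S y →
    C f ≡ true → Joins f a b → y a ≡ 0ℚ
  unbalanced-zero {C} {y = y} {f} {a} {b} h unb C⊑ sat Cf j = x≡-x⇒x≡0 (y a) (begin
    y a              ≡⟨ holonomy h Cf j (sat-⊑ (λ g Cg → C⊑ g (remove-⊑ C f g Cg)) sat) ⟩
    (if balancedCycle Γ C then sg f else - sg f) * y b
                     ≡⟨ cong (λ s → (if s then sg f else - sg f) * y b) unb ⟩
    - sg f * y b     ≡⟨ ℚP.neg-distribˡ-* (sg f) (y b) ⟨
    - (sg f * y b)   ≡⟨ cong -_ (sat (C⊑ f Cf) j) ⟨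
    - y a            ∎)
    where open ≡-Reasoning

  Removable : EdgeSet m → Set
  Removable S = ∃ λ e → S e ≡ true × TrivialKernel (remove Γ S e)

  -- The condition at a deleted edge of a balanced cycle is implied by the other edges of that
  -- cycle, so deletion does not enlarge the kernel.
  balancedCycle-removable : ∀ {S} → TrivialKernel S → HasBalancedCycle S → Removable S
  balancedCycle-removable {S} triv (C , h , C⊑ , bal) =
    let e , Ce = cycle-edge h in
    e , C⊑ e Ce , λ y sat → triv y (sat-restore sat (trans
      (holonomy h Ce (tail-head e)
        (sat-⊑ (λ g Cg → let Cg′ , g≢e = remove⁻ C Cg in remove⁺ S (C⊑ g Cg′) g≢e) sat))
      (cong (λ s → (if s then sg e else - sg e) * y (hd e)) bal)))

  -- If `D` is balanced, one of its own edges is removed. Otherwise `D` survives the deletion of `e`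
  -- and forces zero on its vertices; both ends of `e` remain connected to `D`, so the condition at
  -- `e` holds as 0 = 0.
  twoCycles-removable : ∀ {S} → TrivialKernel S → TwoCycles S → Removable S
  twoCycles-removable {S} triv two = by-balance (balancedCycle Γ D) refl
    where
    open TwoCycles two
    by-balance : ∀ s → balancedCycle Γ D ≡ s → Removable S
    by-balance true  bal = balancedCycle-removable triv (D , D-cycle , D⊑H , bal)
    by-balance false unb =
      let f , Df = cycle-edge D-cycle
          around = reach-mono (λ g Cg → let Cg′ , g≢e = remove⁻ C Cg in remove⁺ S (C⊑H g Cg′) g≢e)
                              (cycle-bypass C-cycle e∈C (tail-head e))
          D⊑ : D ⊑ remove Γ S e
          D⊑ g Dg = remove⁺ S (D⊑H g Dg) λ { refl → true≢false Dg e∉D }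
          to-tail = reach-bypass (tail-head e) around (reach-sym (together e∈C (tail-head e) Df (joins-ends f)))
      in e , C⊑H e e∈C , λ y sat →
        let start = unbalanced-zero D-cycle unb D⊑ sat Df (joins-ends f) in
        triv y (sat-restore sat (trans (reach-zero sat to-tail start)
          (sym (trans (cong (sg e *_) (reach-zero sat (reach-trans to-tail around) start)) (ℚP.*-zeroʳ (sg e))))))

  not-OK-removable : ∀ {S} → TrivialKernel S → componentsOK S ≡ false → Removable S
  not-OK-removable triv bad with ¬componentsOK bad
  ... | inj₁ b = balancedCycle-removable triv b
  ... | inj₂ t = twoCycles-removable triv t

  isTU⁻ : ∀ {H} → isTU Γ N H ≡ true → countF H ≡ n × UnbalancedUnicyclic H
  isTU⁻ {H} tu = let size , ok = ∧⁻ {eqℕ (countF H) n} tu in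
    ⌊⌋⁻ (countF H ℕP.≟ n) size , componentsOK⇒unicyclic ok

  -- A bad component would allow an edge to be removed, leaving n - 1 edges with trivial kernel,
  -- fewer than `trivial⇒large` permits.
  isTU⁺ : ∀ {H} → countF H ≡ n → TrivialKernel H → isTU Γ N H ≡ true
  isTU⁺ {H} size triv = ∧⁺ (⌊⌋⁺ (countF H ℕP.≟ n) size) (ok (componentsOK H) refl)
    where
    ok : ∀ b → componentsOK H ≡ b → componentsOK H ≡ true
    ok true  eq = eq
    ok false eq = let e , He , triv′ = not-OK-removable triv eq in
      ⊥-elim (ℕP.1+n≰n (ℕP.≤-trans (ℕP.≤-reflexive (trans (sym (countF-remove-edge Γ H e He)) size)) (trivial⇒large triv′)))

  isTU-trivial : ∀ {H} → isTU Γ N H ≡ true → TrivialKernel H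
  isTU-trivial tu = let size , u = isTU⁻ tu in unicyclic-trivial u size

  -- Removable edges are deleted until all components are admissible. The edge count is then `n` by
  -- two opposite bounds: the dual rows are independent, and the kernel is trivial.
  TU-exists : TrivialKernel (allEdges Γ) → ∃ λ H → isTU Γ N H ≡ true
  TU-exists triv = prune (countF (allEdges Γ)) (allEdges Γ) ℕP.≤-refl triv
    where
    prune : ∀ k S → countF S ≤ k → TrivialKernel S → ∃ λ H → isTU Γ N H ≡ true
    prune k S bound triv = go k bound (componentsOK S) refl
      where
      go : ∀ k → countF S ≤ k → ∀ b → componentsOK S ≡ b → ∃ λ H → isTU Γ N H ≡ true
      go _ _ true ok =
        S , isTU⁺ (ℕP.≤-antisym (unicyclic-size (componentsOK⇒unicyclic ok)) (trivial⇒large triv)) triv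
      go k bound false bad with not-OK-removable triv bad
      ... | e , Se , triv′ with k | subst (_≤ k) (countF-remove-edge Γ S e Se) bound
      ...   | suc k′ | s≤s bound′ = prune k′ (remove Γ S e) bound′ triv′

  module _ {H : EdgeSet m} {e : Fin m} (tu : isTU Γ N H ≡ true) (He : H e ≡ true) where
    private
      F = remove Γ H e
      t = tl e
      h = hd e

    onCycle⁺ : Reach F t h → onCycle Γ N H e ≡ true
    onCycle⁺ r =
      let C , cyc , Ce , rest = closing-cycle (remove-self H e) (tail-head e) r
          D , D∈ , D≗ = cyclesIn⁺ cyc λ g Cg → case g ≟F e of λ
            { (yes refl) → He ; (no g≢e) → remove-⊑ H e g (rest g Cg g≢e) }
      in anyList⁺ (λ C → C e) D∈ (trans (D≗ e) Ce)

    -- A cycle through `e` would connect its ends without `e`.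
    bridge-avoided : ¬ Reach F t h → ∀ {C} → isCycle Γ C ≡ true → C ⊑ H → C ⊑ F
    bridge-avoided ¬r {C} cyc C⊑ g Cg = remove⁺ H (C⊑ g Cg) λ { refl → ¬r
      (reach-mono (λ k Ck → let Ck′ , k≢e = remove⁻ C Ck in remove⁺ H (C⊑ k Ck′) k≢e) (cycle-bypass cyc Cg (tail-head e))) }

    onCycle-no : ¬ Reach F t h → onCycle Γ N H e ≡ false
    onCycle-no ¬r = ¬true⇒false λ on →
      let C , C∈ , Ce = anyList⁻ (λ C → C e) (cyclesIn Γ H) on
          cyc , C⊑ = cyclesIn⁻ C∈
      in true≢false (bridge-avoided ¬r cyc C⊑ e Ce) (remove-self H e)

    inCside⁺ : ∀ {u v} → CycleAt F u → Reach F v u → inCside Γ N H e v ≡ true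
    inCside⁺ {u} {v} (C , cyc , C⊑ , f , Cf , r) r′ =
      let D , D∈ , D≗ = cyclesIn⁺ {H} cyc λ g Cg → remove-⊑ H e g (C⊑ g Cg)
          x = proj₁ (ends f)
      in anyF⁺ (λ x → touchesCycle Γ N H x ∧ conn Γ F v x) x
           (∧⁺ (anyF⁺ (λ g → onCycle Γ N H g ∧ incident Γ g x) f
                 (∧⁺ (anyList⁺ (λ C → C f) D∈ (trans (D≗ f) Cf)) (incident⁺ (joins-ends f))))
               (conn⁺ (reach-trans r′ r)))

    inCside-no : ∀ {u v} → ¬ Reach F t h → AcyclicAt F u → Reach F u v → inCside Γ N H e v ≡ false
    inCside-no {u} {v} ¬r ac r = ¬true⇒false λ side →
      let x , hx = anyF⁻ (λ x → touchesCycle Γ N H x ∧ conn Γ F v x) side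
          touch , vx = ∧⁻ {touchesCycle Γ N H x} hx
          f , hf = anyF⁻ (λ g → onCycle Γ N H g ∧ incident Γ g x) touch
          on , at = ∧⁻ {onCycle Γ N H f} hf
          C , C∈ , Cf = anyList⁻ (λ C → C f) (cyclesIn Γ H) on
          cyc , C⊑ = cyclesIn⁻ C∈
          y , j = incident⁻ at
      in ac C cyc (bridge-avoided ¬r cyc C⊑) Cf j (reach-trans r (conn⁻ vx))

    -- The potential of a component without cycles would be a nonzero element of the left kernel.
    -- So, with exactly `n` edges, no component is a tree.
    component-cycle : ∀ v → CycleAt H v
    component-cycle v with acyclicAt? H v
    ... | inj₁ at = at
    ... | inj₂ ac = ⊥-elim (1≢0 (trans (sym (pot-self ac)) (isTU-trivial tu (pot H v) (pot-sat ac) v)))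
      where
      1≢0 : 1ℚ ≢ 0ℚ
      1≢0 ()

    opposite-cycle : ¬ Reach F t h → AcyclicAt F t → CycleAt F h
    opposite-cycle ¬r ac with component-cycle t
    ... | C , cyc , C⊑ , f , Cf , r with reach-split (tail-head e) (reach-sym r) (inj₁ here)
    ...   | inj₁ r′ = ⊥-elim (ac C cyc (bridge-avoided ¬r cyc C⊑) Cf (joins-ends f) (reach-sym r′))
    ...   | inj₂ r′ = C , cyc , bridge-avoided ¬r cyc C⊑ , f , Cf , reach-sym r′

    private
      -- The case distinction of `NHinv` as a function of its four tests, so that each branch
      -- follows by matching on equations for the tests.
      select : Bool → Bool → Bool → Bool → ℚ → ℚ → ℚ → ℚ
      select false _     _     _     x y z = 0ℚ
      select true  true  _     _     x y z = x
      select true  false true  _     x y z = 0ℚ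
      select true  false false true  x y z = y
      select true  false false false x y z = z

      select-if : ∀ a b d p x y z →
        (if not a then 0ℚ else if b then x else if d then 0ℚ else if p then y else z) ≡ select a b d p x y z
      select-if false _     _     _     x y z = refl
      select-if true  true  _     _     x y z = refl
      select-if true  false true  _     x y z = refl
      select-if true  false false true  x y z = refl
      select-if true  false false false x y z = refl

      NHinv-select : ∀ v → NHinv Γ N H e v ≡
        select (conn Γ H t v) (onCycle Γ N H e) (inCside Γ N H e v) (not (isNeg Γ e) ∧ conn Γ F h v)
               (divℚ (w Γ N e ℤ.* pathSgn Γ F t v) 2)
               (divℚ (ℤ.- (w Γ N e ℤ.* sgnPe Γ N F e v)) 1) (divℚ (w Γ N e ℤ.* sgnPe Γ N F e v) 1)
      NHinv-select v =
        select-if (conn Γ H t v) (onCycle Γ N H e) (inCside Γ N H e v) (not (isNeg Γ e) ∧ conn Γ F h v)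
               (divℚ (w Γ N e ℤ.* pathSgn Γ F t v) 2)
               (divℚ (ℤ.- (w Γ N e ℤ.* sgnPe Γ N F e v)) 1) (divℚ (w Γ N e ℤ.* sgnPe Γ N F e v) 1)

    NHinv-outside : ∀ {v} → ¬ Reach H t v → NHinv Γ N H e v ≡ 0ℚ
    NHinv-outside {v} ¬r = trans (NHinv-select v) (lemma (conn-no ¬r))
      where
      lemma : ∀ {a b c d x y z} → a ≡ false → select a b c d x y z ≡ 0ℚ
      lemma refl = refl

    NHinv-on-cycle : ∀ {v} → Reach H t v → onCycle Γ N H e ≡ true →
      NHinv Γ N H e v ≡ divℚ (w Γ N e ℤ.* pathSgn Γ F t v) 2
    NHinv-on-cycle {v} r on = trans (NHinv-select v) (lemma (conn⁺ r) on)
      where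
      lemma : ∀ {a b c d x y z} → a ≡ true → b ≡ true → select a b c d x y z ≡ x
      lemma refl refl = refl

    NHinv-cycle-side : ∀ {v} → onCycle Γ N H e ≡ false → inCside Γ N H e v ≡ true → NHinv Γ N H e v ≡ 0ℚ
    NHinv-cycle-side {v} off side = trans (NHinv-select v) (lemma (conn Γ H t v) off side)
      where
      lemma : ∀ a {b c d x y z} → b ≡ false → c ≡ true → select a b c d x y z ≡ 0ℚ
      lemma true  refl refl = refl
      lemma false refl refl = refl

    NHinv-tail-side : ∀ {v} → Reach H t v → onCycle Γ N H e ≡ false → inCside Γ N H e v ≡ false →
      ¬ Reach F h v → NHinv Γ N H e v ≡ divℚ (w Γ N e ℤ.* pathSgn Γ F t v) 1
    NHinv-tail-side {v} r off side ¬r = trans (NHinv-select v)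
      (trans (lemma (not (isNeg Γ e)) (conn⁺ r) off side (conn-no ¬r))
             (cong (λ b → divℚ (w Γ N e ℤ.* (if b then pathSgn Γ F h v else pathSgn Γ F t v)) 1) (conn-no ¬r)))
      where
      lemma : ∀ i {a b c d x y z} → a ≡ true → b ≡ false → c ≡ false → d ≡ false → select a b c (i ∧ d) x y z ≡ z
      lemma true  refl refl refl refl = refl
      lemma false refl refl refl refl = refl

    -- The separate values for positive and negative `e` on the head side are both the path sign
    -- times `- sg e`, up to the factor `wℚ e`.
    NHinv-head-side : ∀ {v} → Reach H t v → onCycle Γ N H e ≡ false → inCside Γ N H e v ≡ false →
      Reach F h v → NHinv Γ N H e v ≡ wℚ e * - sg e * toℚ (pathSgn Γ F h v)
    NHinv-head-side {v} r off side r′ = trans (NHinv-select v) (trans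
      (cong (λ b → select (conn Γ H t v) (onCycle Γ N H e) (inCside Γ N H e v) (not (isNeg Γ e) ∧ conn Γ F h v)
                     (divℚ (w Γ N e ℤ.* pathSgn Γ F t v) 2)
                     (divℚ (ℤ.- (w Γ N e ℤ.* (if b then P else P′))) 1) (divℚ (w Γ N e ℤ.* (if b then P else P′)) 1))
            (conn⁺ r′))
      (by-sign (conn⁺ r) off side (conn⁺ r′) (sg-times e 1ℚ)))
      where
      P = pathSgn Γ F h v
      P′ = pathSgn Γ F t v
      positive : ∀ w s p → s * 1ℚ ≡ 1ℚ → - (w * p) * 1ℚ ≡ w * - s * p
      positive w s p eq = trans (expand w p) (cong (λ s → w * - s * p) (trans (sym eq) (ℚP.*-identityʳ s)))
        where
        expand : ∀ w p → - (w * p) * 1ℚ ≡ w * - 1ℚ * p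
        expand = solve-∀ ℚ-ring
      negative : ∀ w s p → s * 1ℚ ≡ - 1ℚ → w * p * 1ℚ ≡ w * - s * p
      negative w s p eq = trans (expand w p) (cong (λ s → w * - s * p) (trans (sym eq) (ℚP.*-identityʳ s)))
        where
        expand : ∀ w p → w * p * 1ℚ ≡ w * - (- 1ℚ) * p
        expand = solve-∀ ℚ-ring
      by-sign : ∀ {a b c i d x} → a ≡ true → b ≡ false → c ≡ false → d ≡ true →
        (sg e * 1ℚ ≡ 1ℚ × i ≡ false) ⊎ (sg e * 1ℚ ≡ - 1ℚ × i ≡ true) →
        select a b c (not i ∧ d) x (divℚ (ℤ.- (w Γ N e ℤ.* P)) 1) (divℚ (w Γ N e ℤ.* P) 1) ≡ wℚ e * - sg e * toℚ P
      by-sign refl refl refl refl (inj₁ (s , refl)) = trans (divℚ-invℕ (ℤ.- (w Γ N e ℤ.* P)) 1)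
        (trans (cong (_* 1ℚ) (trans (toℚ-neg (w Γ N e ℤ.* P)) (cong -_ (toℚ-* (w Γ N e) P))))
               (positive (wℚ e) (sg e) (toℚ P) s))
      by-sign refl refl refl refl (inj₂ (s , refl)) = trans (divℚ-invℕ (w Γ N e ℤ.* P) 1)
        (trans (cong (_* 1ℚ) (toℚ-* (w Γ N e) P)) (negative (wℚ e) (sg e) (toℚ P) s))

-- Unbalanced graphs: the family of TU-subgraphs.

module UnbalancedCase {n m : ℕ} (Γ : SignedGraph n m) (N : Matrix ℤ n m) (inc : IsIncidenceMatrix Γ N)
                      (connected : Connected Γ) (unbalanced : ¬ Balanced Γ) where
  open Walks Γ
  open Cycles Γ
  open Potentials Γ
  open Incidence Γ N inc
  open Bicircular Γ N inc
  open TUSubgraphs Γ N inc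

  -- The potential is zero exactly where the formula prescribes 0: outside the component and, for a
  -- bridge, on the side of the cycle. For `tail-side` the cycle on the head side is supplied by
  -- `opposite-cycle`.
  NHinv-dualRow : ∀ {H e} → isTU Γ N H ≡ true → H e ≡ true → (d : DualShape H e) →
    ∀ v → NHinv Γ N H e v ≡ dualRow d v
  NHinv-dualRow {H} {e} tu He d v with reach? H (tl e) v
  NHinv-dualRow {H} {e} tu He d v | no ¬r =
    trans (NHinv-outside tu He ¬r) (sym (trans (cong (scale d *_) (pot-out (outside d))) (ℚP.*-zeroʳ (scale d))))
    where
    outside : (d : DualShape H e) → ¬ Reach (remove Γ H e) (anchor d) v
    outside (on-cycle _ _ _)  r = ¬r (reach-mono (remove-⊑ H e) r)
    outside (tail-side _ _)   r = ¬r (reach-mono (remove-⊑ H e) r)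
    outside (head-side _ _ _) r = ¬r (reach-trans (reach-edge He (tail-head e)) (reach-mono (remove-⊑ H e) r))
  NHinv-dualRow {H} {e} tu He (on-cycle around ac _) v | yes r = begin
    NHinv Γ N H e v                                       ≡⟨ NHinv-on-cycle tu He r (onCycle⁺ tu He around) ⟩
    divℚ (w Γ N e ℤ.* pathSgn Γ (remove Γ H e) (tl e) v) 2
      ≡⟨ divℚ-invℕ (w Γ N e ℤ.* pathSgn Γ (remove Γ H e) (tl e) v) 2 ⟩
    toℚ (w Γ N e ℤ.* pathSgn Γ (remove Γ H e) (tl e) v) * ½
      ≡⟨ cong (_* ½) (trans (toℚ-* (w Γ N e) (pathSgn Γ (remove Γ H e) (tl e) v))
           (cong (wℚ e *_) (sym (pot-in (reach-bypass (tail-head e) around r))))) ⟩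
    wℚ e * pot (remove Γ H e) (tl e) v * ½                ≡⟨ regroup (wℚ e) (pot (remove Γ H e) (tl e) v) ½ ⟩
    wℚ e * ½ * pot (remove Γ H e) (tl e) v                ∎
    where
    open ≡-Reasoning
    regroup : ∀ w p h → w * p * h ≡ w * h * p
    regroup = solve-∀ ℚ-ring
  NHinv-dualRow {H} {e} tu He (tail-side ¬r ac) v | yes r
    with reach-split (tail-head e) (reach-sym r) (inj₁ here)
  ... | inj₂ at-head = trans
    (NHinv-cycle-side tu He (onCycle-no tu He ¬r) (inCside⁺ tu He (opposite-cycle tu He ¬r ac) at-head))
    (sym (trans (cong (wℚ e *_) (pot-out λ r′ → ¬r (reach-trans r′ at-head))) (ℚP.*-zeroʳ (wℚ e))))
  ... | inj₁ at-tail = begin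
    NHinv Γ N H e v
      ≡⟨ NHinv-tail-side tu He r (onCycle-no tu He ¬r) (inCside-no tu He ¬r ac (reach-sym at-tail))
           (λ r′ → ¬r (reach-sym (reach-trans r′ at-tail))) ⟩
    divℚ (w Γ N e ℤ.* pathSgn Γ (remove Γ H e) (tl e) v) 1
      ≡⟨ divℚ-invℕ (w Γ N e ℤ.* pathSgn Γ (remove Γ H e) (tl e) v) 1 ⟩
    toℚ (w Γ N e ℤ.* pathSgn Γ (remove Γ H e) (tl e) v) * 1ℚ
      ≡⟨ ℚP.*-identityʳ (toℚ (w Γ N e ℤ.* pathSgn Γ (remove Γ H e) (tl e) v)) ⟩
    toℚ (w Γ N e ℤ.* pathSgn Γ (remove Γ H e) (tl e) v)
      ≡⟨ toℚ-* (w Γ N e) (pathSgn Γ (remove Γ H e) (tl e) v) ⟩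
    wℚ e * toℚ (pathSgn Γ (remove Γ H e) (tl e) v)
      ≡⟨ cong (wℚ e *_) (pot-in (reach-sym at-tail)) ⟨
    wℚ e * pot (remove Γ H e) (tl e) v ∎
    where open ≡-Reasoning
  NHinv-dualRow {H} {e} tu He (head-side ¬r at ac) v | yes r
    with reach-split (tail-head e) (reach-sym r) (inj₁ here)
  ... | inj₁ at-tail = trans
    (NHinv-cycle-side tu He (onCycle-no tu He ¬r) (inCside⁺ tu He at at-tail))
    (sym (trans (cong (wℚ e * - sg e *_) (pot-out λ r′ → ¬r (reach-sym (reach-trans r′ at-tail))))
                (ℚP.*-zeroʳ (wℚ e * - sg e))))
  ... | inj₂ at-head = trans
    (NHinv-head-side tu He r (onCycle-no tu He ¬r) (inCside-no tu He ¬r ac (reach-sym at-head)) (reach-sym at-head))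
    (cong (wℚ e * - sg e *_) (sym (pot-in (reach-sym at-head))))

  module _ {H : EdgeSet m} {e : Fin m} (tu : isTU Γ N H ≡ true) (He : H e ≡ true) where
    private
      u = proj₂ (isTU⁻ tu)
      d = unicyclic-dual u He

    NHinv-dot : ∀ f → dot A (NHinv Γ N H e) f ≡ dot A (dualRow d) f
    NHinv-dot f = sumℚ-cong λ v → cong (_* A v f) (NHinv-dualRow tu He d v)

    -- `H′` again has `n` edges, so by `isTU⁺` only a trivial kernel has to be shown, and the
    -- component structure of `H′` is never examined.
    TU-exchange : ∀ {H′ f} → H f ≡ false → H′ e ≡ false → H′ f ≡ true →
      (∀ g → g ≢ e → g ≢ f → H g ≡ H′ g) → dot A (NHinv Γ N H e) f ≢ 0ℚ →
      isTU Γ N H′ ≡ true ×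
      cycleWeight H′ ≡ dot A (NHinv Γ N H e) f * dot A (NHinv Γ N H e) f * cycleWeight H
    TU-exchange {H′} {f} Hf H′e H′f agree a≢0 = tu′ ,
      trans (cycleWeight-exchange d u (proj₂ (isTU⁻ tu′)) He H′f same (a≢0 ∘ trans (NHinv-dot f)))
            (cong (λ x → x * x * cycleWeight H) (sym (NHinv-dot f)))
      where
      open ≡-Reasoning
      α = dot A (dualRow d) f
      same : remove Γ H e ≗ remove Γ H′ f
      same g with g ≟F e | g ≟F f
      ... | yes refl | yes refl = ⊥-elim (true≢false He Hf)
      ... | yes refl | no _     rewrite H′e = ∧-zeroʳ (H g)
      ... | no _     | yes refl rewrite Hf = sym (∧-zeroʳ (H′ g))
      ... | no g≢e   | no g≢f   = cong (_∧ true) (agree g g≢e g≢f)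
      size′ : countF H′ ≡ n
      size′ = trans (countF-remove-edge Γ H′ f H′f) (trans (cong suc (sym (countF-cong same)))
        (trans (sym (countF-remove-edge Γ H e He)) (proj₁ (isTU⁻ tu))))
      triv′ : TrivialKernel H′
      triv′ y sat = isTU-trivial tu y (dot⇒sat {H} {y} on-H)
        where
        -- Subtracting β times the dual row from a kernel vector `y` of `H′` gives a vector `z` that
        -- annihilates all of `H`, hence zero. Its value on the column `f` is -βα, so β = 0 and `y`
        -- annihilates `H` itself.
        β = dot A y e
        z : Fin n → ℚ
        z v = y v + - β * dualRow d v
        on-z : ∀ g → H g ≡ true → dot A z g ≡ 0ℚ
        on-z g Hg with g ≟F e
        ... | yes refl = trans (dot-linear A (- β) y (dualRow d) g)
          (trans (cong (λ x → β + - β * x) (dualRow-self d)) (cancel β))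
          where
          cancel : ∀ b → b + - b * 1ℚ ≡ 0ℚ
          cancel = solve-∀ ℚ-ring
        ... | no g≢e = trans (dot-linear A (- β) y (dualRow d) g)
          (trans (cong₂ (λ x x′ → x + - β * x′) (sat⇒dot sat g H′g) (dualRow-other d g Hg g≢e)) (vanish β))
          where
          H′g : H′ g ≡ true
          H′g = trans (sym (agree g g≢e λ { refl → true≢false Hg Hf })) Hg
          vanish : ∀ b → 0ℚ + - b * 0ℚ ≡ 0ℚ
          vanish = solve-∀ ℚ-ring
        z≡0 : ∀ v → z v ≡ 0ℚ
        z≡0 = isTU-trivial tu z (dot⇒sat {H} {z} on-z)
        αβ≡0 : α * β ≡ 0ℚ
        αβ≡0 = begin
          α * β                             ≡⟨ negate α β ⟩
          - (0ℚ + - β * α)                  ≡⟨ cong (λ x → - (x + - β * α)) (sat⇒dot sat f H′f) ⟨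
          - (dot A y f + - β * α)           ≡⟨ cong -_ (dot-linear A (- β) y (dualRow d) f) ⟨
          - dot A z f                       ≡⟨ cong -_ (trans (sumℚ-cong λ v → cong (_* A v f) (z≡0 v)) (dot-zero A f)) ⟩
          0ℚ                                ∎
          where
          negate : ∀ a b → a * b ≡ - (0ℚ + - b * a)
          negate = solve-∀ ℚ-ring
        on-H : ∀ g → H g ≡ true → dot A y g ≡ 0ℚ
        on-H g Hg with g ≟F e
        ... | yes refl = no-zero-divisors α β αβ≡0 (a≢0 ∘ trans (NHinv-dot f))
        ... | no g≢e   = sat⇒dot sat g (trans (sym (agree g g≢e λ { refl → true≢false Hg Hf })) Hg)
      tu′ : isTU Γ N H′ ≡ true
      tu′ = isTU⁺ size′ triv′

  TU-family : BasisFamily A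
  TU-family = record
    { member     = isTU Γ N
    ; wt         = cycleWeight
    ; row        = NHinv Γ N
    ; dual-self  = λ H e tu He → trans (NHinv-dot tu He e) (dualRow-self (unicyclic-dual (proj₂ (isTU⁻ tu)) He))
    ; dual-other = λ H e g tu He Hg g≢e →
        trans (NHinv-dot tu He g) (dualRow-other (unicyclic-dual (proj₂ (isTU⁻ tu)) He) g Hg g≢e)
    ; spanning   = λ H tu y y⊥ f → trans
        (sumℚ-cong λ v → cong (_* A v f) (isTU-trivial tu y (dot⇒sat {H} {y} y⊥) v)) (dot-zero A f)
    ; orthogonal = λ H e tu He z z⊥ → sumℚ-zero _ λ v → trans
        (cong (NHinv Γ N H e v *_) (isTU-trivial tu z (dot⇒sat {H} {z} λ g _ → z⊥ g) v)) (ℚP.*-zeroʳ (NHinv Γ N H e v))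
    ; exchange   = λ H H′ e f tu He Hf H′e H′f → TU-exchange tu He Hf H′e H′f
    }

  unbalancedCycle : ∃ λ C → isCycle Γ C ≡ true × balancedCycle Γ C ≡ false
  unbalancedCycle with searchSubsets (λ C → isCycle Γ C ∧ not (balancedCycle Γ C))
      (λ C≗D → trans (sym (cong₂ (λ a b → a ∧ not b) (isCycle-cong C≗D) (balancedCycle-cong C≗D))))
  ... | inj₁ (C , found) = let h , unb = ∧⁻ {isCycle Γ C} found in C , h , not⁻ unb
  ... | inj₂ none = ⊥-elim (unbalanced λ C h → by-value (balancedCycle Γ C) h (none C))
    where
    by-value : ∀ {a} b → a ≡ true → a ∧ not b ≡ false → b ≡ true
    by-value true  _    _ = refl
    by-value false refl ()

  -- An unbalanced cycle forces a zero, and connectedness spreads it to every vertex.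
  allEdges-trivial : TrivialKernel (allEdges Γ)
  allEdges-trivial y sat v =
    let C , h , unb = unbalancedCycle
        f , Cf = cycle-edge h
    in reach-zero sat (conn⁻ (connected (proj₁ (ends f)) v))
         (unbalanced-zero h unb (λ _ _ → refl) sat Cf (joins-ends f))

  weightSum : ℕ
  weightSum = foldr ℕ._+_ 0 (map (λ H → 4 ℕ.^ c Γ N H) (TU Γ N))

  weightSum≢0 : weightSum ≢ 0
  weightSum≢0 eq =
    let H , tu = TU-exists allEdges-trivial
        size , _ = isTU⁻ tu
        H′ , H′∈ , H′≗ = subsets-complete m H
        tu′ = isTU⁺ {H′} (trans (countF-cong H′≗) size)
                (λ y sat → isTU-trivial tu y (sat-⊑ (λ g Hg → trans (H′≗ g) Hg) sat))
    in positive (∈-filterᵇ⁺ (isTU Γ N) H′∈ tu′) eq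
    where
    positive : ∀ {x L} → x ∈ L → foldr ℕ._+_ 0 (map (λ H → 4 ℕ.^ c Γ N H) L) ≢ 0
    positive {x} (here refl) eq = ℕ.≢-nonZero⁻¹ (4 ℕ.^ c Γ N x) {{ℕP.m^n≢0 4 (c Γ N x)}} (ℕP.m+n≡0⇒m≡0 (4 ℕ.^ c Γ N x) eq)
    positive {L = y ∷ _} (there x∈) eq = positive x∈ (ℕP.m+n≡0⇒n≡0 (4 ℕ.^ c Γ N y) eq)

  unbalanced-formula : ∀ X → IsMoorePenroseInverse A X → ∀ i j → X i j ≡ formulaB Γ N i j
  unbalanced-formula X mp i j = ÷ℕ-unique weightSum (X i j) _ weightSum≢0 (begin
    ℕtoℚ weightSum * X i j                  ≡⟨ cong (_* X i j) total-weight ⟨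
    BasisFamily.total TU-family * X i j     ≡⟨ BasisFamily.moorePenrose TU-family X mp i j ⟩
    BasisFamily.sumOfRows TU-family i j
      ≡⟨ Σ-filterᵇ² (λ H → H i) (isTU Γ N) (λ H → cycleWeight H * NHinv Γ N H i j) (subsets m) ⟨
    Σ[ filterᵇ (λ H → H i) (TU Γ N) ] (λ H → cycleWeight H * NHinv Γ N H i j) ∎)
    where
    open ≡-Reasoning
    total-weight : BasisFamily.total TU-family ≡ ℕtoℚ weightSum
    total-weight = trans (sym (Σ-filterᵇ (isTU Γ N) cycleWeight (subsets m))) (Σ-ℕtoℚ (TU Γ N) (λ H → 4 ℕ.^ c Γ N H))

theorem4p1 : ∀ {n m} (Γ : SignedGraph n m) → 2 ≤ n → Connected Γ →
    (N : Matrix ℤ n m) → IsIncidenceMatrix Γ N →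
    (Ndag : Matrix ℚ m n) → IsMoorePenroseInverse (toℚM N) Ndag →
    (Balanced Γ → ∀ (i : Fin m) (j : Fin n) → Ndag i j ≡ formulaA Γ N i j)
    × (¬ Balanced Γ → ∀ (i : Fin m) (j : Fin n) → Ndag i j ≡ formulaB Γ N i j)
theorem4p1 Γ 2≤n connected N inc Ndag mp =
  (λ balanced → BalancedCase.balanced-formula Γ N inc (ℕP.m<n⇒n≢0 2≤n) connected balanced Ndag mp) ,
  (λ unbalanced → UnbalancedCase.unbalanced-formula Γ N inc connected unbalanced Ndag mp)
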